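{- Each of the following decision problems many-one reduces to the next one: $$\mathsf{Halt}\preceq\mathsf{PCP}\preceq\mathsf{MM}\preceq\mathsf{FRACTRAN}\preceq\mathsf{DIO\_FORM}\preceq\mathsf{DIO\_ELEM}\preceq\mathsf{DIO\_SINGLE}\preceq\mathsf{H10}.$$ As a consequence, $\mathsf{H10}$ is undecidable: a decider for $\mathsf{H10}$ would yield a decider for $\mathsf{Halt}$.
   Context: A many-one reduction $P\preceq Q$ between predicates $P:X\to\mathrm{Prop}$ and $Q:Y\to\mathrm{Prop}$ is a function $f:X\to Y$, definable in constructive type theory (Coq) without axioms and hence computable, such that $P\,x\leftrightarrow Q(f\,x)$ for all $x$. $\mathsf{Halt}$: the halting problem for single-tape Turing machines. $\mathsf{PCP}$: the Post correspondence problem. Given a finite list of pairs of strings, is there a nonempty sequence of indices whose top concatenation equals its bottom concatenation? Minsky machines. An instruction over $n$ registers is $\mathrm{INC}\,\alpha$ or $\mathrm{DEC}\,\alpha\,p$ with $\alpha\in\{0,\dots,n-1\}$ and $p\in\mathbb N$. A machine is a pair $(s,[\iota_0;\dots;\iota_k])$, where $\iota_j$ sits at label $s+j$. A state is $(i,\vec v)$ with $i\in\mathbb N$ the program counter and $\vec v\in\mathbb N^n$. If $i$ labels an instruction, one step is as follows. - $\mathrm{INC}\,\alpha$ yields $(i+1,\vec v[\alpha\mapsto v_\alpha+1])$. - $\mathrm{DEC}\,\alpha\,p$ yields $(i+1,\vec v[\alpha\mapsto v_\alpha-1])$ if $v_\alpha>0$, and yields $(p,\vec v)$ if $v_\alpha=0$.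 No step is possible when $i<s$ or $i\ge s+k+1$. The machine terminates from a state if, after finitely many steps, it reaches a state whose program counter is outside the code. $\mathsf{MM}$: given $n$, a list $P$ of instructions over $n$ registers and $\vec v\in\mathbb N^n$, does $(1,P)$ terminate from $(1,\vec v)$? FRACTRAN. A program is a list of pairs $(p,q)\in\mathbb N\times\mathbb N$, written $p/q$. The step relation $Q:x\succ y$ is defined inductively. - $(p/q::Q'):x\succ y$ if $q\,y=p\,x$. - $(p/q::Q'):x\succ y$ if $q\nmid p\,x$ and $Q':x\succ y$. $Q$ terminates from $s$ if some $x$ is reachable from $s$ by finitely many steps with no $y$ satisfying $Q:x\succ y$. $\mathsf{FRACTRAN}$: given $Q$ and $s\in\mathbb N$, does $Q$ terminate from $s$? Diophantine logic. Formulas are $A,B::= x_i\doteq n\mid x_i\doteq x_j\mid x_i\doteq x_j\dot+x_k\mid x_i\doteq x_j\dot\times x_k\mid A\dot\wedge B\mid A\dot\vee B\mid\dot\exists A$, where $n\in\mathbb N$ and the variables are De Bruijn indices. For a valuation $\nu:\mathbb N\to\mathbb N$, the semantics $[\![A]\!]\nu$ is as follows. - Atomic formulas have their obvious meaning, e.g. $[\![x_i\doteq x_j\dot\times x_k]\!]\nu$ iff $\nu(i)=\nu(j)\nu(k)$. - $\dot\wedge$ and $\dot\vee$ are interpreted as $\wedge$ and $\vee$. - $[\![\dot\exists A]\!]\nu$ iff $\exists n,\,[\![A]\!](n\cdot\nu)$, where $(n\cdot\nu)(0)=n$ and $(n\cdot\nu)(i+1)=\nu(i)$. $\mathsf{DIO\_FORM}$: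 given a formula $A$ and a valuation $\nu$, does $[\![A]\!]\nu$ hold? Elementary constraints are $u\doteq n$, $u\doteq v$, $u\doteq x_i$, $u\doteq v\dot+w$ and $u\doteq v\dot\times w$, with $u,v,w\in\mathbb N$ (variables) and $x_i$ a parameter, $i\in\mathbb N$. Given $\varphi:\mathbb N\to\mathbb N$ (variables) and $\nu:\mathbb N\to\mathbb N$ (parameters), a constraint is satisfied if the corresponding equation holds, e.g. $u\doteq x_i$ holds iff $\varphi(u)=\nu(i)$. $\mathsf{DIO\_ELEM}$: given a list $l$ of constraints and $\nu$, is there $\varphi$ satisfying every constraint in $l$? Polynomials over variable type $U$ and parameter type $V$ are $p::=u\in U\mid x\in V\mid n\in\mathbb N\mid p\dot+p\mid p\dot\times p$, evaluated in $\mathbb N$ under $\varphi:U\to\mathbb N$ and $\nu:V\to\mathbb N$. $\mathsf{DIO\_SINGLE}$: given polynomials $p,q$ with $U=V=\mathbb N$ and $\nu$, is there $\varphi$ with equal values of $p$ and $q$? $\mathsf{H10}$: given $n$ and polynomials $p,q$ with variables in $\{0,\dots,n-1\}$ and no parameters, is there a solution in $\mathbb N^n$ of $p=q$? -}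

module Defs where

open import Data.Nat using (ℕ; zero; suc; _+_; _*_; _∸_; _≤_; _<_)
open import Data.Nat.Divisibility using (_∣_)
open import Data.Fin using (Fin)
import Data.Vec
open import Data.Vec using (Vec; _[_]≔_; _[_]%=_)
open import Data.List using (List; []; _∷_; length; concatMap)
import Data.List
open import Data.Maybe using (Maybe; just; nothing)
open import Data.Bool using (Bool; true; false)
open import Data.Product using (Σ; ∃; _×_; _,_; proj₁; proj₂)
open import Data.Sum using (_⊎_)
open import Data.Empty using (⊥; ⊥-elim)
open import Data.List.Relation.Unary.All using (All)
open import Relation.Nullary using (¬_)
open import Relation.Binary.PropositionalEquality using (_≡_; _≢_)
open import Relation.Binary.Construct.Closure.ReflexiveTransitive using (Star)
open import Function.Bundles using (_⇔_)

-- Many-one reductions: the reduction function is an Agda function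
-- (hence computable, --safe, no postulates).

infix 4 _⪯_
_⪯_ : {X Y : Set} → (X → Set) → (Y → Set) → Set
_⪯_ {X} {Y} P Q = Σ (X → Y) λ f → (x : X) → P x ⇔ Q (f x)

-- Single-tape Turing machines (after the Asperti–Ricciotti style
-- machines of the Coq library): finite alphabet Fin σ, finite state
-- set Fin states, tapes with explicit ends.

data Tape (A : Set) : Set where
  niltape : Tape A
  leftof  : A → List A → Tape A
  rightof : A → List A → Tape A
  midtape : List A → A → List A → Tape A

data Move : Set where
  L R N : Move

module _ {A : Set} where

  current : Tape A → Maybe A
  current (midtape _ a _) = just a
  current _ = nothing

  left : Tape A → List A
  left niltape = []
  left (leftof _ _) = []
  left (rightof a ls) = a ∷ ls
  left (midtape ls _ _) = ls

  right : Tape A → List A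
  right niltape = []
  right (leftof a rs) = a ∷ rs
  right (rightof _ _) = []
  right (midtape _ _ rs) = rs

  tapeMoveRight' : List A → A → List A → Tape A
  tapeMoveRight' ls a [] = rightof a ls
  tapeMoveRight' ls a (r ∷ rs) = midtape (a ∷ ls) r rs

  tapeMoveRight : Tape A → Tape A
  tapeMoveRight niltape = niltape
  tapeMoveRight (rightof a ls) = rightof a ls
  tapeMoveRight (leftof a rs) = midtape [] a rs
  tapeMoveRight (midtape ls a rs) = tapeMoveRight' ls a rs

  tapeMoveLeft' : List A → A → List A → Tape A
  tapeMoveLeft' [] a rs = leftof a rs
  tapeMoveLeft' (l ∷ ls) a rs = midtape ls l (a ∷ rs)

  tapeMoveLeft : Tape A → Tape A
  tapeMoveLeft niltape = niltape
  tapeMoveLeft (leftof a rs) = leftof a rs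
  tapeMoveLeft (rightof a ls) = midtape ls a []
  tapeMoveLeft (midtape ls a rs) = tapeMoveLeft' ls a rs

  tapeMove : Tape A → Move → Tape A
  tapeMove t L = tapeMoveLeft t
  tapeMove t R = tapeMoveRight t
  tapeMove t N = t

  tapeWrite : Tape A → Maybe A → Tape A
  tapeWrite t nothing = t
  tapeWrite t (just a) = midtape (left t) a (right t)

  doAct : Tape A → Maybe A × Move → Tape A
  doAct t (w , m) = tapeMove (tapeWrite t w) m

record TM (σ : ℕ) : Set where
  field
    states : ℕ
    trans  : Fin states → Maybe (Fin σ) → Fin states × (Maybe (Fin σ) × Move)
    start  : Fin states
    halt   : Fin states → Bool

module _ {σ : ℕ} (M : TM σ) where
  open TM M

  TMConf : Set
  TMConf = Fin states × Tape (Fin σ)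

  data TMStep : TMConf → TMConf → Set where
    step : ∀ {q t q' act} → halt q ≡ false →
           trans q (current t) ≡ (q' , act) →
           TMStep (q , t) (q' , doAct t act)

  TMHalts : Tape (Fin σ) → Set
  TMHalts t = ∃ λ (c : TMConf) → Star TMStep (start , t) c × halt (proj₁ c) ≡ true

Halt : (Σ ℕ λ σ → TM σ × Tape (Fin σ)) → Set
Halt (σ , M , t) = TMHalts M t

String : Set
String = List ℕ

tops bots : (P : List (String × String)) → List (Fin (length P)) → String
tops P is = concatMap (λ i → proj₁ (Data.List.lookup P i)) is
bots P is = concatMap (λ i → proj₂ (Data.List.lookup P i)) is

PCP : List (String × String) → Set
PCP P = Σ (List (Fin (length P))) λ is → is ≢ [] × tops P is ≡ bots P is

data Instr (n : ℕ) : Set where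
  INC : Fin n → Instr n
  DEC : Fin n → ℕ → Instr n

data InstrAt {A : Set} : ℕ → List A → ℕ → A → Set where
  here  : ∀ {s ι P} → InstrAt s (ι ∷ P) s ι
  there : ∀ {s x P i ι} → InstrAt (suc s) P i ι → InstrAt s (x ∷ P) i ι

MMState : ℕ → Set
MMState n = ℕ × Vec ℕ n

data MMStep {n : ℕ} (s : ℕ) (P : List (Instr n)) : MMState n → MMState n → Set where
  inc  : ∀ {i v α} → InstrAt s P i (INC α) →
         MMStep s P (i , v) (suc i , v [ α ]%= suc)
  decS : ∀ {i v α p u} → InstrAt s P i (DEC α p) → Data.Vec.lookup v α ≡ suc u →
         MMStep s P (i , v) (suc i , v [ α ]≔ u)
  decZ : ∀ {i v α p} → InstrAt s P i (DEC α p) → Data.Vec.lookup v α ≡ 0 →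
         MMStep s P (i , v) (p , v)

OutOfCode : {A : Set} → ℕ → List A → ℕ → Set
OutOfCode s P i = i < s ⊎ s + length P ≤ i

MMTerminates : {n : ℕ} → ℕ → List (Instr n) → MMState n → Set
MMTerminates {n} s P st =
  ∃ λ (st' : MMState n) → Star (MMStep s P) st st' × OutOfCode s P (proj₁ st')

MM : (Σ ℕ λ n → List (Instr n) × Vec ℕ n) → Set
MM (n , P , v) = MMTerminates 1 P (1 , v)

data FStep : List (ℕ × ℕ) → ℕ → ℕ → Set where
  fhere  : ∀ {p q Q x y} → q * y ≡ p * x → FStep ((p , q) ∷ Q) x y
  fthere : ∀ {p q Q x y} → ¬ (q ∣ p * x) → FStep Q x y → FStep ((p , q) ∷ Q) x y

FTerminates : List (ℕ × ℕ) → ℕ → Set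
FTerminates Q s = ∃ λ x → Star (FStep Q) s x × (∀ y → ¬ FStep Q x y)

FRACTRAN : List (ℕ × ℕ) × ℕ → Set
FRACTRAN (Q , s) = FTerminates Q s

data DioForm : Set where
  _≐c_  : ℕ → ℕ → DioForm
  _≐v_  : ℕ → ℕ → DioForm
  ≐add  : ℕ → ℕ → ℕ → DioForm
  ≐mul  : ℕ → ℕ → ℕ → DioForm
  _∧̇_   : DioForm → DioForm → DioForm
  _∨̇_   : DioForm → DioForm → DioForm
  ∃̇     : DioForm → DioForm

_·_ : ℕ → (ℕ → ℕ) → ℕ → ℕ
(n · ν) zero = n
(n · ν) (suc i) = ν i

⟦_⟧ : DioForm → (ℕ → ℕ) → Set
⟦ i ≐c n ⟧ ν = ν i ≡ n
⟦ i ≐v j ⟧ ν = ν i ≡ ν j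
⟦ ≐add i j k ⟧ ν = ν i ≡ ν j + ν k
⟦ ≐mul i j k ⟧ ν = ν i ≡ ν j * ν k
⟦ A ∧̇ B ⟧ ν = ⟦ A ⟧ ν × ⟦ B ⟧ ν
⟦ A ∨̇ B ⟧ ν = ⟦ A ⟧ ν ⊎ ⟦ B ⟧ ν
⟦ ∃̇ A ⟧ ν = ∃ λ n → ⟦ A ⟧ (n · ν)

DIO-FORM : DioForm × (ℕ → ℕ) → Set
DIO-FORM (A , ν) = ⟦ A ⟧ ν

data DioElem : Set where
  cst  : ℕ → ℕ → DioElem
  var  : ℕ → ℕ → DioElem
  par  : ℕ → ℕ → DioElem
  add  : ℕ → ℕ → ℕ → DioElem
  mul  : ℕ → ℕ → ℕ → DioElem

elemSat : (ℕ → ℕ) → (ℕ → ℕ) → DioElem → Set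
elemSat φ ν (cst u n) = φ u ≡ n
elemSat φ ν (var u v) = φ u ≡ φ v
elemSat φ ν (par u i) = φ u ≡ ν i
elemSat φ ν (add u v w) = φ u ≡ φ v + φ w
elemSat φ ν (mul u v w) = φ u ≡ φ v * φ w

DIO-ELEM : List DioElem × (ℕ → ℕ) → Set
DIO-ELEM (l , ν) = ∃ λ (φ : ℕ → ℕ) → All (elemSat φ ν) l

data Poly (U V : Set) : Set where
  pvar : U → Poly U V
  ppar : V → Poly U V
  pcst : ℕ → Poly U V
  padd : Poly U V → Poly U V → Poly U V
  pmul : Poly U V → Poly U V → Poly U V

evalP : {U V : Set} → (U → ℕ) → (V → ℕ) → Poly U V → ℕ
evalP φ ν (pvar u) = φ u
evalP φ ν (ppar x) = ν x
evalP φ ν (pcst n) = n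
evalP φ ν (padd p q) = evalP φ ν p + evalP φ ν q
evalP φ ν (pmul p q) = evalP φ ν p * evalP φ ν q

DIO-SINGLE : Poly ℕ ℕ × Poly ℕ ℕ × (ℕ → ℕ) → Set
DIO-SINGLE (p , q , ν) = ∃ λ (φ : ℕ → ℕ) → evalP φ ν p ≡ evalP φ ν q

H10 : (Σ ℕ λ n → Poly (Fin n) ⊥ × Poly (Fin n) ⊥) → Set
H10 (n , p , q) = ∃ λ (φ : Fin n → ℕ) → evalP φ ⊥-elim p ≡ evalP φ ⊥-elim q

{-# OPTIONS --safe #-}

-- A configuration of a Turing machine is a word and a computation step a local rewriting step;
-- a derivation becomes a match of dominos when successive words are written in two alternating
-- copies of the alphabet. A Minsky machine searches for a match by decoding 1, 2, 3, … as index
-- sequences and evaluating the two strings as numerals. Its state (i , v) becomes a product of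
-- pairwise coprime numbers, two for each label and one for each register, so that FRACTRAN runs in
-- lockstep with it. That FRACTRAN termination is Diophantine is the DPRM theorem: the solutions of
-- a Pell-type equation have a Diophantine graph and grow exponentially, which gives exponentiation;
-- the parity of binomial coefficients then gives the digitwise order of binary numbers; and with the
-- latter a whole run, packed into numbers in base 2^k, is described by linear equations that hold
-- digit by digit. Formulas become single equations by (p − q)² + (r − s)² = 0 and
-- (p − q)(r − s) = 0, and equations become elementary constraints by naming their subterms.

module Submission where

open import Defs
open import Data.Product using (∃; ∃₂; _×_; _,_; proj₁; proj₂)
open import Data.Sum using (_⊎_; inj₁; inj₂)
open import Data.Empty using (⊥; ⊥-elim)
open import Function using (_∘_; id)
open import Function.Bundles using (_⇔_; mk⇔; Equivalence)
open import Function.Properties.Equivalence using () renaming (sym to ⇔-sym)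
open import Relation.Nullary using (¬_; Dec; yes; no)
open import Relation.Nullary.Decidable using () renaming (map to Dec-map)
open import Relation.Binary.PropositionalEquality
open import Relation.Binary.Construct.Closure.ReflexiveTransitive using (Star; ε; _◅_; _◅◅_)
import Data.Nat.Tactic.RingSolver as ℕR

-- The main obstacle is universal quantification over time: a run makes a claim about each of its
-- steps, and Diophantine formulas quantify only existentially. Packing removes it, because a linear
-- equation between packed numbers splits into one equation per digit once carries are excluded.
-- Masks by `≼` see to that: they bound every digit and force it to zero at times when it is
-- switched off. Non-divisibility, needed because a later fraction acts only if the earlier ones
-- fail, becomes linear by naming quotient and remainder. In the Pell step the difficulty is to
-- certify the index of a solution, which is only logarithmic in its value. A second sequence helps.
-- Its parameter agrees with the first one modulo a large v, so the values agree modulo v, and it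
-- vanishes modulo u, where every value is congruent to its own index. The converse of each machine
-- simulation rests on determinism: a configuration word has one successor, an encoded state enables
-- one fraction, and a halting Minsky run must pass through every state that is known to be
-- reachable.

-- The Pell-type sequence and its norm equation.

module Pell where

  open import Data.Nat
  open import Data.Nat.Properties
  open import Relation.Binary using (tri<; tri≈; tri>)
  open import Data.Nat.Induction using (<-wellFounded)
  open import Induction.WellFounded using (Acc; acc)

  -- A d 0, A d 1, … are the values 0, 1, … of the sequence αₙ₊₂ = (d + 2) αₙ₊₁ − αₙ. Pairing it
  -- with its differences Δ d n = A d (suc n) − A d n makes all recurrences free of subtraction.
  A Δ : ℕ → ℕ → ℕ
  A d zero = 0
  A d (suc n) = A d n + Δ d n
  Δ d zero = 1
  Δ d (suc n) = Δ d n + d * A d (suc n)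

  -- This says that δ + a ω has norm 1, where ω² = d - d ω. The pairs `A d n`, `Δ d n` are the
  -- powers of the unit 1 + d + ω.
  Norm : ℕ → ℕ → ℕ → Set
  Norm d a δ = δ * δ ≡ 1 + d * a * (a + δ)

  dA<Δ : ∀ d n → d * A d n < Δ d n
  dA<Δ d zero = subst (_< 1) (sym (*-zeroʳ d)) (s≤s z≤n)
  dA<Δ d (suc n) = +-mono-≤ {1} (≤-<-trans z≤n (dA<Δ d n)) ≤-refl

  A<A+1 : ∀ d n → A d n < A d (suc n)
  A<A+1 d n = subst (_≤ A d n + Δ d n) (+-comm (A d n) 1)
    (+-monoʳ-≤ (A d n) (≤-<-trans z≤n (dA<Δ d n)))

  A-mono-≤ : ∀ d {m n} → m ≤ n → A d m ≤ A d n
  A-mono-≤ d {m} {n} m≤n = go (≤⇒≤′ m≤n)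
    where
    go : ∀ {n} → m ≤′ n → A d m ≤ A d n
    go ≤′-refl = ≤-refl
    go (≤′-step {n} p) = ≤-trans (go p) (<⇒≤ (A<A+1 d n))

  A-mono-< : ∀ d {m n} → m < n → A d m < A d n
  A-mono-< d {m} m<n = ≤-trans (A<A+1 d m) (A-mono-≤ d m<n)

  A-injective : ∀ d {m n} → A d m ≡ A d n → m ≡ n
  A-injective d {m} {n} eq with <-cmp m n
  ... | tri< m<n _ _ = ⊥-elim (<-irrefl eq (A-mono-< d m<n))
  ... | tri≈ _ m≡n _ = m≡n
  ... | tri> _ _ n<m = ⊥-elim (<-irrefl (sym eq) (A-mono-< d n<m))

  n≤A : ∀ d n → n ≤ A d n
  n≤A d zero = z≤n
  n≤A d (suc n) = ≤-<-trans (n≤A d n) (A<A+1 d n)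

  2A<A+1 : ∀ d n → 1 ≤ d → 2 * A d n < A d (suc n)
  2A<A+1 d n 1≤d = begin-strict
    A d n + (A d n + 0) ≡⟨⟩
    A d n + 1 * A d n   ≤⟨ +-monoʳ-≤ (A d n) (*-monoˡ-≤ (A d n) 1≤d) ⟩
    A d n + d * A d n   <⟨ +-monoʳ-< (A d n) (dA<Δ d n) ⟩
    A d n + Δ d n       ∎
    where open ≤-Reasoning

  -- Exponential growth: it makes `Δ` an upper bound for powers that is Diophantine before
  -- exponentiation is.
  ^≤Δ : ∀ d n → suc d ^ n ≤ Δ d n
  ^≤Δ d zero = ≤-refl
  ^≤Δ d (suc n) = begin
    suc d ^ n + d * suc d ^ n   ≤⟨ *-monoʳ-≤ (suc d) (^≤Δ d n) ⟩
    Δ d n + d * Δ d n           ≤⟨ +-monoʳ-≤ (Δ d n) (*-monoʳ-≤ d (m≤n+m (Δ d n) (A d n))) ⟩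
    Δ d n + d * (A d n + Δ d n) ∎
    where open ≤-Reasoning

  norm-step : ∀ d a δ → Norm d a δ → Norm d (a + δ) (δ + d * (a + δ))
  norm-step d a δ eq = begin
    (δ + d * (a + δ)) * (δ + d * (a + δ))                  ≡⟨ lhs d a δ ⟩
    δ * δ + d * (a + δ) * (δ + δ + d * (a + δ))            ≡⟨ cong (_+ d * (a + δ) * (δ + δ + d * (a + δ))) eq ⟩
    1 + d * a * (a + δ) + d * (a + δ) * (δ + δ + d * (a + δ)) ≡⟨ rhs d a δ ⟩
    1 + d * (a + δ) * (a + δ + (δ + d * (a + δ)))          ∎
    where
    open ≡-Reasoning
    lhs : ∀ d a δ → (δ + d * (a + δ)) * (δ + d * (a + δ)) ≡ δ * δ + d * (a + δ) * (δ + δ + d * (a + δ))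
    lhs = ℕR.solve-∀
    rhs : ∀ d a δ → 1 + d * a * (a + δ) + d * (a + δ) * (δ + δ + d * (a + δ)) ≡ 1 + d * (a + δ) * (a + δ + (δ + d * (a + δ)))
    rhs = ℕR.solve-∀

  norm : ∀ d n → Norm d (A d n) (Δ d n)
  norm d zero = sym (cong (λ z → suc (z * 1)) (*-zeroʳ d))
  norm d (suc n) = norm-step d (A d n) (Δ d n) (norm d n)

  -- A solution (a , δ) with a > 0 is the successor of (a − δ' , δ') where δ' = δ − d a.
  norm-pred : ∀ d a δ → 1 ≤ d → 1 ≤ a → Norm d a δ →
              ∃₂ λ a' δ' → 1 ≤ δ' × a ≡ a' + δ' × δ ≡ δ' + d * a × Norm d a' δ'
  norm-pred d a δ 1≤d 1≤a eq = a' , δ' , 1≤δ' , a≡ , δ≡ , norm'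
    where
    da<δ : d * a < δ
    da<δ with d * a <? δ
    ... | yes p = p
    ... | no ¬p = ⊥-elim (<-irrefl eq (begin-strict
        δ * δ                   ≤⟨ *-monoˡ-≤ δ (≮⇒≥ ¬p) ⟩
        d * a * δ               ≤⟨ *-monoʳ-≤ (d * a) (m≤n+m δ a) ⟩
        d * a * (a + δ)         <⟨ n<1+n _ ⟩
        1 + d * a * (a + δ)     ∎))
      where open ≤-Reasoning
    δ' = δ ∸ d * a
    δ≡ : δ ≡ δ' + d * a
    δ≡ = sym (m∸n+n≡m (<⇒≤ da<δ))
    1≤δ' : 1 ≤ δ'
    1≤δ' = m<n⇒0<n∸m da<δ
    eq' : δ' * δ' + d * a * δ' ≡ 1 + d * a * a
    eq' = +-cancelʳ-≡ (d * a * (δ' + d * a)) _ _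
      (trans (l δ' d a) (trans (subst (λ z → z * z ≡ 1 + d * a * (a + z)) δ≡ eq) (r δ' d a)))
      where
      l : ∀ e d a → e * e + d * a * e + d * a * (e + d * a) ≡ (e + d * a) * (e + d * a)
      l = ℕR.solve-∀
      r : ∀ e d a → 1 + d * a * (a + (e + d * a)) ≡ 1 + d * a * a + d * a * (e + d * a)
      r = ℕR.solve-∀
    δ'≤a : δ' ≤ a
    δ'≤a with δ' ≤? a
    ... | yes p = p
    ... | no ¬p = ⊥-elim (<-irrefl (sym eq') (begin-strict
        1 + d * a * a               <⟨ +-monoˡ-< (d * a * a) (≤-trans (s≤s 1≤a) (≤-trans a<δ' (m≤m*n δ' δ' {{>-nonZero 1≤δ'}}))) ⟩
        δ' * δ' + d * a * a         ≤⟨ +-monoʳ-≤ (δ' * δ') (*-monoʳ-≤ (d * a) (<⇒≤ a<δ')) ⟩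
        δ' * δ' + d * a * δ'        ∎))
      where
      open ≤-Reasoning
      a<δ' = ≰⇒> ¬p
    a' = a ∸ δ'
    a≡ : a ≡ a' + δ'
    a≡ = sym (m∸n+n≡m δ'≤a)
    norm' : δ' * δ' ≡ 1 + d * a' * (a' + δ')
    norm' = +-cancelʳ-≡ (d * a * δ') _ _ (trans eq' (subst (λ z → 1 + d * z * z ≡ 1 + d * a' * (a' + δ') + d * z * δ') (sym a≡) (r d a' δ')))
      where
      r : ∀ d x e → 1 + d * (x + e) * (x + e) ≡ 1 + d * x * (x + e) + d * (x + e) * e
      r = ℕR.solve-∀

  -- Descent along predecessors: a decreases strictly until a = 0, where the norm equation leaves
  -- only δ = 1.
  norm⇒A : ∀ d a δ → 1 ≤ d → Norm d a δ → ∃ λ n → a ≡ A d n × δ ≡ Δ d n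
  norm⇒A d a δ 1≤d = go a δ (<-wellFounded a)
    where
    go : ∀ a δ → Acc _<_ a → Norm d a δ → ∃ λ n → a ≡ A d n × δ ≡ Δ d n
    go zero δ _ eq = 0 , refl , m*n≡1⇒m≡1 δ δ (trans eq (cong (λ z → suc (z * δ)) (*-zeroʳ d)))
    go a@(suc _) δ (acc rs) eq with norm-pred d a δ 1≤d (s≤s z≤n) eq
    ... | a' , δ' , 1≤δ' , a≡ , δ≡ , eq'
      with go a' δ' (rs (subst (a' <_) (sym a≡) (subst (_≤ a' + δ') (+-comm a' 1) (+-monoʳ-≤ a' 1≤δ')))) eq'
    ... | n , p , q = suc n , a≡' , trans δ≡ (cong₂ (λ x y → x + d * y) q a≡')
      where a≡' = trans a≡ (cong₂ _+_ p q)

-- Divisibility and congruences between values and indices.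

module PellCongruences where

  open Pell
  open import Data.Nat using (ℕ; zero; suc; s≤s; z≤n)
  import Data.Nat as ℕ
  import Data.Nat.Properties as ℕ
  import Data.Nat.Divisibility as ℕ∣
  open import Data.Nat.DivMod using (_%_; _/_; m≡m%n+[m/n]*n; m%n<n)
  open import Data.Integer using (ℤ; +_; _+_; _*_; _-_; -_)
  open import Data.Integer.Properties using (pos-*; i≡j⇒i-j≡0; i-j≡0⇒i≡j; *-zeroʳ)
  open import Data.Integer.Divisibility.Signed
  open import Data.Integer.Tactic.RingSolver using (solve-∀)
  open import Data.Nat.Induction using (<-wellFounded)
  open import Induction.WellFounded using (Acc; acc)

  -- Reduces an equation that follows from one hypothesis to a ring identity; `c` is the factor by
  -- which the hypothesis enters.
  lc : ∀ {l r X Y : ℤ} (c : ℤ) → l ≡ r → X - Y ≡ c * (l - r) → X ≡ Y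
  lc {l} {r} {X} {Y} c h e =
    i-j≡0⇒i≡j X Y (trans e (trans (cong (c *_) (i≡j⇒i-j≡0 h)) (*-zeroʳ c)))

  ∣-by : ∀ {k z z'} → k ∣ z → z' ≡ z → k ∣ z'
  ∣-by k∣z eq = subst (_ ∣_) (sym eq) k∣z

  module _ (d : ℕ) where
    private
      D : ℤ
      D = + d

    a δ : ℕ → ℤ
    a n = + A d n
    δ n = + Δ d n

    δ-suc : ∀ n → δ (suc n) ≡ δ n + D * (a n + δ n)
    δ-suc n = cong (λ z → δ n + z) (pos-* d (A d (suc n)))

    normℤ : ∀ n → δ n * δ n ≡ + 1 + D * a n * (a n + δ n)
    normℤ n = begin
      δ n * δ n                                  ≡⟨ pos-* (Δ d n) (Δ d n) ⟨
      + (Δ d n ℕ.* Δ d n)                        ≡⟨ cong +_ (norm d n) ⟩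
      + 1 + + (d ℕ.* A d n ℕ.* (A d n ℕ.+ Δ d n)) ≡⟨ cong (λ z → + 1 + z) (pos-* (d ℕ.* A d n) _) ⟩
      + 1 + + (d ℕ.* A d n) * (a n + δ n)        ≡⟨ cong (λ z → + 1 + z * (a n + δ n)) (pos-* d _) ⟩
      + 1 + D * a n * (a n + δ n)                ∎
      where open ≡-Reasoning

    -- The product of two powers of the unit, expanded with ω² = d - d ω.
    addition : ∀ m n → a (m ℕ.+ n) ≡ a m * δ n + a n * δ m - D * a m * a n
                × δ (m ℕ.+ n) ≡ δ m * δ n + D * a m * a n
    addition zero n = r₁ (a n) (δ n) D , r₂ (a n) (δ n) D
      where
      r₁ : ∀ x y d → x ≡ + 0 * y + x * + 1 - d * + 0 * x
      r₁ = solve-∀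
      r₂ : ∀ x y d → y ≡ + 1 * y + d * + 0 * x
      r₂ = solve-∀
    addition (suc m) n with addition m n
    ... | p , q = trans (cong₂ _+_ p q)
                    (trans (r₁ D (a m) (δ m) (a n) (δ n))
                           (cong (λ z → (a m + δ m) * δ n + a n * z - D * (a m + δ m) * a n) (sym (δ-suc m))))
                , trans (δ-suc (m ℕ.+ n)) (trans (cong₂ (λ x y → y + D * (x + y)) p q)
                    (trans (r₂ D (a m) (δ m) (a n) (δ n))
                           (cong (λ z → z * δ n + D * (a m + δ m) * a n) (sym (δ-suc m)))))
      where
      r₁ : ∀ d a e x y → (a * y + x * e - d * a * x) + (e * y + d * a * x)
                       ≡ (a + e) * y + x * (e + d * (a + e)) - d * (a + e) * x
      r₁ = solve-∀
      r₂ : ∀ d a e x y → e * y + d * a * x + d * ((a * y + x * e - d * a * x) + (e * y + d * a * x))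
                       ≡ (e + d * (a + e)) * y + d * (a + e) * x
      r₂ = solve-∀

    -- The trace of the m-th power of the unit, that is, the companion Lucas sequence.
    v : ℕ → ℤ
    v m = + 2 * δ m - D * a m

    -- The conjugate of the m-th power of the unit is its inverse, so multiplying by the trace adds
    -- the terms at distance m on both sides.
    a-shift : ∀ m n → a (m ℕ.+ (m ℕ.+ n)) + a n ≡ v m * a (m ℕ.+ n)
    a-shift m n = begin
      a (m ℕ.+ (m ℕ.+ n)) + a n ≡⟨ cong (_+ a n) (proj₁ (addition m (m ℕ.+ n))) ⟩
      a m * δ (m ℕ.+ n) + a (m ℕ.+ n) * δ m - D * a m * a (m ℕ.+ n) + a n
        ≡⟨ cong₂ (λ p q → a m * q + p * δ m - D * a m * p + a n) (proj₁ (addition m n)) (proj₂ (addition m n)) ⟩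
      _ ≡⟨ lc (- a n) (normℤ m) (r D (a m) (δ m) (a n) (δ n)) ⟩
      v m * (a m * δ n + a n * δ m - D * a m * a n) ≡⟨ cong (v m *_) (sym (proj₁ (addition m n))) ⟩
      v m * a (m ℕ.+ n) ∎
      where
      open ≡-Reasoning
      r : ∀ d a e x y →
          (a * (e * y + d * a * x) + (a * y + x * e - d * a * x) * e - d * a * (a * y + x * e - d * a * x) + x)
          - (+ 2 * e - d * a) * (a * y + x * e - d * a * x)
          ≡ - x * (e * e - (+ 1 + d * a * (a + e)))
      r = solve-∀

    -- The shift identity with the larger index in the trace. The sign changes because a is an odd
    -- function of its index.
    a-reflect : ∀ i j → a (i ℕ.+ (i ℕ.+ j)) - a j ≡ v (i ℕ.+ j) * a i
    a-reflect i j = begin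
      a (i ℕ.+ (i ℕ.+ j)) - a j ≡⟨ cong (_- a j) (proj₁ (addition i (i ℕ.+ j))) ⟩
      a i * δ (i ℕ.+ j) + a (i ℕ.+ j) * δ i - D * a i * a (i ℕ.+ j) - a j
        ≡⟨ cong₂ (λ p q → a i * q + p * δ i - D * a i * p - a j) (proj₁ (addition i j)) (proj₂ (addition i j)) ⟩
      _ ≡⟨ lc (a j) (normℤ i) (r D (a i) (δ i) (a j) (δ j)) ⟩
      (+ 2 * (δ i * δ j + D * a i * a j) - D * (a i * δ j + a j * δ i - D * a i * a j)) * a i
        ≡⟨ cong₂ (λ p q → (+ 2 * q - D * p) * a i) (proj₁ (addition i j)) (proj₂ (addition i j)) ⟨
      v (i ℕ.+ j) * a i ∎
      where
      open ≡-Reasoning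
      r : ∀ d a e x y →
          (a * (e * y + d * a * x) + (a * y + x * e - d * a * x) * e - d * a * (a * y + x * e - d * a * x) - x)
          - (+ 2 * (e * y + d * a * x) - d * (a * y + x * e - d * a * x)) * a
          ≡ x * (e * e - (+ 1 + d * a * (a + e)))
      r = solve-∀

    -- Writing n = 2 m l ± j with j ≤ m, the shift and reflection identities give a n ≡ ± a j modulo v m.
    a-mod-v : ∀ m → 1 ℕ.≤ m → ∀ n → ∃ λ j → j ℕ.≤ m
            × (v m ∣ a n - a j ⊎ v m ∣ a n + a j)
            × (+ m ∣ + n - + j ⊎ + m ∣ + n + + j)
    a-mod-v m 1≤m n = go n (<-wellFounded n)
      where
      P : ℕ → Set
      P n = ∃ λ j → j ℕ.≤ m
            × (v m ∣ a n - a j ⊎ v m ∣ a n + a j)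
            × (+ m ∣ + n - + j ⊎ + m ∣ + n + + j)
      self : ∀ k x → k ∣ x - x
      self k x = divides (+ 0) (trans (r x) (sym (r' k)))
        where
        r : ∀ x → x - x ≡ + 0
        r = solve-∀
        r' : ∀ k → + 0 * k ≡ + 0
        r' = solve-∀
      shift : ∀ n → P n → P (m ℕ.+ (m ℕ.+ n))
      shift n (j , j≤m , p , q) = j , j≤m , sh p , sm q
        where
        e : v m ∣ a (m ℕ.+ (m ℕ.+ n)) + a n
        e = divides (a (m ℕ.+ n)) (trans (a-shift m n) (r (v m) (a (m ℕ.+ n))))
          where r : ∀ x y → x * y ≡ y * x
                r = solve-∀
        r₁ : ∀ x y z → x + z ≡ (x + y) - (y - z)
        r₁ = solve-∀
        r₂ : ∀ x y z → x - z ≡ (x + y) - (y + z)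
        r₂ = solve-∀
        sh : _ → _
        sh (inj₁ p) = inj₂ (∣-by (∣m∣n⇒∣m-n e p) (r₁ (a (m ℕ.+ (m ℕ.+ n))) (a n) (a j)))
        sh (inj₂ p) = inj₁ (∣-by (∣m∣n⇒∣m-n e p) (r₂ (a (m ℕ.+ (m ℕ.+ n))) (a n) (a j)))
        r₃ : ∀ m n j → m + (m + n) - j ≡ + 2 * m + (n - j)
        r₃ = solve-∀
        r₄ : ∀ m n j → m + (m + n) + j ≡ + 2 * m + (n + j)
        r₄ = solve-∀
        sm : _ → _
        sm (inj₁ p) = inj₁ (∣-by (∣m∣n⇒∣m+n (∣n⇒∣m*n (+ 2) ∣-refl) p) (r₃ (+ m) (+ n) (+ j)))
        sm (inj₂ p) = inj₂ (∣-by (∣m∣n⇒∣m+n (∣n⇒∣m*n (+ 2) ∣-refl) p) (r₄ (+ m) (+ n) (+ j)))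
      reflect : ∀ i j → i ℕ.+ j ≡ m → P (i ℕ.+ m)
      reflect i j refl = j , ℕ.m≤n+m j i
        , inj₁ (divides (a i) (trans (a-reflect i j) (r (v (i ℕ.+ j)) (a i))))
        , inj₂ (divides (+ 2) (r' (+ i) (+ j)))
        where
        r : ∀ x y → x * y ≡ y * x
        r = solve-∀
        r' : ∀ i j → i + (i + j) + j ≡ + 2 * (i + j)
        r' = solve-∀
      go : ∀ n → Acc ℕ._<_ n → P n
      go n (acc rs) with n ℕ.≤? m
      ... | yes n≤m = n , n≤m , inj₁ (self (v m) (a n)) , inj₁ (self (+ m) (+ n))
      ... | no n≰m with ℕ.m≤n⇒∃[o]m+o≡n (ℕ.<⇒≤ (ℕ.≰⇒> n≰m))
      ... | i , refl with i ℕ.≤? m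
      ... | yes i≤m = subst P (ℕ.+-comm i m) (reflect i (m ℕ.∸ i) (ℕ.m+[n∸m]≡n i≤m))
      ... | no i≰m with ℕ.m≤n⇒∃[o]m+o≡n (ℕ.<⇒≤ (ℕ.≰⇒> i≰m))
      ... | k , refl = shift k (go k (rs (ℕ.<-≤-trans (ℕ.m<n+m k 1≤m) (ℕ.m≤n+m _ m))))

    -- The derivative of the k-th power of δ + a ω, read modulo a(k)².
    a-mult : ∀ k q → a k ∣ a (k ℕ.* q)
           × a k * a k ∣ a (k ℕ.* q) * δ k - + q * a k * δ (k ℕ.* q)
    a-mult k zero rewrite ℕ.*-zeroʳ k = divides (+ 0) refl , divides (+ 0) (r (δ k) (a k))
      where
      r : ∀ x y → + 0 * x - + 0 * y * + 1 ≡ + 0 * (y * y)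
      r = solve-∀
    a-mult k (suc q) rewrite ℕ.*-suc k q with a-mult k q
    ... | divides r ar , divides s es = divides (δ K + r * δ k - D * a k * r) eq₁
      , divides (δ k * s - D * r * δ k - (+ 1 + + q) * D * r * a k) eq₂
      where
      K = k ℕ.* q
      r₁ : ∀ d u e r y → u * y + r * u * e - d * u * (r * u) ≡ (y + r * e - d * u * r) * u
      r₁ = solve-∀
      eq₁ : a (k ℕ.+ K) ≡ (δ K + r * δ k - D * a k * r) * a k
      eq₁ = trans (proj₁ (addition k K)) (trans (cong (λ z → a k * δ K + z * δ k - D * a k * z) ar) (r₁ D (a k) (δ k) r (δ K)))
      r₂ : ∀ d u e r y s q → (u * y + r * u * e - d * u * (r * u)) * e - (+ 1 + q) * u * (e * y + d * u * (r * u))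
          - ((e * s - d * r * e - (+ 1 + q) * d * r * u) * (u * u)) ≡ e * ((r * u) * e - q * u * y - s * (u * u))
      r₂ = solve-∀
      eq₂ : a (k ℕ.+ K) * δ k - + suc q * a k * δ (k ℕ.+ K) ≡ (δ k * s - D * r * δ k - (+ 1 + + q) * D * r * a k) * (a k * a k)
      eq₂ = trans (cong₂ (λ x y → x * δ k - + suc q * a k * y) (proj₁ (addition k K)) (proj₂ (addition k K)))
           (trans (cong (λ z → (a k * δ K + z * δ k - D * a k * z) * δ k - + suc q * a k * (δ k * δ K + D * a k * z)) ar)
             (lc (δ k) (subst (λ z → z * δ k - + q * a k * δ K ≡ s * (a k * a k)) ar es) (r₂ D (a k) (δ k) r (δ K) s (+ q))))

    -- Modulo a divisor of `a n` the norm equation reads δ² ≡ 1, so `δ n` is invertible there.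
    a∣x*δ : ∀ {u} n x → u ∣ a n → u ∣ x * δ n → u ∣ x
    a∣x*δ {u} n x (divides r ar) (divides s es) = divides (s * δ n - D * x * r * (a n + δ n))
        (trans (lc (- x) (normℤ n) (r₁ D (a n) (δ n) x)) (trans (cong₂ (λ p q → p * δ n - D * x * q * (a n + δ n)) es ar) (r₂ D (a n) (δ n) x s r u)))
      where
      r₁ : ∀ d a e x → x - (x * e * e - d * x * a * (a + e)) ≡ - x * (e * e - (+ 1 + d * a * (a + e)))
      r₁ = solve-∀
      r₂ : ∀ d a e x s r u → s * u * e - d * x * (r * u) * (a + e) ≡ (s * e - d * x * r * (a + e)) * u
      r₂ = solve-∀

    -- For the multiplier q = `A d k` the congruence of `a-mult` has a multiple of a(k)² on its
    -- right, and `δ k` can be cancelled. This provides the solution s with u² dividing s in a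
    -- certificate.
    a²∣a-mult : ∀ k → a k * a k ∣ a (k ℕ.* A d k)
    a²∣a-mult k with a-mult k (A d k)
    ... | divides r ar , divides s es = 
      divides (s * δ k + δ K * δ k - D * r * (a k + δ k))
        (trans (lc {X = a K} (- a K) (normℤ k) (r₁ D (a k) (δ k) (a K)))
           (trans (cong₂ (λ p q → p * δ k - D * a k * q * (a k + δ k))
                    (lc {X = a K * δ k} {s * (a k * a k) + a k * a k * δ K} (+ 1) es (r₃ (a K * δ k) (a k * a k * δ K) s (a k * a k))) ar)
           (r₂ D (a k) (δ k) (δ K) r s)))
      where
      K = k ℕ.* A d k
      r₁ : ∀ d u e x → x - (x * e * e - d * u * x * (u + e)) ≡ - x * (e * e - (+ 1 + d * u * (u + e)))
      r₁ = solve-∀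
      r₂ : ∀ d u e y r s → (s * (u * u) + u * u * y) * e - d * u * (r * u) * (u + e) ≡ (s * e + y * e - d * r * (u + e)) * (u * u)
      r₂ = solve-∀
      r₃ : ∀ p q s t → p - (s * t + q) ≡ + 1 * (p - q - s * t)
      r₃ = solve-∀

    -- By the addition law the divisibility passes to the index m mod k. The value there is smaller
    -- than `a k`, hence zero.
    a-∣⇒index-∣ : ∀ k m → 1 ℕ.≤ k → a k ∣ a m → ∃ λ q → m ≡ k ℕ.* q
    a-∣⇒index-∣ k@(suc _) m _ ak∣am = m / k , trans m≡ (trans (cong (ℕ._+ k ℕ.* (m / k)) r≡0) refl)
      where
      K = k ℕ.* (m / k)
      m≡ : m ≡ m % k ℕ.+ K
      m≡ = trans (m≡m%n+[m/n]*n m k) (cong (m % k ℕ.+_) (ℕ.*-comm (m / k) k))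
      r₁ : ∀ d x y p q → p * y ≡ (p * y + x * q - d * p * x) - x * (q - d * p)
      r₁ = solve-∀
      ak∣ar : a k ∣ a (m % k)
      ak∣ar = a∣x*δ K (a (m % k)) (proj₁ (a-mult k (m / k)))
        (∣-by (∣m∣n⇒∣m-n (∣-by ak∣am (trans (sym (proj₁ (addition (m % k) K))) (cong a (sym m≡))))
                         (∣m⇒∣m*n (δ (m % k) - D * a (m % k)) (proj₁ (a-mult k (m / k)))))
              (r₁ D (a K) (δ K) (a (m % k)) (δ (m % k))))
      r≡0 : m % k ≡ 0
      r≡0 with m % k in eq
      ... | zero = refl
      ... | suc r = ⊥-elim (ℕ∣.>⇒∤ {{ℕ.>-nonZero (ℕ.<-≤-trans (s≤s z≤n) (n≤A d (suc r)))}}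
                      (A-mono-< d (subst (ℕ._< k) eq (m%n<n m k)))
                      (∣⇒∣ᵤ (subst (λ z → a k ∣ a z) eq ak∣ar)))

    -- Matiyasevich's key divisibility: a condition on values becomes one on indices. With m = k q,
    -- `a-mult` shows that a(k) divides q δ(m), and δ(m) is invertible modulo a(k).
    a²-∣⇒a∣index : ∀ k m → 1 ℕ.≤ k → a k * a k ∣ a m → a k ∣ + m
    a²-∣⇒a∣index k m 1≤k a²∣am with a-∣⇒index-∣ k m 1≤k (∣-trans (divides (a k) refl) a²∣am)
    ... | q , refl with a-mult k q
    ... | ak∣ , a²∣ = ∣-by (∣n⇒∣m*n (+ k) ak∣q) (pos-* k q)
      where
      K = k ℕ.* q
      r₂ : ∀ q u y → q * y * u ≡ q * u * y
      r₂ = solve-∀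
      instance _ = ℕ.>-nonZero (ℕ.≤-trans 1≤k (n≤A d k))
      ak∣q : a k ∣ + q
      ak∣q = a∣x*δ K (+ q) ak∣ (*-cancelʳ-∣ (a k)
        (∣-by (∣m∣n⇒∣m-n (∣m⇒∣m*n (δ k) a²∣am) a²∣)
          (trans (r₂ (+ q) (a k) (δ K)) (r₃ (a K * δ k) (+ q * a k * δ K)))))
        where
        r₃ : ∀ x y → y ≡ x - (x - y)
        r₃ = solve-∀

  -- Modulo d the differences are constantly 1, so a value reveals its index.
  a-mod-d : ∀ d n → + d ∣ a d n - + n × + d ∣ δ d n - + 1
  a-mod-d d zero = divides (+ 0) refl , divides (+ 0) refl
  a-mod-d d (suc n) with a-mod-d d n
  ... | p , q = ∣-by (∣m∣n⇒∣m+n p q) (r₁ (a d n) (δ d n) (+ n))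
              , ∣-by (∣m∣n⇒∣m+n q (∣n⇒∣m*n (a d n + δ d n) ∣-refl)) (trans (cong (_- + 1) (δ-suc d n)) (r₂ (a d n) (δ d n) (+ d)))
    where
    r₁ : ∀ a e n → a + e - (+ 1 + n) ≡ (a - n) + (e - + 1)
    r₁ = solve-∀
    r₂ : ∀ a e d → e + d * (a + e) - + 1 ≡ (e - + 1) + (a + e) * d
    r₂ = solve-∀

  a-cong-d : ∀ {v} d d' n → v ∣ + d' - + d → v ∣ a d' n - a d n × v ∣ δ d' n - δ d n
  a-cong-d d d' zero h = divides (+ 0) refl , divides (+ 0) refl
  a-cong-d d d' (suc n) h with a-cong-d d d' n h
  ... | p , q = p+q
              , ∣-by (∣m∣n⇒∣m+n (∣m∣n⇒∣m+n q (∣n⇒∣m*n (+ d') p+q)) (∣m⇒∣m*n (a d (suc n)) h))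
                  (trans (cong₂ _-_ (δ-suc d' n) (δ-suc d n)) (r₂ (a d' n + δ d' n) (a d n + δ d n) (δ d' n) (δ d n) (+ d') (+ d)))
    where
    r₁ : ∀ a' a e' e → a' + e' - (a + e) ≡ (a' - a) + (e' - e)
    r₁ = solve-∀
    p+q = ∣-by (∣m∣n⇒∣m+n p q) (r₁ (a d' n) (a d n) (δ d' n) (δ d n))
    r₂ : ∀ a' a e' e d' d → e' + d' * a' - (e + d * a) ≡ (e' - e) + d' * (a' - a) + (d' - d) * a
    r₂ = solve-∀

-- Existential certificates for the c-th solution.

module PellCertificates where

  open Pell
  open PellCongruences renaming (a to aℤ; δ to δℤ; v to vℤ)
  open import Data.Nat
  open import Data.Nat.Properties
  open import Data.Nat.Divisibility using (divides)
  import Data.Nat.Divisibility as ℕ∣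
  open import Data.Integer using (ℤ; +_)
  import Data.Integer as ℤ
  import Data.Integer.Properties as ℤ
  import Data.Integer.Divisibility.Signed as ℤ∣
  open ℤ∣ using () renaming (_∣_ to _∣ℤ_)
  import Data.Integer.Tactic.RingSolver as ℤR

  Cong : ℕ → ℕ → ℕ → Set
  Cong m x y = + m ∣ℤ (+ x ℤ.- + y)

  small-multiple : ∀ {v} z n → z ≡ 0 ⊎ v ≤ z → z ≤ n → n < v → z ≡ 0
  small-multiple z n (inj₁ p) _ _ = p
  small-multiple z n (inj₂ p) q r = ⊥-elim (<-irrefl refl (<-≤-trans r (≤-trans p q)))

  ∣⇒0⊎≤ : ∀ {v} z → v ℕ∣.∣ z → z ≡ 0 ⊎ v ≤ z
  ∣⇒0⊎≤ zero _ = inj₁ refl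
  ∣⇒0⊎≤ (suc z) h = inj₂ (ℕ∣.∣⇒≤ h)

  -- Both the distance and the sum of x and y are below v, so a multiple of v among them is 0; a
  -- vanishing sum makes both numbers 0.
  ±-unique : ∀ {v x y} → 2 * x < v → 2 * y < v →
             + v ∣ℤ (+ x ℤ.- + y) ⊎ + v ∣ℤ (+ x ℤ.+ + y) → x ≡ y
  ±-unique {v} {x} {y} p q h = go h
    where
    x+y<v : x + y < v
    x+y<v = *-cancelˡ-< 2 (x + y) v (subst₂ _<_ (sym (*-distribˡ-+ 2 x y)) (cong (λ z → v + z) (sym (+-identityʳ v))) (+-mono-< p q))
    go : + v ∣ℤ (+ x ℤ.- + y) ⊎ + v ∣ℤ (+ x ℤ.+ + y) → x ≡ y
    go (inj₁ h) = ℤ.+-injective (ℤ.i-j≡0⇒i≡j (+ x) (+ y) (ℤ.∣i∣≡0⇒i≡0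
      (small-multiple _ (x + y) (∣⇒0⊎≤ _ (ℤ∣.∣⇒∣ᵤ h)) (ℤ.∣i-j∣≤∣i∣+∣j∣ (+ x) (+ y)) x+y<v)))
    go (inj₂ h) = trans (m+n≡0⇒m≡0 x e) (sym (m+n≡0⇒n≡0 x e))
      where e = small-multiple _ (x + y) (∣⇒0⊎≤ _ (ℤ∣.∣⇒∣ᵤ h)) ≤-refl x+y<v

  -- An even parameter makes values at odd indices odd, which is how v gets an inverse modulo u.
  -- That it is at least 2 gives `2A<v`.
  even : ℕ → ℕ
  even f = 2 * suc f

  v-eq : ∀ d m {w} → w + d * A d m ≡ 2 * Δ d m → + w ≡ vℤ d m
  v-eq d m {w} eq = lc {X = + w} {vℤ d m} (+ 1)
    (trans (cong (λ z → + w ℤ.+ z) (sym (ℤ.pos-* d (A d m)))) (trans (cong +_ eq) (ℤ.pos-* 2 (Δ d m))))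
    (r (+ w) (+ d) (aℤ d m) (δℤ d m))
    where
    r : ∀ w d a e → w ℤ.- (+ 2 ℤ.* e ℤ.- d ℤ.* a) ≡ + 1 ℤ.* (w ℤ.+ d ℤ.* a ℤ.- + 2 ℤ.* e)
    r = ℤR.solve-∀

  Δ<v : ∀ d m {w} → w + d * A d m ≡ 2 * Δ d m → Δ d m < w
  Δ<v d m {w} eq = +-cancelʳ-< (d * A d m) (Δ d m) w (begin-strict
    Δ d m + d * A d m <⟨ +-monoʳ-< (Δ d m) (dA<Δ d m) ⟩
    Δ d m + Δ d m     ≡⟨ cong (λ z → Δ d m + z) (sym (+-identityʳ _)) ⟩
    2 * Δ d m         ≡⟨ sym eq ⟩
    w + d * A d m     ∎)
    where open ≤-Reasoning

  2≤even : ∀ f → 2 ≤ even f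
  2≤even f = *-monoʳ-≤ 2 (s≤s z≤n)

  2A<v : ∀ f m {w} → w + even f * A (even f) m ≡ 2 * Δ (even f) m → 2 * A (even f) m < w
  2A<v f m eq = ≤-<-trans (*-monoˡ-≤ (A (even f) m) (2≤even f)) (<-trans (dA<Δ (even f) m) (Δ<v (even f) m eq))

  Cong⇐+* : ∀ {x y v k} → x ≡ y + v * k → Cong v x y
  Cong⇐+* {x} {y} {v} {k} refl = ℤ∣.divides (+ k) (trans (cong (λ z → + y ℤ.+ z ℤ.- + y) (ℤ.pos-* v k)) (r (+ y) (+ v) (+ k)))
    where
    r : ∀ y v k → y ℤ.+ v ℤ.* k ℤ.- y ≡ k ℤ.* v
    r = ℤR.solve-∀

  0<A⇒0<n : ∀ d n → 0 < A d n → 0 < n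
  0<A⇒0<n d (suc n) _ = s≤s z≤n

  -- The numbers u and s are values for the parameter d, at indices K and m; v is the trace at m,
  -- and x is a value for the second parameter w. Since u² divides s, u divides m. The factor
  -- `suc l` keeps s, and hence m, positive.
  record Certificate (d c a : ℕ) : Set where
    field
      u u' s s' l v w k h x y : ℕ
      norm-u : Norm d u u'
      norm-s : Norm d s s'
      u²∣s   : s ≡ suc l * (u * u)
      v-def  : v + d * s ≡ 2 * s'
      w≡d    : w ≡ d + v * k
      u∣w    : w ≡ h * u
      norm-x : Norm w x y
      2a<u   : 2 * a < u
      2c<u   : 2 * c < u
      2a<v   : 2 * a < v
      x≡a    : Cong v x a
      x≡c    : Cong u x c

  -- Let n be the index of x, and n ≡ ± j modulo m with j ≤ m. Modulo v, a ≡ x ≡ A d n ≡ ± A d j;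
  -- modulo u, c ≡ x ≡ n ≡ ± j. The size conditions turn both congruences into equations, so j is
  -- the index of a and equals c.
  pell-sound : ∀ f c a b → Norm (even f) a b → Certificate (even f) c a → a ≡ A (even f) c × b ≡ Δ (even f) c
  pell-sound f c a b na record
    { u = u ; u' = u' ; s = s ; s' = s' ; l = l ; v = v ; w = w ; k = k ; h = h ; x = x ; y = y
    ; norm-u = nu ; norm-s = ns ; u²∣s = s≡ ; v-def = v≡ ; w≡d = w≡₁ ; u∣w = w≡₂ ; norm-x = nx
    ; 2a<u = 2a<u ; 2c<u = 2c<u ; 2a<v = 2a<v ; x≡a = x≡a ; x≡c = x≡c }
    with norm⇒A (even f) a b 1≤d na | norm⇒A (even f) u u' 1≤d nu | norm⇒A (even f) s s' 1≤d ns | norm⇒A w x y 1≤w nx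
    where
    1≤d : 1 ≤ even f
    1≤d = s≤s z≤n
    1≤w = ≤-trans (≤-trans 1≤d (m≤m+n (even f) (v * k))) (≤-reflexive (sym w≡₁))
  ... | i , refl , refl | K , refl , refl | m , refl , refl | n , refl , refl
    with a-mod-v (even f) m 1≤m n
    where
    1≤u : 1 ≤ A (even f) K
    1≤u = ≤-trans (s≤s z≤n) 2c<u
    1≤s : 1 ≤ A (even f) m
    1≤s = subst (1 ≤_) (sym s≡) (≤-trans (*-mono-≤ 1≤u 1≤u) (m≤m+n _ _))
    1≤m : 1 ≤ m
    1≤m = 0<A⇒0<n (even f) m 1≤s
  ... | j , j≤m , α± , j± = cong (A d) i≡c , cong (Δ d) i≡c
    where
    d = even f
    1≤K : 1 ≤ K
    1≤K = 0<A⇒0<n d K (≤-trans (s≤s z≤n) 2c<u)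
    u∣m : + u ∣ℤ + m
    u∣m = a²-∣⇒a∣index d K m 1≤K (ℤ∣.divides (+ suc l)
      (trans (cong +_ s≡) (trans (ℤ.pos-* (suc l) (u * u)) (cong (λ z → + suc l ℤ.* z) (ℤ.pos-* u u)))))
    x-n : + v ∣ℤ (+ x ℤ.- aℤ d n)
    x-n = proj₁ (a-cong-d d w n (Cong⇐+* {k = k} w≡₁))
    x-n' : + u ∣ℤ (+ x ℤ.- + n)
    x-n' = ℤ∣.∣-trans (ℤ∣.divides (+ h) (trans (cong +_ w≡₂) (ℤ.pos-* h u))) (proj₁ (a-mod-d w n))
    r₁ : ∀ a x y z → a ℤ.- z ≡ (x ℤ.- y) ℤ.+ (y ℤ.- z) ℤ.- (x ℤ.- a)
    r₁ = ℤR.solve-∀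
    r₂ : ∀ a x y z → a ℤ.+ z ≡ (x ℤ.- y) ℤ.+ (y ℤ.+ z) ℤ.- (x ℤ.- a)
    r₂ = ℤR.solve-∀
    combine : ∀ {v} a x y z → v ∣ℤ (x ℤ.- a) → v ∣ℤ (x ℤ.- y) → v ∣ℤ (y ℤ.- z) ⊎ v ∣ℤ (y ℤ.+ z) →
              v ∣ℤ (a ℤ.- z) ⊎ v ∣ℤ (a ℤ.+ z)
    combine {v} a x y z p q (inj₁ r) = inj₁ (∣-by (ℤ∣.∣m∣n⇒∣m-n (ℤ∣.∣m∣n⇒∣m+n q r) p) (r₁ a x y z))
    combine {v} a x y z p q (inj₂ r) = inj₂ (∣-by (ℤ∣.∣m∣n⇒∣m-n (ℤ∣.∣m∣n⇒∣m+n q r) p) (r₂ a x y z))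
    a≡Aj : a ≡ A d j
    a≡Aj = ±-unique {v = v} 2a<v (≤-<-trans (*-monoʳ-≤ 2 (A-mono-≤ d j≤m)) (2A<v f m v≡))
      (combine (+ a) (+ x) (aℤ d n) (aℤ d j) x≡a x-n (subst (λ z → z ∣ℤ _ ⊎ z ∣ℤ _) (sym (v-eq d m v≡)) α±))
    mod-u : + m ∣ℤ (+ n ℤ.- + j) ⊎ + m ∣ℤ (+ n ℤ.+ + j) → + u ∣ℤ (+ n ℤ.- + j) ⊎ + u ∣ℤ (+ n ℤ.+ + j)
    mod-u (inj₁ p) = inj₁ (ℤ∣.∣-trans u∣m p)
    mod-u (inj₂ p) = inj₂ (ℤ∣.∣-trans u∣m p)
    c≡j : c ≡ j
    c≡j = ±-unique {v = u} 2c<u (≤-<-trans (*-monoʳ-≤ 2 (n≤A d j)) (subst (λ z → 2 * z < u) a≡Aj 2a<u))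
      (combine (+ c) (+ x) (+ n) (+ j) x≡c x-n' (mod-u j±))
    i≡c : i ≡ c
    i≡c = trans (A-injective d a≡Aj) (sym c≡j)

  A-mod-ℕ : ∀ d n → (∃ λ q → A d n ≡ n + d * q) × (∃ λ q → Δ d n ≡ 1 + d * q)
  A-mod-ℕ d zero = (0 , sym (*-zeroʳ d)) , (0 , cong suc (sym (*-zeroʳ d)))
  A-mod-ℕ d (suc n) with A-mod-ℕ d n
  ... | (q , p) , (q' , p') = (q + q' , trans (cong₂ _+_ p p') (r n d q q'))
                            , (q' + A d (suc n) , trans (cong (_+ d * A d (suc n)) p') (r' d q' (A d (suc n))))
    where
    r : ∀ n d q q' → n + d * q + (1 + d * q') ≡ suc n + d * (q + q')
    r = ℕR.solve-∀
    r' : ∀ d q x → 1 + d * q + d * x ≡ 1 + d * (q + x)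
    r' = ℕR.solve-∀

  -- Modulo the odd number u = 2 t + 1 dividing s, v s' ≡ 2 and hence − t s' inverts v, so that
  -- d + v k is a multiple of u for k = d t s'.
  coprime-solution : ∀ d u t s s' l v → Norm d s s' → u ≡ 1 + 2 * t → s ≡ suc l * (u * u) →
    v + d * s ≡ 2 * s' → ∃ λ h → d + v * (d * t * s') ≡ h * u
  coprime-solution d u t s s' l v ns u≡ s≡ v≡ = d + d * t * (suc l * u * z) , (begin
      d + v * (d * t * s')                        ≡⟨ r₁ d v t s' ⟩
      d + d * t * (v * s')                        ≡⟨ cong (λ n → d + d * t * n) vs' ⟩
      d + d * t * (2 + s * z)                      ≡⟨ cong (λ n → d + d * t * (2 + n * z)) s≡ ⟩
      d + d * t * (2 + suc l * (u * u) * z)        ≡⟨ r₂ d t (suc l) u z ⟩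
      d * (1 + 2 * t) + d * t * (suc l * u * z) * u ≡⟨ cong (λ n → d * n + d * t * (suc l * u * z) * u) (sym u≡) ⟩
      d * u + d * t * (suc l * u * z) * u          ≡⟨ sym (*-distribʳ-+ u d _) ⟩
      (d + d * t * (suc l * u * z)) * u            ∎)
    where
    open ≡-Reasoning
    z = 2 * d * s + d * s'
    r : ∀ d s e → 2 * (1 + d * s * (s + e)) ≡ 2 + s * (2 * d * s + d * e) + d * s * e
    r = ℕR.solve-∀
    r₁ : ∀ d v t e → d + v * (d * t * e) ≡ d + d * t * (v * e)
    r₁ = ℕR.solve-∀
    r₂ : ∀ d t l u z → d + d * t * (2 + l * (u * u) * z) ≡ d * (1 + 2 * t) + d * t * (l * u * z) * u
    r₂ = ℕR.solve-∀
    vs' : v * s' ≡ 2 + s * (2 * d * s + d * s')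
    vs' = +-cancelʳ-≡ (d * s * s') _ _ (trans (sym (*-distribʳ-+ s' v (d * s))) (trans (cong (_* s') v≡)
          (trans (*-assoc 2 s' s') (trans (cong (2 *_) ns) (r d s s')))))

  A-odd : ∀ d e c → d ≡ 2 * e → ∃ λ t → A d (suc (2 * c)) ≡ 1 + 2 * t
  A-odd d e c refl with A-mod-ℕ d (suc (2 * c))
  ... | (q , p) , _ = c + e * q , trans p (r c e q)
    where
    r : ∀ c f q → suc (2 * c) + 2 * f * q ≡ 1 + 2 * (c + f * q)
    r = ℕR.solve-∀

  ∣-mult : ∀ {n s} → 1 ≤ s → n ℕ∣.∣ s → ∃ λ l → s ≡ suc l * n
  ∣-mult 1≤s (divides zero eq) = ⊥-elim (<-irrefl refl (subst (1 ≤_) eq 1≤s))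
  ∣-mult 1≤s (divides (suc l) eq) = l , eq

  A²∣A-mult : ∀ d k → A d k * A d k ℕ∣.∣ A d (k * A d k)
  A²∣A-mult d k = subst (ℕ∣._∣ A d (k * A d k)) (ℤ.abs-* (+ A d k) (+ A d k)) (ℤ∣.∣⇒∣ᵤ (a²∣a-mult d k))

  pell-complete : ∀ f c → Certificate (even f) c (A (even f) c)
  pell-complete f c = go (even f) (A-odd (even f) (suc f) c refl) (s≤s z≤n) (λ m w → 2A<v f m {w})
    where
    go : ∀ d → (∃ λ t → A d (suc (2 * c)) ≡ 1 + 2 * t) → 1 ≤ d →
         (∀ m w → w + d * A d m ≡ 2 * Δ d m → 2 * A d m < w) → Certificate d c (A d c)
    go d (t , u≡) 1≤d 2A<v = choose-u (A d K) (n≤A d K) u≡ (2A<A+1 d c 1≤d) (A-mono-≤ d (s≤s (m≤m+n c (c + 0))))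
        (norm d K) (A²∣A-mult d K)
      where
      -- Odd, so that u is odd; above c, so that u exceeds twice `A d c`; above 2 c, since u is at
      -- least its index.
      K = suc (2 * c)
      choose-u : ∀ u → K ≤ u → u ≡ 1 + 2 * t → 2 * A d c < A d (suc c) → A d (suc c) ≤ u →
        Norm d u (Δ d K) → u * u ℕ∣.∣ A d (K * u) → Certificate d c (A d c)
      -- At the index K u the value is divisible by u², by `A²∣A-mult`.
      choose-u u K≤u u≡ p q nu u²∣ = choose-s (K * u) (m≤m*n K u {{>-nonZero 1≤u}}) u²∣
        where
        1≤u : 1 ≤ u
        1≤u = ≤-trans (s≤s z≤n) K≤u
        choose-s : ∀ m → K ≤ m → u * u ℕ∣.∣ A d m → Certificate d c (A d c)
        choose-s m K≤m u²∣ = choose-v (2 * Δ d m ∸ d * A d m)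
            (m∸n+n≡m (≤-trans (<⇒≤ (dA<Δ d m)) (m≤m+n (Δ d m) _)))
            (∣-mult (≤-trans (≤-trans (s≤s z≤n) K≤m) (n≤A d m)) u²∣)
          where
          choose-v : ∀ v → v + d * A d m ≡ 2 * Δ d m → (∃ λ l → A d m ≡ suc l * (u * u)) → Certificate d c (A d c)
          choose-v v v≡ (l , s≡) with coprime-solution d u t (A d m) (Δ d m) l v (norm d m) u≡ s≡ v≡
          ... | h , w≡ = choose-w (d + v * (d * t * Δ d m)) refl w≡
            where
            choose-w : ∀ w → w ≡ d + v * (d * t * Δ d m) → w ≡ h * u → Certificate d c (A d c)
            choose-w w w≡₁ w≡₂ = record
              { norm-u = nu ; norm-s = norm d m ; u²∣s = s≡ ; v-def = v≡ ; w≡d = w≡₁ ; u∣w = w≡₂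
              ; l = l ; k = d * t * Δ d m ; h = h ; norm-x = norm w c ; 2a<u = <-≤-trans p q ; 2c<u = K≤u
              ; 2a<v = ≤-<-trans (*-monoʳ-≤ 2 (A-mono-≤ d (≤-trans (≤-trans (m≤m+n c _) (n≤1+n _)) K≤m))) (2A<v m v v≡)
              ; x≡a = proj₁ (a-cong-d d w c (Cong⇐+* {w} {d} {v} {d * t * Δ d m} w≡₁))
              ; x≡c = ℤ∣.∣-trans (ℤ∣.divides (+ h) (trans (cong +_ w≡₂) (ℤ.pos-* h u))) (proj₁ (a-mod-d w c))
              }

-- Powers read off modulo a quadratic expression.

module Exponentiation where

  open Pell
  open PellCongruences renaming (a to aℤ; δ to δℤ; v to vℤ)
  open PellCertificates
  open import Data.Nat
  open import Data.Nat.Properties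
  open import Data.Integer using (ℤ; +_)
  import Data.Integer as ℤ
  import Data.Integer.Properties as ℤ
  import Data.Integer.Divisibility.Signed as ℤ∣
  open ℤ∣ using () renaming (_∣_ to _∣ℤ_)
  import Data.Integer.Tactic.RingSolver as ℤR

  -- p is a root of X² − (d + 2) X + 1 modulo m = (d + 2) p − p² − 1, so p^q is read off the q-th solution.
  ^-cong : ∀ d p m → suc m + p * p ≡ (d + 2) * p → ∀ q →
           Cong m (p ^ q + suc d * A d q) (Δ d q + p * A d q)
  ^-cong d p m eq zero rewrite *-zeroʳ d | *-zeroʳ p = ℤ∣.divides (+ 0) refl
  ^-cong d p m eq (suc q) with ^-cong d p m eq q
  ... | ℤ∣.divides s h = ℤ∣.divides (+ p ℤ.* s ℤ.- aℤ d q) (begin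
      + (p * p ^ q + suc d * A d (suc q)) ℤ.- + (Δ d (suc q) + p * A d (suc q))
        ≡⟨ cong₂ ℤ._-_ (cong₂ ℤ._+_ (ℤ.pos-* p (p ^ q)) (ℤ.pos-* (suc d) (A d (suc q))))
                       (cong₂ ℤ._+_ (δ-suc d q) (ℤ.pos-* p (A d (suc q)))) ⟩
      P ℤ.* E ℤ.+ (+ 1 ℤ.+ D) ℤ.* (α ℤ.+ β) ℤ.- (β ℤ.+ D ℤ.* (α ℤ.+ β) ℤ.+ P ℤ.* (α ℤ.+ β))
        ≡⟨ lc P h′ (r₁ P E D α β s M) ⟩
      P ℤ.* (s ℤ.* M) ℤ.- (D ℤ.* P ℤ.+ + 2 ℤ.* P ℤ.- P ℤ.* P ℤ.- + 1) ℤ.* α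
        ≡⟨ lc α eq′ (r₂ P D α s M) ⟩
      (P ℤ.* s ℤ.- α) ℤ.* M ∎)
    where
    open ≡-Reasoning
    P = + p ; E = + (p ^ q) ; D = + d ; α = aℤ d q ; β = δℤ d q ; M = + m
    h′ : E ℤ.+ (+ 1 ℤ.+ D) ℤ.* α ℤ.- (β ℤ.+ P ℤ.* α) ≡ s ℤ.* M
    h′ = trans (sym (cong₂ (λ x y → E ℤ.+ x ℤ.- (β ℤ.+ y)) (ℤ.pos-* (suc d) (A d q)) (ℤ.pos-* p (A d q)))) h
    eq′ : + 1 ℤ.+ M ℤ.+ P ℤ.* P ≡ (D ℤ.+ + 2) ℤ.* P
    eq′ = trans (cong (λ z → + suc m ℤ.+ z) (sym (ℤ.pos-* p p))) (trans (cong +_ eq) (ℤ.pos-* (d + 2) p))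
    r₁ : ∀ P E D α β s M →
         P ℤ.* E ℤ.+ (+ 1 ℤ.+ D) ℤ.* (α ℤ.+ β) ℤ.- (β ℤ.+ D ℤ.* (α ℤ.+ β) ℤ.+ P ℤ.* (α ℤ.+ β))
         ℤ.- (P ℤ.* (s ℤ.* M) ℤ.- (D ℤ.* P ℤ.+ + 2 ℤ.* P ℤ.- P ℤ.* P ℤ.- + 1) ℤ.* α)
         ≡ P ℤ.* (E ℤ.+ (+ 1 ℤ.+ D) ℤ.* α ℤ.- (β ℤ.+ P ℤ.* α) ℤ.- s ℤ.* M)
    r₁ = ℤR.solve-∀
    r₂ : ∀ P D α s M → P ℤ.* (s ℤ.* M) ℤ.- (D ℤ.* P ℤ.+ + 2 ℤ.* P ℤ.- P ℤ.* P ℤ.- + 1) ℤ.* α ℤ.- (P ℤ.* s ℤ.- α) ℤ.* M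
         ≡ α ℤ.* (+ 1 ℤ.+ M ℤ.+ P ℤ.* P ℤ.- (D ℤ.+ + 2) ℤ.* P)
    r₂ = ℤR.solve-∀

  -- With p = p' + 1 and d = 2 (p + t), the modulus (d + 2) p - p² - 1 equals (p + 2 t + 2) p - 1.
  -- The summand t is there to make it large compared with the power.
  modulus-eq : ∀ p' t m → suc m ≡ (suc p' + 2 * t + 2) * suc p' →
               suc m + suc p' * suc p' ≡ (even (p' + t) + 2) * suc p'
  modulus-eq p' t m eq = trans (cong (_+ suc p' * suc p') eq) (r p' t)
    where
    r : ∀ p' t → (suc p' + 2 * t + 2) * suc p' + suc p' * suc p' ≡ (2 * suc (p' + t) + 2) * suc p'
    r = ℕR.solve-∀

  2^<modulus : ∀ p' q t m → t ≡ Δ (even p') q → suc m ≡ (suc p' + 2 * t + 2) * suc p' → 2 * suc p' ^ q < m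
  2^<modulus p' q t m refl eq = s≤s⁻¹ (begin-strict
    suc (2 * suc p' ^ q)               ≤⟨ s≤s (*-monoʳ-≤ 2 p^q≤t) ⟩
    suc (2 * t)                        <⟨ +-monoʳ-≤ 2 (≤-reflexive refl) ⟩
    2 + 2 * t                          ≡⟨ +-comm 2 (2 * t) ⟩
    2 * t + 2                          ≤⟨ +-monoˡ-≤ 2 (m≤n+m (2 * t) (suc p')) ⟩
    suc p' + 2 * t + 2                 ≤⟨ m≤m*n _ (suc p') ⟩
    (suc p' + 2 * t + 2) * suc p'      ≡⟨ sym eq ⟩
    suc m                              ∎)
    where
    open ≤-Reasoning
    p^q≤t : suc p' ^ q ≤ t
    p^q≤t = ≤-trans (^-monoˡ-≤ q (s≤s (≤-trans (n≤1+n p') (m≤m+n (suc p') _)))) (^≤Δ (even p') q)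

  -- Both r and the power are below half the modulus, since t bounds the power by `^≤Δ`; so
  -- congruence is equality.
  ^-unique : ∀ p' q r t m → t ≡ Δ (even p') q → suc m ≡ (suc p' + 2 * t + 2) * suc p' → 2 * r < m →
    let d = even (p' + t) in Cong m (r + suc d * A d q) (Δ d q + suc p' * A d q) → r ≡ suc p' ^ q
  ^-unique p' q r t m t≡ m≡ 2r<m h = ±-unique {v = m} 2r<m (2^<modulus p' q t m t≡ m≡)
    (inj₁ (∣-by (ℤ∣.∣m∣n⇒∣m-n h (^-cong d (suc p') m (modulus-eq p' t m m≡) q))
      (r₁ (+ r) (+ (suc p' ^ q)) (+ (suc d * A d q)) (+ (Δ d q + suc p' * A d q)))))
    where
    d = even (p' + t)
    r₁ : ∀ x y z w → x ℤ.- y ≡ (x ℤ.+ z ℤ.- w) ℤ.- (y ℤ.+ z ℤ.- w)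
    r₁ = ℤR.solve-∀

-- Binomial coefficients as digits, and Lucas's theorem modulo 2.

module BinomialParity where

  open import Data.Nat
  open import Data.Nat.Properties
  open import Data.Bool using (Bool; true; false; _xor_; _∧_; not)
  open import Data.Bool.Properties using (not-involutive; not-distribˡ-xor; xor-same; xor-identityʳ; ∧-assoc; ∧-conicalˡ; ∧-conicalʳ)
  open import Relation.Binary using (tri<; tri≈; tri>)

  +*-lex-< : ∀ {k} a b x y → a < k → x < y → a + k * x < b + k * y
  +*-lex-< {k} a b x y a<k x<y = begin-strict
    a + k * x <⟨ +-monoˡ-< (k * x) a<k ⟩
    k + k * x ≡⟨ *-suc k x ⟨
    k * suc x ≤⟨ *-monoʳ-≤ k x<y ⟩
    k * y     ≤⟨ m≤n+m _ b ⟩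
    b + k * y ∎
    where open ≤-Reasoning

  +*-injective : ∀ {k} a b x y → a < k → b < k → a + k * x ≡ b + k * y → a ≡ b × x ≡ y
  +*-injective {k} a b x y a<k b<k eq with <-cmp x y
  ... | tri≈ _ refl _ = +-cancelʳ-≡ (k * x) a b eq , refl
  ... | tri< x<y _ _ = ⊥-elim (<-irrefl eq (+*-lex-< a b x y a<k x<y))
  ... | tri> _ _ y<x = ⊥-elim (<-irrefl (sym eq) (+*-lex-< b a y x b<k y<x))

  binom : ℕ → ℕ → ℕ
  binom _ zero = 1
  binom zero (suc k) = 0
  binom (suc n) (suc k) = binom n k + binom n (suc k)

  -- high u n k = Σ_{i ≥ k} binom n i · u^(i − k)
  high : ℕ → ℕ → ℕ → ℕ
  high u n zero = suc u ^ n
  high u zero (suc k) = 0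
  high u (suc n) (suc k) = high u n k + high u n (suc k)

  high-suc : ∀ u n k → high u n k ≡ binom n k + u * high u n (suc k)
  high-suc u zero zero = sym (cong suc (*-zeroʳ u))
  high-suc u zero (suc k) = sym (*-zeroʳ u)
  high-suc u (suc n) zero = begin
    suc u ^ n + u * suc u ^ n                    ≡⟨ cong (_+ u * suc u ^ n) (high-suc u n zero) ⟩
    suc (u * high u n 1) + u * suc u ^ n         ≡⟨ cong suc (+-comm (u * high u n 1) _) ⟩
    suc (u * suc u ^ n + u * high u n 1)         ≡⟨ cong suc (sym (*-distribˡ-+ u _ _)) ⟩
    suc (u * (suc u ^ n + high u n 1))           ∎
    where open ≡-Reasoning
  high-suc u (suc n) (suc k) = trans (cong₂ _+_ (high-suc u n k) (high-suc u n (suc k)))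
    (r u (binom n k) (binom n (suc k)) (high u n (suc k)) (high u n (suc (suc k))))
    where
    r : ∀ u a b x y → a + u * x + (b + u * y) ≡ a + b + u * (x + y)
    r = ℕR.solve-∀

  binom-≤ : ∀ n k → binom n k ≤ 2 ^ n
  binom-≤ n zero = m^n>0 2 n
  binom-≤ zero (suc k) = z≤n
  binom-≤ (suc n) (suc k) = +-mono-≤ (binom-≤ n k) (≤-trans (binom-≤ n (suc k)) (m≤m+n _ 0))

  -- No coefficient of (u + 1)^n exceeds 2^n, so for larger u the binomial expansion is the
  -- expansion in base u.
  ^-split : ∀ u n → 2 ^ n < u → ∀ k → ∃ λ lo → lo < u ^ k × suc u ^ n ≡ lo + u ^ k * high u n k
  ^-split u n h zero = 0 , s≤s z≤n , sym (+-identityʳ _)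
  ^-split u n h (suc k) with ^-split u n h k
  ... | lo , lo< , eq = lo + u ^ k * binom n k
    , (begin-strict
       lo + u ^ k * binom n k    <⟨ +-monoˡ-< _ lo< ⟩
       u ^ k + u ^ k * binom n k ≡⟨ *-suc (u ^ k) _ ⟨
       u ^ k * suc (binom n k)   ≤⟨ *-monoʳ-≤ (u ^ k) (≤-<-trans (binom-≤ n k) h) ⟩
       u ^ k * u                 ≡⟨ *-comm (u ^ k) u ⟩
       u * u ^ k                 ∎)
    , trans eq (trans (cong (λ z → lo + u ^ k * z) (high-suc u n k)) (r lo (u ^ k) (binom n k) u (high u n (suc k))))
    where
    open ≤-Reasoning
    r : ∀ lo p b u h → lo + p * (b + u * h) ≡ lo + p * b + u * p * h
    r = ℕR.solve-∀

  binom-digit : ∀ u n k lo b hi → 2 ^ n < u → lo < u ^ k → b < u →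
                suc u ^ n ≡ lo + u ^ k * (b + u * hi) → b ≡ binom n k
  binom-digit u n k lo b hi h lo< b< eq with ^-split u n h k
  ... | lo' , lo'< , eq' = proj₁ (+*-injective b (binom n k) hi _ b< (≤-<-trans (binom-≤ n k) h)
        (trans (proj₂ (+*-injective lo lo' _ _ lo< lo'< (trans (sym eq) eq'))) (high-suc u n k)))

  odd? : ℕ → Bool
  odd? zero = false
  odd? (suc n) = not (odd? n)

  infix 4 _≼_ _≼?_
  -- Pascal's rule for parities: the truth value says whether `binom n k` is odd. By Lucas's theorem
  -- this is the order in which every binary digit of k is at most that of n.
  _≼?_ : ℕ → ℕ → Bool
  zero ≼? _ = true
  suc k ≼? zero = false
  suc k ≼? suc n = (k ≼? n) xor (suc k ≼? n)

  record _≼_ (k n : ℕ) : Set where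
    constructor binom-odd
    field holds : (k ≼? n) ≡ true
  open _≼_ public

  odd?-+ : ∀ m n → odd? (m + n) ≡ odd? m xor odd? n
  odd?-+ zero n = refl
  odd?-+ (suc m) n = trans (cong not (odd?-+ m n)) (not-distribˡ-xor (odd? m) (odd? n))

  odd?-binom : ∀ n k → odd? (binom n k) ≡ (k ≼? n)
  odd?-binom n zero = refl
  odd?-binom zero (suc k) = refl
  odd?-binom (suc n) (suc k) = trans (odd?-+ (binom n k) _) (cong₂ _xor_ (odd?-binom n k) (odd?-binom n (suc k)))

  odd⇒∃ : ∀ n → odd? n ≡ true → ∃ λ m → n ≡ 1 + 2 * m
  odd⇒∃ (suc zero) _ = 0 , refl
  odd⇒∃ (suc (suc n)) h with odd⇒∃ n (trans (sym (not-involutive (odd? n))) h)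
  ... | m , refl = suc m , r m
    where
    r : ∀ m → suc (suc (1 + 2 * m)) ≡ 1 + 2 * suc m
    r = ℕR.solve-∀

  ∃⇒odd : ∀ m → odd? (1 + 2 * m) ≡ true
  ∃⇒odd m = cong not (trans (odd?-+ m (m + 0)) (trans (cong (λ z → odd? m xor odd? z) (+-identityʳ m)) (xor-same (odd? m))))

  bit : Bool → ℕ
  bit false = 0
  bit true = 1

  ≼?-bit : Bool → Bool → Bool
  ≼?-bit a b = bit a ≼? bit b

  >⇒⋠ : ∀ k n → n < k → (k ≼? n) ≡ false
  >⇒⋠ (suc k) zero _ = refl
  >⇒⋠ (suc k) (suc n) (s≤s h) rewrite >⇒⋠ k n h | >⇒⋠ (suc k) n (m≤n⇒m≤1+n h) = refl

  ≼⇒≤ : ∀ {k n} → k ≼ n → k ≤ n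
  ≼⇒≤ {k} {n} h with k ≤? n
  ... | yes p = p
  ... | no p with trans (sym (holds h)) (>⇒⋠ k n (≰⇒> p))
  ... | ()

  double : ℕ → ℕ
  double zero = zero
  double (suc n) = suc (suc (double n))

  xor-cancel : ∀ a b c → (a xor b) xor (b xor c) ≡ a xor c
  xor-cancel false false c = refl
  xor-cancel false true false = refl
  xor-cancel false true true = refl
  xor-cancel true false c = refl
  xor-cancel true true false = refl
  xor-cancel true true true = refl

  -- Lucas modulo 2: two steps of Pascal's rule act on halves as one.
  ≼?-ee : ∀ k n → (double k ≼? double n) ≡ (k ≼? n)
  ≼?-ee zero n = refl
  ≼?-ee (suc k) zero = refl
  ≼?-ee (suc k) (suc n) = trans (xor-cancel (double k ≼? double n) (suc (double k) ≼? double n) (suc (suc (double k)) ≼? double n))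
    (cong₂ _xor_ (≼?-ee k n) (≼?-ee (suc k) n))

  ≼?-oe : ∀ k n → (suc (double k) ≼? double n) ≡ false
  ≼?-oe k zero = refl
  ≼?-oe zero (suc n) rewrite ≼?-oe zero n = refl
  ≼?-oe (suc k) (suc n) rewrite ≼?-oe k n | ≼?-oe (suc k) n | xor-identityʳ (suc (suc (double k)) ≼? double n) = xor-same (suc (suc (double k)) ≼? double n)

  ≼?-eo : ∀ k n → (double k ≼? suc (double n)) ≡ (k ≼? n)
  ≼?-eo zero n = refl
  ≼?-eo (suc k) n rewrite ≼?-oe k n = ≼?-ee (suc k) n

  ≼?-oo : ∀ k n → (suc (double k) ≼? suc (double n)) ≡ (k ≼? n)
  ≼?-oo k n rewrite ≼?-oe k n = trans (xor-identityʳ _) (≼?-ee k n)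

  snoc : Bool → ℕ → ℕ
  snoc b n = bit b + double n

  ≼?-snoc : ∀ a b k n → (snoc a k ≼? snoc b n) ≡ (≼?-bit a b ∧ (k ≼? n))
  ≼?-snoc false false k n = ≼?-ee k n
  ≼?-snoc false true k n = ≼?-eo k n
  ≼?-snoc true false k n = ≼?-oe k n
  ≼?-snoc true true k n = ≼?-oo k n

  double≡2* : ∀ n → double n ≡ 2 * n
  double≡2* zero = refl
  double≡2* (suc n) = trans (cong (λ z → suc (suc z)) (double≡2* n)) (cong suc (sym (+-suc n (n + 0))))

  unsnoc : ∀ n → ∃₂ λ b m → n ≡ snoc b m
  unsnoc zero = false , 0 , refl
  unsnoc (suc n) with unsnoc n
  ... | false , m , refl = true , m , refl
  ... | true , m , refl = false , suc m , refl

  snoc-< : ∀ b m k → snoc b m < 2 * k → m < k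
  snoc-< b m k h = *-cancelˡ-< 2 m k (≤-<-trans (≤-trans (≤-reflexive (sym (double≡2* m))) (m≤n+m (double m) (bit b))) h)

  snoc-+ : ∀ b m k x → snoc b m + 2 * k * x ≡ snoc b (m + k * x)
  snoc-+ b m k x = trans (+-assoc (bit b) (double m) _) (cong (λ z → bit b + z)
     (trans (cong₂ _+_ (double≡2* m) (*-assoc 2 k x)) (trans (sym (*-distribˡ-+ 2 m (k * x))) (sym (double≡2* _)))))

  -- Lucas's theorem applied j times. It lets a mask act on each digit in base 2^j separately.
  ≼?-+* : ∀ j a b x y → a < 2 ^ j → b < 2 ^ j →
          ((a + 2 ^ j * x) ≼? (b + 2 ^ j * y)) ≡ ((a ≼? b) ∧ (x ≼? y))
  ≼?-+* zero zero zero x y _ _ = cong₂ _≼?_ (+-identityʳ x) (+-identityʳ y)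
  ≼?-+* zero (suc _) _ x y (s≤s ()) _
  ≼?-+* zero zero (suc _) x y _ (s≤s ())
  ≼?-+* (suc j) a b x y a< b< with unsnoc a | unsnoc b
  ... | e , a' , refl | f , b' , refl = begin
    ((snoc e a' + 2 * 2 ^ j * x) ≼? (snoc f b' + 2 * 2 ^ j * y))
      ≡⟨ cong₂ _≼?_ (snoc-+ e a' (2 ^ j) x) (snoc-+ f b' (2 ^ j) y) ⟩
    (snoc e (a' + 2 ^ j * x) ≼? snoc f (b' + 2 ^ j * y))    ≡⟨ ≼?-snoc e f _ _ ⟩
    (≼?-bit e f ∧ ((a' + 2 ^ j * x) ≼? (b' + 2 ^ j * y)))
      ≡⟨ cong (≼?-bit e f ∧_) (≼?-+* j a' b' x y (snoc-< e a' _ a<) (snoc-< f b' _ b<)) ⟩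
    (≼?-bit e f ∧ ((a' ≼? b') ∧ (x ≼? y)))                 ≡⟨ sym (∧-assoc (≼?-bit e f) _ _) ⟩
    ((≼?-bit e f ∧ (a' ≼? b')) ∧ (x ≼? y))                 ≡⟨ cong (_∧ (x ≼? y)) (sym (≼?-snoc e f a' b')) ⟩
    ((snoc e a' ≼? snoc f b') ∧ (x ≼? y))                  ∎
    where open ≡-Reasoning

  -- All j binary digits of D are 1, so as a mask D is nothing but a size bound.
  ≼-ones : ∀ j D a → suc D ≡ 2 ^ j → a ≤ D → a ≼ D
  ≼-ones zero zero zero refl h = binom-odd refl
  ≼-ones (suc j) D a eq h with unsnoc a | unsnoc D
  ... | e , a' , refl | false , D' , refl = ⊥-elim (even≢odd (2 ^ j) D' (trans (sym eq) (cong suc (double≡2* D'))))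
  ... | e , a' , refl | true , D' , refl = binom-odd (trans (≼?-snoc e true a' D') (cong₂ _∧_ (one e) (holds (≼-ones j D' a' eq' a'≤D'))))
    where
    one : ∀ e → ≼?-bit e true ≡ true
    one false = refl
    one true = refl
    eq' : suc D' ≡ 2 ^ j
    eq' = *-cancelˡ-≡ (suc D') (2 ^ j) 2 (trans (sym (double≡2* (suc D'))) eq)
    a'≤D' : a' ≤ D'
    a'≤D' = s≤s⁻¹ (snoc-< e a' (suc D') (≤-trans (s≤s h) (≤-reflexive (double≡2* (suc D')))))

  ≼-combine : ∀ j {a b x y} → a < 2 ^ j → b < 2 ^ j → a ≼ b → x ≼ y → (a + 2 ^ j * x) ≼ (b + 2 ^ j * y)
  ≼-combine j {a} {b} {x} {y} a< b< p q = binom-odd (trans (≼?-+* j a b x y a< b<) (cong₂ _∧_ (holds p) (holds q)))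

  ≼-split : ∀ j {a b x y} → a < 2 ^ j → b < 2 ^ j → (a + 2 ^ j * x) ≼ (b + 2 ^ j * y) → a ≼ b × x ≼ y
  ≼-split j {a} {b} {x} {y} a< b< h =
    binom-odd (∧-conicalˡ (a ≼? b) (x ≼? y) both) , binom-odd (∧-conicalʳ (a ≼? b) (x ≼? y) both)
    where both = trans (sym (≼?-+* j a b x y a< b<)) (holds h)

-- A richer formula language translated into Diophantine logic.

module DiophantineLogic where

  open import Data.Nat
  open import Data.Nat.Properties
  open import Data.Fin using (Fin; zero; suc; #_)
  open import Data.Vec using (Vec; []; _∷_; map; lookup)
  open import Data.Vec.Properties using (lookup-map; map-∘)
  open import Relation.Nullary.Decidable using (True)
  open Equivalence using (to; from)

  infixl 6 _⊕_
  infixl 7 _⊗_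
  data Tm (n : ℕ) : Set where
    var : Fin n → Tm n
    con : ℕ → Tm n
    _⊕_ _⊗_ : Tm n → Tm n → Tm n

  evalTm : ∀ {n} → Vec ℕ n → Tm n → ℕ
  evalTm ρ (var i) = lookup ρ i
  evalTm ρ (con c) = c
  evalTm ρ (s ⊕ t) = evalTm ρ s + evalTm ρ t
  evalTm ρ (s ⊗ t) = evalTm ρ s * evalTm ρ t

  -- The formula depends on the variables σ that hold the arguments, so that it can be placed under
  -- any further quantifiers.
  record Dio (n : ℕ) (R : Vec ℕ n → Set) : Set₁ where
    field
      form : Vec ℕ n → DioForm
      spec : ∀ σ ν → ⟦ form σ ⟧ ν ⇔ R (map ν σ)
  open Dio

  infix 5 _≐_
  infixr 4 _∧_
  infixr 3 _∨_
  data Fm (n : ℕ) : Set₁ where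
    _≐_ : Tm n → Tm n → Fm n
    _∧_ _∨_ : Fm n → Fm n → Fm n
    ex : Fm (suc n) → Fm n
    atom : ∀ {m R} → Dio m R → Vec (Tm n) m → Fm n

  ⟦_⟧ᶠ : ∀ {n} → Fm n → Vec ℕ n → Set
  ⟦ s ≐ t ⟧ᶠ ρ = evalTm ρ s ≡ evalTm ρ t
  ⟦ F ∧ G ⟧ᶠ ρ = ⟦ F ⟧ᶠ ρ × ⟦ G ⟧ᶠ ρ
  ⟦ F ∨ G ⟧ᶠ ρ = ⟦ F ⟧ᶠ ρ ⊎ ⟦ G ⟧ᶠ ρ
  ⟦ ex F ⟧ᶠ ρ = ∃ λ x → ⟦ F ⟧ᶠ (x ∷ ρ)
  ⟦ atom {R = S} _ ts ⟧ᶠ ρ = S (map (evalTm ρ) ts)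

  map-push : ∀ {n} x ν (σ : Vec ℕ n) → map (x · ν) (map suc σ) ≡ map ν σ
  map-push x ν σ = sym (map-∘ (x · ν) suc σ)

  map-push₂ : ∀ {n} x y ν (σ : Vec ℕ n) → map (y · (x · ν)) (map suc (map suc σ)) ≡ map ν σ
  map-push₂ x y ν σ = trans (map-push y (x · ν) (map suc σ)) (map-push x ν σ)

  tmForm : ∀ {n} → Tm n → Vec ℕ n → ℕ → DioForm
  tmForm (var i) σ k = k ≐v lookup σ i
  tmForm (con c) σ k = k ≐c c
  tmForm (s ⊕ t) σ k = ∃̇ (∃̇ (tmForm s (map suc (map suc σ)) 1 ∧̇ (tmForm t (map suc (map suc σ)) 0 ∧̇ ≐add (2 + k) 1 0)))
  tmForm (s ⊗ t) σ k = ∃̇ (∃̇ (tmForm s (map suc (map suc σ)) 1 ∧̇ (tmForm t (map suc (map suc σ)) 0 ∧̇ ≐mul (2 + k) 1 0)))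

  tmForm-spec : ∀ {n} (t : Tm n) σ k ν → ⟦ tmForm t σ k ⟧ ν ⇔ (ν k ≡ evalTm (map ν σ) t)

  subterm-spec : ∀ {n} (t : Tm n) σ ν x y k →
                 ⟦ tmForm t (map suc (map suc σ)) k ⟧ (y · (x · ν)) ⇔ ((y · (x · ν)) k ≡ evalTm (map ν σ) t)
  subterm-spec t σ ν x y k = subst (λ ρ → ⟦ tmForm t (map suc (map suc σ)) k ⟧ (y · (x · ν)) ⇔ ((y · (x · ν)) k ≡ evalTm ρ t))
    (map-push₂ x y ν σ) (tmForm-spec t (map suc (map suc σ)) k (y · (x · ν)))

  tmForm-spec (var i) σ k ν = mk⇔ (λ e → trans e (sym (lookup-map i ν σ))) (λ e → trans e (lookup-map i ν σ))
  tmForm-spec (con c) σ k ν = mk⇔ (λ e → e) (λ e → e)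
  tmForm-spec (s ⊕ t) σ k ν = mk⇔
    (λ { (x , y , p , q , e) → trans e (cong₂ _+_ (to (subterm-spec s σ ν x y 1) p) (to (subterm-spec t σ ν x y 0) q)) })
    (λ e → _ , _ , from (subterm-spec s σ ν _ _ 1) refl , from (subterm-spec t σ ν _ _ 0) refl , e)
  tmForm-spec (s ⊗ t) σ k ν = mk⇔
    (λ { (x , y , p , q , e) → trans e (cong₂ _*_ (to (subterm-spec s σ ν x y 1) p) (to (subterm-spec t σ ν x y 0) q)) })
    (λ e → _ , _ , from (subterm-spec s σ ν _ _ 1) refl , from (subterm-spec t σ ν _ _ 0) refl , e)

  push : ∀ {m} → Vec ℕ m → (ℕ → ℕ) → ℕ → ℕ
  push [] ν = ν
  push (a ∷ as) ν = push as (a · ν)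

  names : ∀ m → Vec ℕ m
  names zero = []
  names (suc m) = m ∷ names m

  push-outer : ∀ {m} (as : Vec ℕ m) ν i → push as ν (m + i) ≡ ν i
  push-outer [] ν i = refl
  push-outer {suc m} (a ∷ as) ν i = trans (cong (push as (a · ν)) (sym (+-suc m i))) (push-outer as (a · ν) (suc i))

  push-names : ∀ {m} (as : Vec ℕ m) ν → map (push as ν) (names m) ≡ as
  push-names [] ν = refl
  push-names {suc m} (a ∷ as) ν = cong₂ _∷_
    (trans (cong (push as (a · ν)) (sym (+-identityʳ m))) (push-outer as (a · ν) 0)) (push-names as (a · ν))

  call : ∀ {m n} → Vec (Tm n) m → Vec ℕ n → (Vec ℕ m → DioForm) → DioForm
  call [] σ K = K []
  -- The variable bound here is 0 now and becomes `m` below the m quantifiers for the remaining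
  -- arguments.
  call {suc m} (t ∷ ts) σ K = ∃̇ (tmForm t (map suc σ) 0 ∧̇ call ts (map suc σ) (λ τ → K (m ∷ τ)))

  call-spec : ∀ {m n} (ts : Vec (Tm n) m) σ K ν →
              ⟦ call ts σ K ⟧ ν ⇔ ⟦ K (names m) ⟧ (push (map (evalTm (map ν σ)) ts) ν)
  call-spec [] σ K ν = mk⇔ (λ x → x) (λ x → x)
  call-spec {suc m} (t ∷ ts) σ K ν = mk⇔ f g
    where
    val = evalTm (map ν σ) t
    IH = λ x → call-spec ts (map suc σ) (λ τ → K (m ∷ τ)) (x · ν)
    val≡ : ∀ x → evalTm (map (x · ν) (map suc σ)) t ≡ val
    val≡ x = cong (λ ρ → evalTm ρ t) (map-push x ν σ)
    f : _ → _
    f (x , e , h) with trans (to (tmForm-spec t (map suc σ) 0 (x · ν)) e) (val≡ x)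
    ... | refl = subst (λ ρ → ⟦ K (m ∷ names m) ⟧ (push (map (evalTm ρ) ts) (x · ν))) (map-push x ν σ) (to (IH x) h)
    g : _ → _
    g h = val , from (tmForm-spec t (map suc σ) 0 (val · ν)) (sym (val≡ val))
        , from (IH val) (subst (λ ρ → ⟦ K (m ∷ names m) ⟧ (push (map (evalTm ρ) ts) (val · ν))) (sym (map-push val ν σ)) h)

  fmForm : ∀ {n} → Fm n → Vec ℕ n → DioForm
  fmForm (s ≐ t) σ = ∃̇ (tmForm s (map suc σ) 0 ∧̇ tmForm t (map suc σ) 0)
  fmForm (F ∧ G) σ = fmForm F σ ∧̇ fmForm G σ
  fmForm (F ∨ G) σ = fmForm F σ ∨̇ fmForm G σ
  fmForm (ex F) σ = ∃̇ (fmForm F (0 ∷ map suc σ))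
  fmForm (atom D ts) σ = call ts σ (form D)

  fmForm-spec : ∀ {n} (F : Fm n) σ ν → ⟦ fmForm F σ ⟧ ν ⇔ ⟦ F ⟧ᶠ (map ν σ)
  fmForm-spec (s ≐ t) σ ν = mk⇔
    (λ { (x , p , q) → trans (sym (trans (to (tmForm-spec s _ 0 _) p) (cong (λ ρ → evalTm ρ s) (map-push x ν σ))))
                             (trans (to (tmForm-spec t _ 0 _) q) (cong (λ ρ → evalTm ρ t) (map-push x ν σ))) })
    (λ e → let x = evalTm (map ν σ) s in x
         , from (tmForm-spec s _ 0 _) (cong (λ ρ → evalTm ρ s) (sym (map-push x ν σ)))
         , from (tmForm-spec t _ 0 _) (trans e (cong (λ ρ → evalTm ρ t) (sym (map-push x ν σ)))))
  fmForm-spec (F ∧ G) σ ν = mk⇔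
    (λ { (p , q) → to (fmForm-spec F σ ν) p , to (fmForm-spec G σ ν) q })
    (λ { (p , q) → from (fmForm-spec F σ ν) p , from (fmForm-spec G σ ν) q })
  fmForm-spec (F ∨ G) σ ν = mk⇔
    (λ { (inj₁ p) → inj₁ (to (fmForm-spec F σ ν) p) ; (inj₂ p) → inj₂ (to (fmForm-spec G σ ν) p) })
    (λ { (inj₁ p) → inj₁ (from (fmForm-spec F σ ν) p) ; (inj₂ p) → inj₂ (from (fmForm-spec G σ ν) p) })
  fmForm-spec (ex F) σ ν = mk⇔
    (λ { (x , p) → x , subst (λ ρ → ⟦ F ⟧ᶠ (x ∷ ρ)) (map-push x ν σ) (to (fmForm-spec F _ _) p) })
    (λ { (x , p) → x , from (fmForm-spec F _ _) (subst (λ ρ → ⟦ F ⟧ᶠ (x ∷ ρ)) (sym (map-push x ν σ)) p) })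
  fmForm-spec (atom {m} {S} D ts) σ ν = mk⇔
    (λ h → subst S (push-names as ν) (to (spec D _ _) (to (call-spec ts σ (form D) ν) h)))
    (λ h → from (call-spec ts σ (form D) ν) (from (spec D _ _) (subst S (sym (push-names as ν)) h)))
    where as = map (evalTm (map ν σ)) ts

  dio : ∀ {n} {R : Vec ℕ n → Set} (F : Fm n) → (∀ ρ → ⟦ F ⟧ᶠ ρ ⇔ R ρ) → Dio n R
  form (dio F h) = fmForm F
  spec (dio F h) σ ν = mk⇔ (λ p → to (h _) (to (fmForm-spec F σ ν) p)) (λ p → from (fmForm-spec F σ ν) (from (h _) p))

  v : ∀ m {n} {m<n : True (suc m ≤? n)} → Tm n
  v m {n} {p} = var (#_ m {n} {p})

-- Pell solutions, powers and the digitwise order are Diophantine.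

module DiophantineRelations where

  open DiophantineLogic
  open Pell
  open PellCertificates
  open Exponentiation
  open BinomialParity
  open import Data.Nat
  open import Data.Nat.Properties
  open import Data.Integer using (ℤ; +_; -[1+_])
  import Data.Integer as ℤ
  import Data.Integer.Properties as ℤ
  import Data.Integer.Divisibility.Signed as ℤ∣
  import Data.Integer.Tactic.RingSolver as ℤR
  open PellCongruences using (lc)
  open import Data.Vec using (Vec; []; _∷_)
  open Equivalence using (to; from)

  Lt : Vec ℕ 2 → Set
  Lt (x ∷ y ∷ []) = x < y

  lt : Dio 2 Lt
  lt = dio (ex (con 1 ⊕ v 1 ⊕ v 0 ≐ v 2)) λ { (x ∷ y ∷ []) → mk⇔
    (λ { (z , e) → ≤-trans (m≤m+n (suc x) z) (≤-reflexive e) })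
    (λ h → y ∸ suc x , m+[n∸m]≡n h) }

  CongR : Vec ℕ 3 → Set
  CongR (m ∷ x ∷ y ∷ []) = Cong m x y

  -- A multiple of m on each side covers both signs of the quotient over the natural numbers.
  cong-dio : Dio 3 CongR
  cong-dio = dio (ex (ex (v 3 ⊕ v 2 ⊗ v 1 ≐ v 4 ⊕ v 2 ⊗ v 0))) λ { (m ∷ x ∷ y ∷ []) → mk⇔ (f m x y) (g m x y) }
    where
    r : ∀ x y m g h → x ℤ.- y ℤ.- (h ℤ.- g) ℤ.* m ≡ + 1 ℤ.* (x ℤ.+ m ℤ.* g ℤ.- (y ℤ.+ m ℤ.* h))
    r = ℤR.solve-∀
    f : ∀ m x y → (∃ λ g → ∃ λ h → x + m * g ≡ y + m * h) → Cong m x y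
    f m x y (g , h , e) = ℤ∣.divides (+ h ℤ.- + g) (lc (+ 1)
      (trans (cong (λ z → + x ℤ.+ z) (sym (ℤ.pos-* m g))) (trans (cong +_ e) (cong (λ z → + y ℤ.+ z) (ℤ.pos-* m h))))
      (r (+ x) (+ y) (+ m) (+ g) (+ h)))
    r₁ : ∀ x y m h → x ℤ.+ m ℤ.* + 0 ℤ.- (y ℤ.+ m ℤ.* h) ≡ + 1 ℤ.* (x ℤ.- y ℤ.- h ℤ.* m)
    r₁ = ℤR.solve-∀
    r₂ : ∀ x y m h → x ℤ.+ m ℤ.* h ℤ.- (y ℤ.+ m ℤ.* + 0) ≡ + 1 ℤ.* (x ℤ.- y ℤ.- (ℤ.- h) ℤ.* m)
    r₂ = ℤR.solve-∀
    inℕ : ∀ m x y g h → + x ℤ.+ + m ℤ.* + g ≡ + y ℤ.+ + m ℤ.* + h → x + m * g ≡ y + m * h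
    inℕ m x y g h e = ℤ.+-injective (trans (cong (λ z → + x ℤ.+ z) (ℤ.pos-* m g))
                        (trans e (cong (λ z → + y ℤ.+ z) (sym (ℤ.pos-* m h)))))
    g : ∀ m x y → Cong m x y → ∃ λ g → ∃ λ h → x + m * g ≡ y + m * h
    g m x y (ℤ∣.divides (+ h) e) = 0 , h , inℕ m x y 0 h (lc (+ 1) e (r₁ (+ x) (+ y) (+ m) (+ h)))
    g m x y (ℤ∣.divides -[1+ h ] e) = suc h , 0 , inℕ m x y (suc h) 0 (lc (+ 1) e (r₂ (+ x) (+ y) (+ m) (+ suc h)))

  PellR : Vec ℕ 4 → Set
  PellR (f ∷ c ∷ a ∷ b ∷ []) = a ≡ A (even f) c × b ≡ Δ (even f) c

  normF : ∀ {n} → Tm n → Tm n → Tm n → Fm n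
  normF d a b = b ⊗ b ≐ con 1 ⊕ d ⊗ a ⊗ (a ⊕ b)

  evenT : ∀ {n} → Tm n → Tm n
  evenT f = con 2 ⊗ (con 1 ⊕ f)

  certificateF : Fm 4
  certificateF =
    ex (ex (ex (ex (ex (ex (ex (ex (ex (ex (ex (
      normF d u u' ∧ normF d s s' ∧ s ≐ (con 1 ⊕ l) ⊗ (u ⊗ u) ∧ V ⊕ d ⊗ s ≐ con 2 ⊗ s' ∧
      w ≐ d ⊕ V ⊗ k ∧ w ≐ h ⊗ u ∧ normF w x y ∧
      atom lt (con 2 ⊗ a ∷ u ∷ []) ∧ atom lt (con 2 ⊗ c ∷ u ∷ []) ∧ atom lt (con 2 ⊗ a ∷ V ∷ []) ∧
      atom cong-dio (V ∷ x ∷ a ∷ []) ∧ atom cong-dio (u ∷ x ∷ c ∷ []))))))))))))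
    where
    y = v 0 ; x = v 1 ; h = v 2 ; k = v 3 ; w = v 4 ; V = v 5 ; l = v 6 ; s' = v 7 ; s = v 8 ; u' = v 9 ; u = v 10
    f = v 11 ; c = v 12 ; a = v 13
    d = evenT f

  pell : Dio 4 PellR
  pell = dio (normF (evenT (v 0)) (v 2) (v 3) ∧ certificateF) λ { (f ∷ c ∷ a ∷ b ∷ []) → mk⇔ (sound f c a b) (complete f c a b) }
    where
    sound : ∀ f c a b → Norm (even f) a b × ⟦ certificateF ⟧ᶠ (f ∷ c ∷ a ∷ b ∷ []) → PellR (f ∷ c ∷ a ∷ b ∷ [])
    sound f c a b (na , u , u' , s , s' , l , V , w , k , h , x , y , h₁ , h₂ , h₃ , h₄ , h₅ , h₆ , h₇ , h₈ , h₉ , h₁₀ , h₁₁ , h₁₂) =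
      pell-sound f c a b na record
        { u = u ; u' = u' ; s = s ; s' = s' ; l = l ; v = V ; w = w ; k = k ; h = h ; x = x ; y = y
        ; norm-u = h₁ ; norm-s = h₂ ; u²∣s = h₃ ; v-def = h₄ ; w≡d = h₅ ; u∣w = h₆ ; norm-x = h₇
        ; 2a<u = h₈ ; 2c<u = h₉ ; 2a<v = h₁₀ ; x≡a = h₁₁ ; x≡c = h₁₂ }
    complete : ∀ f c a b → PellR (f ∷ c ∷ a ∷ b ∷ []) → Norm (even f) a b × ⟦ certificateF ⟧ᶠ (f ∷ c ∷ a ∷ b ∷ [])
    complete f c a b (refl , refl) = norm (even f) c , u , u' , s , s' , l , V , w , k , h , x , y
      , norm-u , norm-s , u²∣s , v-def , w≡d , u∣w , norm-x , 2a<u , 2c<u , 2a<v , x≡a , x≡c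
      where open Certificate (pell-complete f c) renaming (v to V)

  ExpR : Vec ℕ 3 → Set
  ExpR (p ∷ q ∷ r ∷ []) = r ≡ suc p ^ q

  exp : Dio 3 ExpR
  exp = dio F λ { (p ∷ q ∷ r ∷ []) → mk⇔ (sound p q r) (complete p q r) }
    where
    F : Fm 3
    F = ex (ex (ex (ex (ex (
          -- This first solution serves only to bound the power by t. The second one, whose
          -- parameter is built from t, carries the congruence.
          atom pell (p ∷ q ∷ v 4 ∷ t ∷ []) ∧ con 1 ⊕ m ≐ (con 1 ⊕ p ⊕ con 2 ⊗ t ⊕ con 2) ⊗ (con 1 ⊕ p) ∧
          atom lt (con 2 ⊗ r ∷ m ∷ []) ∧ atom pell (p ⊕ t ∷ q ∷ a ∷ b ∷ []) ∧
          atom cong-dio (m ∷ r ⊕ (con 1 ⊕ evenT (p ⊕ t)) ⊗ a ∷ b ⊕ (con 1 ⊕ p) ⊗ a ∷ []))))))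
      where b = v 0 ; a = v 1 ; m = v 2 ; t = v 3 ; p = v 5 ; q = v 6 ; r = v 7
    sound : ∀ p q r → ⟦ F ⟧ᶠ (p ∷ q ∷ r ∷ []) → r ≡ suc p ^ q
    sound p q r (_ , t , m , _ , _ , (_ , t≡) , m≡ , 2r<m , (refl , refl) , h) = ^-unique p q r t m t≡ m≡ 2r<m h
    complete : ∀ p q r → r ≡ suc p ^ q → ⟦ F ⟧ᶠ (p ∷ q ∷ r ∷ [])
    complete p q r refl = _ , t , m , _ , _ , (refl , refl) , refl , 2^<modulus p q t m refl refl , (refl , refl)
      , ^-cong (even (p + t)) (suc p) m (modulus-eq p t m refl) q
      where
      t = Δ (even p) q
      m = (suc p + 2 * t + 2) * suc p ∸ 1

  MaskR : Vec ℕ 2 → Set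
  MaskR (k ∷ n ∷ []) = k ≼ n

  mask : Dio 2 MaskR
  mask = dio F λ { (k ∷ n ∷ []) → mk⇔ (sound k n) (complete k n) }
    where
    F : Fm 2
    F = ex (ex (ex (ex (ex (ex (
          -- Here w = 2^n, the base is u = w + 1, P = u^k and E = (u + 1)^n. The digit of E at P is
          -- the binomial coefficient, required to be odd by the form 1 + 2 m.
          atom exp (con 1 ∷ n ∷ w ∷ []) ∧ atom exp (w ∷ k ∷ P ∷ []) ∧ atom exp (con 1 ⊕ w ∷ n ∷ E ∷ []) ∧
          atom lt (lo ∷ P ∷ []) ∧ atom lt (con 1 ⊕ con 2 ⊗ m ∷ con 1 ⊕ w ∷ []) ∧
          E ≐ lo ⊕ P ⊗ ((con 1 ⊕ con 2 ⊗ m) ⊕ (con 1 ⊕ w) ⊗ hi)))))))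
      where hi = v 0 ; m = v 1 ; lo = v 2 ; E = v 3 ; P = v 4 ; w = v 5 ; k = v 6 ; n = v 7
    sound : ∀ k n → ⟦ F ⟧ᶠ (k ∷ n ∷ []) → k ≼ n
    sound k n (w , P , E , lo , m , hi , refl , refl , refl , lo< , m< , eq) =
      binom-odd (trans (sym (odd?-binom n k)) (trans (cong odd? (sym (binom-digit (suc w) n k lo (1 + 2 * m) hi ≤-refl lo< m< eq))) (∃⇒odd m)))
    complete : ∀ k n → k ≼ n → ⟦ F ⟧ᶠ (k ∷ n ∷ [])
    complete k n h with ^-split (suc (2 ^ n)) n ≤-refl k | odd⇒∃ (binom n k) (trans (odd?-binom n k) (holds h))
    ... | lo , lo< , eq | m , b≡ = 2 ^ n , _ , _ , lo , m , high (suc (2 ^ n)) n (suc k) , refl , refl , refl , lo<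
      , s≤s (subst (_≤ 2 ^ n) b≡ (binom-≤ n k))
      , trans eq (trans (cong (λ z → lo + suc (2 ^ n) ^ k * z) (high-suc (suc (2 ^ n)) n k))
                (cong (λ z → lo + suc (2 ^ n) ^ k * (z + suc (2 ^ n) * high (suc (2 ^ n)) n (suc k))) b≡))

-- FRACTRAN steps at all times at once, digit by digit.

module PackedSteps where

  open DiophantineLogic
  open DiophantineRelations
  open BinomialParity
  open import Data.Nat
  open import Data.Nat.Properties
  open import Data.Nat.Divisibility using (_∣_; divides; ∣m+n∣m⇒∣n; m∣m*n; ∣⇒≤; 0∣⇒≡0; m%n≡0⇒n∣m)
  open import Data.Nat.DivMod using (_/_; _%_; m≡m%n+[m/n]*n; m%n<n)
  open import Data.List using (List; []; _∷_)
  open import Data.Vec using ([]; _∷_)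
  open import Data.Unit using (⊤)
  open Equivalence using (to; from)

  -- For q = 0 the second equation is void, so it only constrains the remainder of a genuine division.
  NonMultiple : ℕ → ℕ → ℕ → ℕ → ℕ → ℕ → Set
  NonMultiple q f z u r s = z ≡ q * u + (r + f) × q * (r + s + f) ≡ q * (pred q * f)

  nonMultiple⇒∤ : ∀ q z u r s → NonMultiple q 1 z u r s → ¬ (q ∣ z)
  nonMultiple⇒∤ zero z u r s (p , _) h = 1+n≢0 {r} (trans (+-comm 1 r) (trans (sym p) (0∣⇒≡0 h)))
  nonMultiple⇒∤ q@(suc q') z u r s (p , e) h = <-irrefl refl (<-≤-trans r+1<q (∣⇒≤ {{>-nonZero (m≤n+m 1 r)}} q∣r+1))
    where
    q∣r+1 : q ∣ r + 1
    q∣r+1 = ∣m+n∣m⇒∣n (subst (q ∣_) p h) (m∣m*n u)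
    r+1<q : r + 1 < q
    r+1<q = s≤s (≤-trans (+-monoˡ-≤ 1 (m≤m+n r s)) (≤-reflexive (trans (*-cancelˡ-≡ _ _ q e) (*-identityʳ q'))))

  ∤⇒nonMultiple : ∀ q z → ¬ (q ∣ z) → ∃ λ u → ∃ λ r → ∃ λ s → NonMultiple q 1 z u r s
  ∤⇒nonMultiple zero zero h = ⊥-elim (h (divides 0 refl))
  ∤⇒nonMultiple zero (suc z) h = 0 , z , 0 , +-comm 1 z , refl
  ∤⇒nonMultiple q@(suc q') z h with z % q in eq
  ... | zero = ⊥-elim (h (m%n≡0⇒n∣m z q eq))
  ... | suc r = z / q , r , q' ∸ suc r
      , trans (m≡m%n+[m/n]*n z q) (trans (cong₂ _+_ (trans eq (+-comm 1 r)) (*-comm (z / q) q)) (+-comm (r + 1) (q * (z / q))))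
      , cong (q *_) (trans (r₁ r (q' ∸ suc r)) (trans (m+[n∸m]≡n r<q') (sym (*-identityʳ q'))))
    where
    r<q' : r < q'
    r<q' = s≤s⁻¹ (subst (_< q) eq (m%n<n z q))
    r₁ : ∀ r s → r + s + 1 ≡ suc r + s
    r₁ = ℕR.solve-∀

  -- A number stands for the vector of its base-B digits. F is the 0/1-vector of the times at which
  -- the program (p / q) ∷ Q is to make a step from X to Y, and D bounds the digits; F₁ marks the
  -- times at which p / q fires, F₂ those at which the step is left to Q.
  record Split (p q : ℕ) (T : ℕ → ℕ → ℕ → Set) (D I F X Y : ℕ) : Set where
    field
      F₁ X₁ Y₁ F₂ X₂ Y₂ U R′ S : ℕ
      F≡ : F ≡ F₁ + F₂
      X≡ : X ≡ X₁ + X₂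
      Y≡ : Y ≡ Y₁ + Y₂
      F₁≼ : F₁ ≼ I
      F₂≼ : F₂ ≼ I
      X₁≼ : X₁ ≼ D * F₁
      Y₁≼ : Y₁ ≼ D * F₁
      X₂≼ : X₂ ≼ D * F₂
      Y₂≼ : Y₂ ≼ D * F₂
      U≼  : U ≼ D * F₂
      R≼  : R′ ≼ D * F₂
      S≼  : S ≼ D * F₂
      fires : q * Y₁ ≡ p * X₁
      skips : NonMultiple q F₂ (p * X₂) U R′ S
      rest  : T F₂ X₂ Y₂

  Packed : List (ℕ × ℕ) → ℕ → ℕ → ℕ → ℕ → ℕ → Set
  Packed [] D I F X Y = F ≡ 0 × X ≡ 0 × Y ≡ 0
  Packed ((p , q) ∷ Q) D I F X Y = Split p q (Packed Q D I) D I F X Y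

  ≼D*0 : ∀ x D → x ≼ D * 0 → x ≡ 0
  ≼D*0 x D h = n≤0⇒n≡0 (subst (x ≤_) (*-zeroʳ D) (≼⇒≤ h))

  packed-0 : ∀ Q {D I X Y} → Packed Q D I 0 X Y → X ≡ 0 × Y ≡ 0
  packed-0 [] (_ , p , q) = p , q
  packed-0 ((p , q) ∷ Q) {D} sp with Split.F₁ sp in e₁ | Split.F₂ sp in e₂ | Split.F≡ sp
  ... | zero | zero | _ = trans (X≡) (cong₂ _+_ (z X₁≼ e₁) (z X₂≼ e₂)) , trans Y≡ (cong₂ _+_ (z Y₁≼ e₁) (z Y₂≼ e₂))
    where
    open Split sp
    z : ∀ {x f} → x ≼ D * f → f ≡ 0 → x ≡ 0
    z {x} h refl = ≼D*0 x D h

  zero-packed : ∀ Q D I → Packed Q D I 0 0 0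
  zero-packed [] D I = refl , refl , refl
  zero-packed ((p , q) ∷ Q) D I = record
    { F₁ = 0 ; X₁ = 0 ; Y₁ = 0 ; F₂ = 0 ; X₂ = 0 ; Y₂ = 0 ; U = 0 ; R′ = 0 ; S = 0
    ; F≡ = refl ; X≡ = refl ; Y≡ = refl ; F₁≼ = binom-odd refl ; F₂≼ = binom-odd refl ; X₁≼ = binom-odd refl ; Y₁≼ = binom-odd refl
    ; X₂≼ = binom-odd refl ; Y₂≼ = binom-odd refl ; U≼ = binom-odd refl ; R≼ = binom-odd refl ; S≼ = binom-odd refl
    ; fires = trans (*-zeroʳ q) (sym (*-zeroʳ p))
    ; skips = trans (*-zeroʳ p) (trans (sym (*-zeroʳ q)) (sym (+-identityʳ (q * 0)))) , cong (q *_) (sym (*-zeroʳ (pred q)))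
    ; rest = zero-packed Q D I }

  -- At a single active time exactly one of `F₁` and `F₂` is 1, which selects the constructor; the
  -- masks erase the components of the other branch.
  packed⇒FStep : ∀ Q {D x y} → Packed Q D 1 1 x y → FStep Q x y
  packed⇒FStep ((p , q) ∷ Q) {D} {x} {y} sp = go F₁ X₁ Y₁ F₂ X₂ Y₂ F≡ X≡ Y≡ X₁≼ Y₁≼ X₂≼ Y₂≼ fires skips rest
    where
    open Split sp
    go : ∀ F₁ X₁ Y₁ F₂ X₂ Y₂ → 1 ≡ F₁ + F₂ → x ≡ X₁ + X₂ → y ≡ Y₁ + Y₂ →
         X₁ ≼ D * F₁ → Y₁ ≼ D * F₁ → X₂ ≼ D * F₂ → Y₂ ≼ D * F₂ → q * Y₁ ≡ p * X₁ →
         NonMultiple q F₂ (p * X₂) U R′ S → Packed Q D 1 F₂ X₂ Y₂ → FStep ((p , q) ∷ Q) x y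
    go zero X₁ Y₁ .1 X₂ Y₂ refl x≡ y≡ a b _ _ _ skips rest with ≼D*0 X₁ D a | ≼D*0 Y₁ D b
    go zero .0 .0 .1 X₂ Y₂ refl refl refl a b _ _ _ skips rest | refl | refl =
      fthere (nonMultiple⇒∤ q (p * X₂) U R′ S skips) (packed⇒FStep Q rest)
    go (suc zero) X₁ Y₁ zero X₂ Y₂ refl x≡ y≡ _ _ a b fires _ _ with ≼D*0 X₂ D a | ≼D*0 Y₂ D b
    go (suc zero) X₁ Y₁ zero .0 .0 refl refl refl _ _ a b fires _ _ | refl | refl =
      fhere (subst₂ (λ y x → q * y ≡ p * x) (sym (+-identityʳ Y₁)) (sym (+-identityʳ X₁)) fires)

  -- Only a threshold for D is returned, because a single D has to serve every step of a run.
  FStep⇒packed : ∀ {Q x y} → FStep Q x y → ∃ λ c → ∀ j D → c ≤ D → suc D ≡ 2 ^ j → Packed Q D 1 1 x y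
  FStep⇒packed {(p , q) ∷ Q} {x} {y} (fhere e) = x + y , λ j D c≤D D≡ → record
    { F₁ = 1 ; X₁ = x ; Y₁ = y ; F₂ = 0 ; X₂ = 0 ; Y₂ = 0 ; U = 0 ; R′ = 0 ; S = 0
    ; F≡ = refl ; X≡ = sym (+-identityʳ x) ; Y≡ = sym (+-identityʳ y) ; F₁≼ = binom-odd refl ; F₂≼ = binom-odd refl
    ; X₁≼ = subst (x ≼_) (sym (*-identityʳ D)) (≼-ones j D x D≡ (≤-trans (m≤m+n x y) c≤D))
    ; Y₁≼ = subst (y ≼_) (sym (*-identityʳ D)) (≼-ones j D y D≡ (≤-trans (m≤n+m y x) c≤D))
    ; X₂≼ = binom-odd refl ; Y₂≼ = binom-odd refl ; U≼ = binom-odd refl ; R≼ = binom-odd refl ; S≼ = binom-odd refl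
    ; fires = e
    ; skips = trans (*-zeroʳ p) (trans (sym (*-zeroʳ q)) (sym (+-identityʳ (q * 0)))) , cong (q *_) (sym (*-zeroʳ (pred q)))
    ; rest = zero-packed Q D 1 }
  FStep⇒packed {(p , q) ∷ Q} {x} {y} (fthere h st) with FStep⇒packed st | ∤⇒nonMultiple q (p * x) h
  ... | c , k | u , r , s , nm = c + (x + (y + (u + (r + s)))) , λ j D c≤D D≡ →
    let ones : ∀ z → z ≤ c + (x + (y + (u + (r + s)))) → z ≼ D * 1
        ones = λ z z≤ → subst (z ≼_) (sym (*-identityʳ D)) (≼-ones j D z D≡ (≤-trans z≤ c≤D))
    in record
    { F₁ = 0 ; X₁ = 0 ; Y₁ = 0 ; F₂ = 1 ; X₂ = x ; Y₂ = y ; U = u ; R′ = r ; S = s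
    ; F≡ = refl ; X≡ = refl ; Y≡ = refl ; F₁≼ = binom-odd refl ; F₂≼ = binom-odd refl ; X₁≼ = binom-odd refl ; Y₁≼ = binom-odd refl
    ; X₂≼ = ones x (m≤n⇒m≤o+n c (m≤m+n x _))
    ; Y₂≼ = ones y (m≤n⇒m≤o+n c (m≤n⇒m≤o+n x (m≤m+n y _)))
    ; U≼ = ones u (m≤n⇒m≤o+n c (m≤n⇒m≤o+n x (m≤n⇒m≤o+n y (m≤m+n u _))))
    ; R≼ = ones r (m≤n⇒m≤o+n c (m≤n⇒m≤o+n x (m≤n⇒m≤o+n y (m≤n⇒m≤o+n u (m≤m+n r s)))))
    ; S≼ = ones s (m≤n⇒m≤o+n c (m≤n⇒m≤o+n x (m≤n⇒m≤o+n y (m≤n⇒m≤o+n u (m≤n+m s r)))))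
    ; fires = trans (*-zeroʳ q) (sym (*-zeroʳ p))
    ; skips = nm
    ; rest = k j D (≤-trans (m≤m+n c _) c≤D) D≡ }

  -- With digits at most D and flags at most 1, both sides of each equation in `Split` are below
  -- `weight p q * suc D`. A base of at least this size excludes carries.
  weight : ℕ → ℕ → ℕ
  weight p q = p + (2 * q + (q * q + 3))

  Fits : List (ℕ × ℕ) → ℕ → ℕ → Set
  Fits [] D B = ⊤
  Fits ((p , q) ∷ Q) D B = weight p q * suc D ≤ B × Fits Q D B

  module _ (j : ℕ) where
    private
      B = 2 ^ j
      instance
        B≢0 : NonZero B
        B≢0 = m^n≢0 2 j

    digits : ∀ Z → ∃ λ z → ∃ λ Z' → z < B × Z ≡ z + B * Z'
    digits Z = Z % B , Z / B , m%n<n Z B , trans (m≡m%n+[m/n]*n Z B) (cong (Z % B +_) (*-comm (Z / B) B))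

    *-digits : ∀ c z Z → c * (z + B * Z) ≡ c * z + B * (c * Z)
    *-digits c z Z = r c z B Z
      where
      r : ∀ c z B Z → c * (z + B * Z) ≡ c * z + B * (c * Z)
      r = ℕR.solve-∀

    mask-split : ∀ D {x f X F} → x < B → D < B → f ≤ 1 → (x + B * X) ≼ D * (f + B * F) → x ≼ D * f × X ≼ D * F
    mask-split D {x} {f} {X} {F} x< D< f≤1 h = ≼-split j x< (≤-<-trans (≤-trans (*-monoʳ-≤ D {f} {1} f≤1) (≤-reflexive (*-identityʳ D))) D<)
      (subst ((x + B * X) ≼_) (*-digits D f F) h)

    mask-combine : ∀ D {x f X F} → D < B → f ≤ 1 → x ≼ D * f → X ≼ D * F → (x + B * X) ≼ D * (f + B * F)
    mask-combine D {x} {f} {X} {F} D< f≤1 p q = subst ((x + B * X) ≼_) (sym (*-digits D f F))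
      (≼-combine j (≤-<-trans (≼⇒≤ p) Df<) Df< p q)
      where Df< = ≤-<-trans (≤-trans (*-monoʳ-≤ D f≤1) (≤-reflexive (*-identityʳ D))) D<

    module _ (D : ℕ) where
      module Bounds (p q : ℕ) (w : weight p q * suc D ≤ B) where
        bound : ∀ c {z} → z ≤ c * suc D → c < weight p q → z < B
        bound c z≤ c< = ≤-<-trans z≤ (<-≤-trans (*-monoˡ-< (suc D) c<) w)

        3≤w : 3 ≤ weight p q
        3≤w = m≤n⇒m≤o+n p (m≤n⇒m≤o+n (2 * q) (m≤n+m 3 (q * q)))

        D<B : D < B
        D<B = bound 1 (≤-trans (n≤1+n D) (≤-reflexive (sym (+-identityʳ (suc D))))) (≤-trans (n≤1+n 2) 3≤w)

        2D<B : ∀ {x y} → x ≤ D → y ≤ D → x + y < B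
        2D<B {x} {y} x≤ y≤ = bound 2 (+-mono-≤ (m≤n⇒m≤1+n x≤) (≤-trans (m≤n⇒m≤1+n y≤) (≤-reflexive (sym (+-identityʳ (suc D)))))) 3≤w

        2<B : 2 < B
        2<B = <-≤-trans (s≤s (s≤s (s≤s z≤n))) (≤-trans 3≤w (≤-trans (m≤m*n _ (suc D)) w))

        p*<B : ∀ {x} → x ≤ D → p * x < B
        p*<B x≤ = bound p (*-monoʳ-≤ p (m≤n⇒m≤1+n x≤)) (m<m+n p (m≤n⇒m≤o+n (2 * q) (m≤n⇒m≤o+n (q * q) (s≤s z≤n))))

        2q<w : 2 * q < weight p q
        2q<w = m≤n⇒m≤o+n p (m<m+n (2 * q) (m≤n⇒m≤o+n (q * q) (s≤s z≤n)))

        q≤2q : q ≤ 2 * q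
        q≤2q = m≤m+n q _

        q*<B : ∀ {x} → x ≤ D → q * x < B
        q*<B x≤ = bound q (*-monoʳ-≤ q (m≤n⇒m≤1+n x≤)) (≤-<-trans q≤2q 2q<w)

        qu+<B : ∀ {u r f} → u ≤ D → r ≤ D → f ≤ 1 → q * u + (r + f) < B
        qu+<B {u} {r} {f} u≤ r≤ f≤ = bound (q + 1) (≤-trans
            (+-mono-≤ (*-monoʳ-≤ q (m≤n⇒m≤1+n u≤)) (≤-trans (+-mono-≤ r≤ f≤) (≤-reflexive (+-comm D 1))))
            (≤-reflexive (r₁ q (suc D))))
          (≤-trans (≤-reflexive (trans (cong suc (+-comm q 1)) (+-comm 2 q))) (≤-trans (+-mono-≤ q≤2q (≤-trans (n≤1+n 2) (m≤n+m 3 (q * q)))) (m≤n+m _ p)))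
          where
          r₁ : ∀ q d → q * d + d ≡ (q + 1) * d
          r₁ = ℕR.solve-∀

        q2<B : ∀ {r s f} → r ≤ D → s ≤ D → f ≤ 1 → q * (r + s + f) < B
        q2<B {r} {s} {f} r≤ s≤ f≤ = bound (2 * q) (≤-trans (*-monoʳ-≤ q {r + s + f} {2 * suc D}
            (≤-trans (+-mono-≤ (+-mono-≤ r≤ s≤) f≤) (≤-trans (≤-reflexive (+-comm (D + D) 1)) (≤-trans (n≤1+n _) (≤-reflexive (r₁ D))))))
            (≤-reflexive (r₂ q (suc D)))) 2q<w
          where
          r₁ : ∀ D → suc (1 + (D + D)) ≡ 2 * suc D
          r₁ = ℕR.solve-∀
          r₂ : ∀ q d → q * (2 * d) ≡ 2 * q * d
          r₂ = ℕR.solve-∀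

        qq<B : ∀ {f} → f ≤ 1 → q * (pred q * f) < B
        qq<B {f} f≤ = bound (q * q) (≤-trans (*-monoʳ-≤ q (≤-trans (*-mono-≤ (pred[n]≤n {q}) f≤) (≤-reflexive (*-identityʳ q)))) (m≤m*n (q * q) (suc D)))
           (m≤n⇒m≤o+n p (m≤n⇒m≤o+n (2 * q) (m<m+n (q * q) (s≤s z≤n))))

      ≼D⇒≤ : ∀ {x f} → f ≤ 1 → x ≼ D * f → x ≤ D
      ≼D⇒≤ {x} {f} f≤ h = ≤-trans (≼⇒≤ h) (≤-trans (*-monoʳ-≤ D f≤) (≤-reflexive (*-identityʳ D)))

      +-digits : ∀ a A b C → a + B * A + (b + B * C) ≡ a + b + B * (A + C)
      +-digits a A b C = r a A b C B
        where
        r : ∀ a A b C B → a + B * A + (b + B * C) ≡ a + b + B * (A + C)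
        r = ℕR.solve-∀

      -- The equations are linear and homogeneous, so they survive the addition of a lowest digit.
      -- Only the masks need the size bounds.
      packed-combine : ∀ Q {i f x y I F X Y} → Fits Q D B → i ≤ 1 →
        Packed Q D i f x y → Packed Q D I F X Y → Packed Q D (i + B * I) (f + B * F) (x + B * X) (y + B * Y)
      packed-combine [] _ _ (refl , refl , refl) (refl , refl , refl) = *-zeroʳ B , *-zeroʳ B , *-zeroʳ B
      packed-combine ((p , q) ∷ Q) {i} {f} {x} {y} {I} {F} {X} {Y} (w , fits) i≤1 s t = record
        { F₁ = s.F₁ + B * t.F₁ ; X₁ = s.X₁ + B * t.X₁ ; Y₁ = s.Y₁ + B * t.Y₁
        ; F₂ = s.F₂ + B * t.F₂ ; X₂ = s.X₂ + B * t.X₂ ; Y₂ = s.Y₂ + B * t.Y₂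
        ; U = s.U + B * t.U ; R′ = s.R′ + B * t.R′ ; S = s.S + B * t.S
        ; F≡ = trans (cong₂ (λ a b → a + B * b) s.F≡ t.F≡) (sym (+-digits s.F₁ t.F₁ s.F₂ t.F₂))
        ; X≡ = trans (cong₂ (λ a b → a + B * b) s.X≡ t.X≡) (sym (+-digits s.X₁ t.X₁ s.X₂ t.X₂))
        ; Y≡ = trans (cong₂ (λ a b → a + B * b) s.Y≡ t.Y≡) (sym (+-digits s.Y₁ t.Y₁ s.Y₂ t.Y₂))
        ; F₁≼ = ≼-combine j (≤-<-trans f₁≤1 1<B) (≤-<-trans i≤1 1<B) s.F₁≼ t.F₁≼
        ; F₂≼ = ≼-combine j (≤-<-trans f₂≤1 1<B) (≤-<-trans i≤1 1<B) s.F₂≼ t.F₂≼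
        ; X₁≼ = mask-combine D D<B f₁≤1 s.X₁≼ t.X₁≼
        ; Y₁≼ = mask-combine D D<B f₁≤1 s.Y₁≼ t.Y₁≼
        ; X₂≼ = mask-combine D D<B f₂≤1 s.X₂≼ t.X₂≼
        ; Y₂≼ = mask-combine D D<B f₂≤1 s.Y₂≼ t.Y₂≼
        ; U≼ = mask-combine D D<B f₂≤1 s.U≼ t.U≼
        ; R≼ = mask-combine D D<B f₂≤1 s.R≼ t.R≼
        ; S≼ = mask-combine D D<B f₂≤1 s.S≼ t.S≼
        ; fires = trans (*-digits q s.Y₁ t.Y₁) (trans (cong₂ (λ a b → a + B * b) s.fires t.fires) (sym (*-digits p s.X₁ t.X₁)))
        ; skips = trans (*-digits p s.X₂ t.X₂) (trans (cong₂ (λ a b → a + B * b) (proj₁ s.skips) (proj₁ t.skips))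
                    (r₁ q s.U t.U s.R′ t.R′ s.F₂ t.F₂ B))
                , trans (r₂ q s.R′ t.R′ s.S t.S s.F₂ t.F₂ B) (trans (cong₂ (λ a b → a + B * b) (proj₂ s.skips) (proj₂ t.skips))
                    (r₃ q (pred q) s.F₂ t.F₂ B))
        ; rest = packed-combine Q fits i≤1 s.rest t.rest }
        where
        module s = Split s
        module t = Split t
        open Bounds p q w
        1<B = <-trans (s≤s (s≤s z≤n)) 2<B
        f₁≤1 = ≤-trans (≼⇒≤ s.F₁≼) i≤1
        f₂≤1 = ≤-trans (≼⇒≤ s.F₂≼) i≤1
        r₁ : ∀ q u U r R f F B → q * u + (r + f) + B * (q * U + (R + F)) ≡ q * (u + B * U) + ((r + B * R) + (f + B * F))
        r₁ = ℕR.solve-∀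
        r₂ : ∀ q r R s S f F B → q * ((r + B * R) + (s + B * S) + (f + B * F)) ≡ q * (r + s + f) + B * (q * (R + S + F))
        r₂ = ℕR.solve-∀
        r₃ : ∀ q q' f F B → q * (q' * f) + B * (q * (q' * F)) ≡ q * (q' * (f + B * F))
        r₃ = ℕR.solve-∀

      -- The masks first bound the lowest digits of all components; then `Fits` keeps both sides of
      -- each equation below B, and uniqueness of division by B separates the digit from the rest.
      packed-split : ∀ Q {i f x y I F X Y} → Fits Q D B → i ≤ 1 → f < B → x < B → y < B →
        Packed Q D (i + B * I) (f + B * F) (x + B * X) (y + B * Y) → Packed Q D i f x y × Packed Q D I F X Y
      packed-split [] {i} {f} {x} {y} {I} {F} {X} {Y} _ _ _ _ _ (p , q , r) =
        (m+n≡0⇒m≡0 f p , m+n≡0⇒m≡0 x q , m+n≡0⇒m≡0 y r) , (hi f F p , hi x X q , hi y Y r)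
        where
        hi : ∀ z Z → z + B * Z ≡ 0 → Z ≡ 0
        hi z Z e = m*n≡0⇒m≡0 Z B (trans (*-comm Z B) (m+n≡0⇒n≡0 z e))
      packed-split ((p , q) ∷ Q) {i} {f} {x} {y} {I} {F} {X} {Y} (w , fits) i≤1 f< x< y< sp
        with digits (Split.F₁ sp) | digits (Split.X₁ sp) | digits (Split.Y₁ sp)
           | digits (Split.F₂ sp) | digits (Split.X₂ sp) | digits (Split.Y₂ sp)
           | digits (Split.U sp) | digits (Split.R′ sp) | digits (Split.S sp)
      ... | f₁ , G₁ , f₁< , f₁≡ | x₁ , H₁ , x₁< , x₁≡ | y₁ , J₁ , y₁< , y₁≡
          | f₂ , G₂ , f₂< , f₂≡ | x₂ , H₂ , x₂< , x₂≡ | y₂ , J₂ , y₂< , y₂≡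
          | u , U′ , u< , u≡ | r , R″ , r< , r≡ | s , S′ , s< , s≡ =
        record
          { F₁ = f₁ ; X₁ = x₁ ; Y₁ = y₁ ; F₂ = f₂ ; X₂ = x₂ ; Y₂ = y₂ ; U = u ; R′ = r ; S = s
          ; F≡ = proj₁ eF ; X≡ = proj₁ eX ; Y≡ = proj₁ eY ; F₁≼ = proj₁ m₁ ; F₂≼ = proj₁ m₂
          ; X₁≼ = proj₁ mX₁ ; Y₁≼ = proj₁ mY₁ ; X₂≼ = proj₁ mX₂ ; Y₂≼ = proj₁ mY₂
          ; U≼ = proj₁ mU ; R≼ = proj₁ mR ; S≼ = proj₁ mS
          ; fires = proj₁ e₁ ; skips = proj₁ e₂ , proj₁ e₃ ; rest = proj₁ ih }
        , record
          { F₁ = G₁ ; X₁ = H₁ ; Y₁ = J₁ ; F₂ = G₂ ; X₂ = H₂ ; Y₂ = J₂ ; U = U′ ; R′ = R″ ; S = S′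
          ; F≡ = proj₂ eF ; X≡ = proj₂ eX ; Y≡ = proj₂ eY ; F₁≼ = proj₂ m₁ ; F₂≼ = proj₂ m₂
          ; X₁≼ = proj₂ mX₁ ; Y₁≼ = proj₂ mY₁ ; X₂≼ = proj₂ mX₂ ; Y₂≼ = proj₂ mY₂
          ; U≼ = proj₂ mU ; R≼ = proj₂ mR ; S≼ = proj₂ mS
          ; fires = proj₂ e₁ ; skips = proj₂ e₂ , proj₂ e₃ ; rest = proj₂ ih }
        where
        module P = Split sp
        open Bounds p q w
        1<B = <-trans (s≤s (s≤s z≤n)) 2<B
        m₁ : f₁ ≼ i × G₁ ≼ I
        m₁ = ≼-split j f₁< (≤-<-trans i≤1 1<B) (subst (_≼ (i + B * I)) f₁≡ P.F₁≼)
        m₂ : f₂ ≼ i × G₂ ≼ I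
        m₂ = ≼-split j f₂< (≤-<-trans i≤1 1<B) (subst (_≼ (i + B * I)) f₂≡ P.F₂≼)
        f₁≤ = ≤-trans (≼⇒≤ (proj₁ m₁)) i≤1
        f₂≤ = ≤-trans (≼⇒≤ (proj₁ m₂)) i≤1
        mX₁ : x₁ ≼ D * f₁ × H₁ ≼ D * G₁
        mX₁ = mask-split D x₁< D<B f₁≤ (subst₂ (λ a b → a ≼ D * b) x₁≡ f₁≡ P.X₁≼)
        mY₁ : y₁ ≼ D * f₁ × J₁ ≼ D * G₁
        mY₁ = mask-split D y₁< D<B f₁≤ (subst₂ (λ a b → a ≼ D * b) y₁≡ f₁≡ P.Y₁≼)
        mX₂ : x₂ ≼ D * f₂ × H₂ ≼ D * G₂
        mX₂ = mask-split D x₂< D<B f₂≤ (subst₂ (λ a b → a ≼ D * b) x₂≡ f₂≡ P.X₂≼)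
        mY₂ : y₂ ≼ D * f₂ × J₂ ≼ D * G₂
        mY₂ = mask-split D y₂< D<B f₂≤ (subst₂ (λ a b → a ≼ D * b) y₂≡ f₂≡ P.Y₂≼)
        mU : u ≼ D * f₂ × U′ ≼ D * G₂
        mU = mask-split D u< D<B f₂≤ (subst₂ (λ a b → a ≼ D * b) u≡ f₂≡ P.U≼)
        mR : r ≼ D * f₂ × R″ ≼ D * G₂
        mR = mask-split D r< D<B f₂≤ (subst₂ (λ a b → a ≼ D * b) r≡ f₂≡ P.R≼)
        mS : s ≼ D * f₂ × S′ ≼ D * G₂
        mS = mask-split D s< D<B f₂≤ (subst₂ (λ a b → a ≼ D * b) s≡ f₂≡ P.S≼)
        eF : f ≡ f₁ + f₂ × F ≡ G₁ + G₂
        eF = +*-injective f (f₁ + f₂) F (G₁ + G₂) f< (≤-<-trans (+-mono-≤ f₁≤ f₂≤) 2<B)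
               (trans P.F≡ (trans (cong₂ _+_ f₁≡ f₂≡) (+-digits f₁ G₁ f₂ G₂)))
        eX : x ≡ x₁ + x₂ × X ≡ H₁ + H₂
        eX = +*-injective x (x₁ + x₂) X (H₁ + H₂) x< (2D<B (≼D⇒≤ f₁≤ (proj₁ mX₁)) (≼D⇒≤ f₂≤ (proj₁ mX₂)))
               (trans P.X≡ (trans (cong₂ _+_ x₁≡ x₂≡) (+-digits x₁ H₁ x₂ H₂)))
        eY : y ≡ y₁ + y₂ × Y ≡ J₁ + J₂
        eY = +*-injective y (y₁ + y₂) Y (J₁ + J₂) y< (2D<B (≼D⇒≤ f₁≤ (proj₁ mY₁)) (≼D⇒≤ f₂≤ (proj₁ mY₂)))
               (trans P.Y≡ (trans (cong₂ _+_ y₁≡ y₂≡) (+-digits y₁ J₁ y₂ J₂)))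
        e₁ : q * y₁ ≡ p * x₁ × q * J₁ ≡ p * H₁
        e₁ = +*-injective (q * y₁) (p * x₁) (q * J₁) (p * H₁) (q*<B (≼D⇒≤ f₁≤ (proj₁ mY₁))) (p*<B (≼D⇒≤ f₁≤ (proj₁ mX₁)))
               (trans (sym (*-digits q y₁ J₁)) (trans (subst₂ (λ a b → q * a ≡ p * b) y₁≡ x₁≡ P.fires) (*-digits p x₁ H₁)))
        r₁ : ∀ q u U r R f F B → q * (u + B * U) + ((r + B * R) + (f + B * F)) ≡ q * u + (r + f) + B * (q * U + (R + F))
        r₁ = ℕR.solve-∀
        r₂ : ∀ q r R s S f F B → q * ((r + B * R) + (s + B * S) + (f + B * F)) ≡ q * (r + s + f) + B * (q * (R + S + F))
        r₂ = ℕR.solve-∀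
        r₃ : ∀ q q' f F B → q * (q' * (f + B * F)) ≡ q * (q' * f) + B * (q * (q' * F))
        r₃ = ℕR.solve-∀
        u≤ = ≼D⇒≤ f₂≤ (proj₁ mU)
        r≤ = ≼D⇒≤ f₂≤ (proj₁ mR)
        s≤ = ≼D⇒≤ f₂≤ (proj₁ mS)
        e₂ : p * x₂ ≡ q * u + (r + f₂) × p * H₂ ≡ q * U′ + (R″ + G₂)
        e₂ = +*-injective (p * x₂) (q * u + (r + f₂)) (p * H₂) (q * U′ + (R″ + G₂)) (p*<B (≼D⇒≤ f₂≤ (proj₁ mX₂))) (qu+<B u≤ r≤ f₂≤)
               (trans (sym (*-digits p x₂ H₂)) (trans (cong (p *_) (sym x₂≡)) (trans (proj₁ P.skips)
                 (trans (cong₂ (λ a b → q * a + b) u≡ (cong₂ _+_ r≡ f₂≡)) (r₁ q u U′ r R″ f₂ G₂ B)))))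
        e₃ : q * (r + s + f₂) ≡ q * (pred q * f₂) × q * (R″ + S′ + G₂) ≡ q * (pred q * G₂)
        e₃ = +*-injective (q * (r + s + f₂)) (q * (pred q * f₂)) (q * (R″ + S′ + G₂)) (q * (pred q * G₂)) (q2<B r≤ s≤ f₂≤) (qq<B f₂≤)
               (trans (sym (r₂ q r R″ s S′ f₂ G₂ B)) (trans (cong₂ (λ a b → q * (a + b)) (cong₂ _+_ (sym r≡) (sym s≡)) (sym f₂≡))
                 (trans (proj₂ P.skips) (trans (cong (λ a → q * (pred q * a)) f₂≡) (r₃ q (pred q) f₂ G₂ B)))))
        ih : Packed Q D i f₂ x₂ y₂ × Packed Q D I G₂ H₂ J₂
        ih = packed-split Q fits i≤1 f₂< x₂< y₂< (subst (λ z → z) (cong₂ (λ z k → k z) f₂≡ (cong₂ (λ X Y F → Packed Q D (i + B * I) F X Y) x₂≡ y₂≡)) P.rest)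

-- Termination of a FRACTRAN program as a Diophantine relation.

module PackedRuns where

  open DiophantineLogic
  open DiophantineRelations
  open BinomialParity
  open PackedSteps
  open import Data.Nat
  open import Data.Nat.Properties
  open import Data.Nat.Divisibility using (divides; _∣?_)
  open import Data.List using (List; []; _∷_)
  open import Data.Vec using (Vec; []; _∷_)
  open import Data.Unit using (tt)
  open Equivalence using (to; from)

  repunit : ℕ → ℕ → ℕ
  repunit B zero = 0
  repunit B (suc n) = 1 + B * repunit B n

  module _ (Q : List (ℕ × ℕ)) (j D : ℕ) (fits : Fits Q D (2 ^ j)) where
    private B = 2 ^ j

    -- X and Y list x₀ … xₙ₋₁ and x₁ … xₙ; matching them digit by digit needs x₀ = s and Y shifted by B.
    packed⇒run : 1 < B → ∀ n s X Y x → s < B → Packed Q D (repunit B n) (repunit B n) X Y →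
                 X + B ^ n * x ≡ s + B * Y → Star (FStep Q) s x
    packed⇒run 1<B zero s X Y x s< pk e with packed-0 Q pk
    ... | refl , refl = subst (Star (FStep Q) s) (sym (trans (sym (+-identityʳ x)) (trans e (trans (cong (s +_) (*-zeroʳ B)) (+-identityʳ s))))) ε
    packed⇒run 1<B (suc n) s X Y x s< pk e with digits j X | digits j Y
    ... | x₀ , X′ , x₀< , refl | y₀ , Y′ , y₀< , refl with packed-split j D Q {i = 1} {f = 1} {I = repunit B n} {F = repunit B n} fits ≤-refl 1<B x₀< y₀< pk
    ... | p₀ , p′ with +*-injective x₀ s (X′ + B ^ n * x) (y₀ + B * Y′) x₀< s< (trans (r x₀ X′ B (B ^ n) x) e)
      where
      r : ∀ a X B N x → a + B * (X + N * x) ≡ a + B * X + B * N * x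
      r = ℕR.solve-∀
    ... | refl , e′ = packed⇒FStep Q p₀ ◅ packed⇒run 1<B n y₀ X′ Y′ x y₀< p′ e′

  PackedRun : List (ℕ × ℕ) → (D B s x : ℕ) → Set
  PackedRun Q D B s x = ∃ λ n → ∃ λ X → ∃ λ Y → Packed Q D (repunit B n) (repunit B n) X Y × X + B ^ n * x ≡ s + B * Y

  -- The thresholds of the single steps are added up, and D and the base are chosen only afterwards.
  run⇒packed : ∀ Q {s x} → Star (FStep Q) s x → ∃ λ c → ∀ i j D → c ≤ D → suc D ≡ 2 ^ i → Fits Q D (2 ^ j) → PackedRun Q D (2 ^ j) s x
  run⇒packed Q {s} ε = 0 , λ i j D _ _ _ → 0 , 0 , 0 , zero-packed Q D 0 ,
    trans (+-identityʳ s) (sym (trans (cong (s +_) (*-zeroʳ (2 ^ j))) (+-identityʳ s)))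
  run⇒packed Q {s} {x} (_◅_ {j = y} st sts) with FStep⇒packed st | run⇒packed Q sts
  ... | c , k | c′ , k′ = c + c′ , λ i j D c≤D D≡ fits →
        cons i j D (k i D (≤-trans (m≤m+n c c′) c≤D) D≡) fits (k′ i j D (≤-trans (m≤n+m c′ c) c≤D) D≡ fits)
    where
    cons : ∀ i j D → Packed Q D 1 1 s y → Fits Q D (2 ^ j) → PackedRun Q D (2 ^ j) y x → PackedRun Q D (2 ^ j) s x
    cons i j D p₀ fits (n , X , Y , p , e) = suc n , s + B * X , y + B * Y , packed-combine j D Q fits ≤-refl p₀ p
      , trans (r s X B (B ^ n) x) (cong (λ z → s + B * z) e)
      where
      B = 2 ^ j
      r : ∀ a X B N x → a + B * X + B * N * x ≡ a + B * (X + N * x)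
      r = ℕR.solve-∀

  packedR : List (ℕ × ℕ) → Vec ℕ 5 → Set
  packedR Q (D ∷ I ∷ F ∷ X ∷ Y ∷ []) = Packed Q D I F X Y

  nonMultipleF : ∀ {n} → ℕ → Tm n → Tm n → Tm n → Tm n → Tm n → Fm n
  nonMultipleF q f z u r s = (z ≐ con q ⊗ u ⊕ (r ⊕ f)) ∧ (con q ⊗ (r ⊕ s ⊕ f) ≐ con q ⊗ (con (pred q) ⊗ f))

  packed : ∀ Q → Dio 5 (packedR Q)
  packed [] = dio ((v 2 ≐ con 0) ∧ (v 3 ≐ con 0) ∧ (v 4 ≐ con 0)) λ { (D ∷ I ∷ F ∷ X ∷ Y ∷ []) → mk⇔ (λ p → p) (λ p → p) }
  packed ((p , q) ∷ Q) = dio body λ { (D ∷ I ∷ F ∷ X ∷ Y ∷ []) → mk⇔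
      (λ { (F₁ , X₁ , Y₁ , F₂ , X₂ , Y₂ , U , R′ , S , a , b , c , d , e , f , g , h , i , j , k , l , m , n , o) → record
        { F₁ = F₁ ; X₁ = X₁ ; Y₁ = Y₁ ; F₂ = F₂ ; X₂ = X₂ ; Y₂ = Y₂ ; U = U ; R′ = R′ ; S = S
        ; F≡ = a ; X≡ = b ; Y≡ = c ; F₁≼ = d ; F₂≼ = e ; X₁≼ = f ; Y₁≼ = g ; X₂≼ = h ; Y₂≼ = i
        ; U≼ = j ; R≼ = k ; S≼ = l ; fires = m ; skips = n ; rest = o } })
      (λ sp → let open Split sp in F₁ , X₁ , Y₁ , F₂ , X₂ , Y₂ , U , R′ , S
        , F≡ , X≡ , Y≡ , F₁≼ , F₂≼ , X₁≼ , Y₁≼ , X₂≼ , Y₂≼ , U≼ , R≼ , S≼ , fires , skips , rest) }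
    where
    body : Fm 5
    body = ex (ex (ex (ex (ex (ex (ex (ex (ex (
        (F ≐ F₁ ⊕ F₂) ∧ (X ≐ X₁ ⊕ X₂) ∧ (Y ≐ Y₁ ⊕ Y₂) ∧
        atom mask (F₁ ∷ I ∷ []) ∧ atom mask (F₂ ∷ I ∷ []) ∧
        atom mask (X₁ ∷ D ⊗ F₁ ∷ []) ∧ atom mask (Y₁ ∷ D ⊗ F₁ ∷ []) ∧
        atom mask (X₂ ∷ D ⊗ F₂ ∷ []) ∧ atom mask (Y₂ ∷ D ⊗ F₂ ∷ []) ∧
        atom mask (U ∷ D ⊗ F₂ ∷ []) ∧ atom mask (R′ ∷ D ⊗ F₂ ∷ []) ∧ atom mask (S ∷ D ⊗ F₂ ∷ []) ∧
        (con q ⊗ Y₁ ≐ con p ⊗ X₁) ∧ nonMultipleF q F₂ (con p ⊗ X₂) U R′ S ∧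
        atom (packed Q) (D ∷ I ∷ F₂ ∷ X₂ ∷ Y₂ ∷ []))))))))))
      where
      S = v 0 ; R′ = v 1 ; U = v 2 ; Y₂ = v 3 ; X₂ = v 4 ; F₂ = v 5 ; Y₁ = v 6 ; X₁ = v 7 ; F₁ = v 8
      D = v 9 ; I = v 10 ; F = v 11 ; X = v 12 ; Y = v 13

  Halted : List (ℕ × ℕ) → Vec ℕ 1 → Set
  Halted Q (x ∷ []) = ∀ y → ¬ FStep Q x y

  halted : ∀ Q → Dio 1 (Halted Q)
  halted [] = dio (con 0 ≐ con 0) λ { (x ∷ []) → mk⇔ (λ _ y ()) (λ _ → refl) }
  halted ((p , q) ∷ Q) = dio (ex (ex (ex (nonMultipleF q (con 1) (con p ⊗ v 3) (v 2) (v 1) (v 0)))) ∧ atom (halted Q) (v 0 ∷ []))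
    λ { (x ∷ []) → mk⇔
      (λ { ((u , r , s , nm) , h) y (fhere e) → nonMultiple⇒∤ q (p * x) u r s nm (divides y (trans (sym e) (*-comm q y)))
         ; (_ , h) y (fthere _ st) → h y st })
      (λ h → go x h (q ∣? p * x)) }
    where
    go : ∀ x → (∀ y → ¬ FStep ((p , q) ∷ Q) x y) → _ → (∃ λ u → ∃ λ r → ∃ λ s → NonMultiple q 1 (p * x) u r s) × (∀ y → ¬ FStep Q x y)
    go x h (yes (divides y e)) = ⊥-elim (h y (fhere (trans (*-comm q y) (sym e))))
    go x h (no ∤) = ∤⇒nonMultiple q (p * x) ∤ , λ y st → h y (fthere ∤ st)

  -- An exponent for which 2^κ exceeds the weight of every fraction. The value 1 for the empty
  -- program keeps the base above 1.
  κ : List (ℕ × ℕ) → ℕ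
  κ [] = 1
  κ ((p , q) ∷ Q) = weight p q + κ Q

  n<2^n : ∀ n → n < 2 ^ n
  n<2^n zero = ≤-refl
  n<2^n (suc n) = ≤-trans (+-mono-≤ (m^n>0 2 n) (n<2^n n)) (≤-reflexive (cong (2 ^ n +_) (sym (+-identityʳ _))))

  fits-κ : ∀ Q D i → suc D ≡ 2 ^ i → Fits Q D (2 ^ (i + κ Q))
  fits-κ Q D i D≡ = go Q (κ Q) ≤-refl
    where
    go : ∀ Q k → κ Q ≤ k → Fits Q D (2 ^ (i + k))
    go [] k h = tt
    go ((p , q) ∷ Q) k h = (begin
        weight p q * suc D  ≤⟨ *-mono-≤ (≤-trans (m≤m+n _ (κ Q)) (≤-trans h (<⇒≤ (n<2^n k)))) (≤-reflexive D≡) ⟩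
        2 ^ k * 2 ^ i       ≡⟨ *-comm (2 ^ k) _ ⟩
        2 ^ i * 2 ^ k       ≡⟨ sym (^-distribˡ-+-* 2 i k) ⟩
        2 ^ (i + k)         ∎)
      , go Q k (≤-trans (m≤n+m (κ Q) _) h)
      where open ≤-Reasoning

  1≤κ : ∀ Q → 1 ≤ κ Q
  1≤κ [] = ≤-refl
  1≤κ ((p , q) ∷ Q) = ≤-trans (1≤κ Q) (m≤n+m (κ Q) _)

  -- The geometric sum. It replaces the recursive definition of `repunit` by an equation with a
  -- power.
  repunit-^ : ∀ E n → suc (E * repunit (suc E) n) ≡ suc E ^ n
  repunit-^ E zero = cong suc (*-zeroʳ E)
  repunit-^ E (suc n) = trans (r E (repunit (suc E) n)) (cong (suc E *_) (repunit-^ E n))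
    where
    r : ∀ E x → suc (E * (1 + suc E * x)) ≡ suc E * suc (E * x)
    r = ℕR.solve-∀

  TerminatesR : List (ℕ × ℕ) → Vec ℕ 1 → Set
  TerminatesR Q (s ∷ []) = FTerminates Q s

  terminates : ∀ Q → Dio 1 (TerminatesR Q)
  terminates Q = dio body λ { (s ∷ []) → mk⇔ (sound s) (complete s) }
    where
    body : Fm 1
    body = ex (ex (ex (ex (ex (ex (ex (ex (ex (
        atom exp (con 1 ∷ i ∷ con 1 ⊕ D ∷ []) ∧ atom exp (con 1 ∷ i ⊕ con (κ Q) ∷ con 1 ⊕ E ∷ []) ∧
        atom exp (E ∷ n ∷ M ∷ []) ∧ (con 1 ⊕ E ⊗ I ≐ M) ∧ atom lt (s ∷ con 1 ⊕ E ∷ []) ∧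
        (X ⊕ M ⊗ x ≐ s ⊕ (con 1 ⊕ E) ⊗ Y) ∧ atom (packed Q) (D ∷ I ∷ I ∷ X ∷ Y ∷ []) ∧
        atom (halted Q) (x ∷ []))))))))))
      where x = v 0 ; Y = v 1 ; X = v 2 ; I = v 3 ; M = v 4 ; n = v 5 ; E = v 6 ; D = v 7 ; i = v 8 ; s = v 9
    sound : ∀ s → ⟦ body ⟧ᶠ (s ∷ []) → FTerminates Q s
    sound s (i , D , E , n , M , I , X , Y , x , D≡ , E≡ , refl , I≡ , s< , e , pk , h) = x
      , packed⇒run Q (i + κ Q) D (fits-κ Q D i D≡) 1<B n s X Y x (subst (s <_) E≡ s<)
          (subst (λ z → Packed Q D z z X Y) (trans I≡′ (cong (λ b → repunit b n) E≡)) pk)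
          (subst (λ b → X + b ^ n * x ≡ s + b * Y) E≡ e)
      , h
      where
      1<B : 1 < 2 ^ (i + κ Q)
      1<B = ≤-<-trans (≤-trans (1≤κ Q) (m≤n+m (κ Q) i)) (n<2^n (i + κ Q))
      0<E : 0 < E
      0<E = s≤s⁻¹ (subst (1 <_) (sym E≡) 1<B)
      I≡′ : I ≡ repunit (suc E) n
      I≡′ = *-cancelˡ-≡ _ _ E {{>-nonZero 0<E}} (suc-injective (trans I≡ (sym (repunit-^ E n))))
    complete : ∀ s → FTerminates Q s → ⟦ body ⟧ᶠ (s ∷ [])
    complete s (x , run , h) with run⇒packed Q run
    ... | c , k = go (k i j (pred (2 ^ i)) c≤D D≡ (fits-κ Q (pred (2 ^ i)) i D≡))
      where
      -- Makes D = 2^i - 1 reach the threshold c of the run and the base exceed s, which is to be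
      -- the lowest digit.
      i = suc (c + s)
      j = i + κ Q
      D≡ : suc (pred (2 ^ i)) ≡ 2 ^ i
      D≡ = suc-pred (2 ^ i) {{m^n≢0 2 i}}
      c+s≤D : c + s ≤ pred (2 ^ i)
      c+s≤D = s≤s⁻¹ (≤-trans (<⇒≤ (n<2^n i)) (≤-reflexive (sym D≡)))
      c≤D = ≤-trans (m≤m+n c s) c+s≤D
      E≡ : suc (pred (2 ^ j)) ≡ 2 ^ j
      E≡ = suc-pred (2 ^ j) {{m^n≢0 2 j}}
      s<B : s < suc (pred (2 ^ j))
      s<B = ≤-trans (s≤s (≤-trans (m≤n+m s c) c+s≤D)) (≤-trans (≤-reflexive D≡) (≤-trans (^-monoʳ-≤ 2 (m≤m+n i (κ Q))) (≤-reflexive (sym E≡))))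
      go : PackedRun Q (pred (2 ^ i)) (2 ^ j) s x → ⟦ body ⟧ᶠ (s ∷ [])
      go (n , X , Y , pk , e) = i , pred (2 ^ i) , pred (2 ^ j) , n , suc (pred (2 ^ j)) ^ n , repunit (suc (pred (2 ^ j))) n , X , Y , x
        , D≡ , E≡ , refl , repunit-^ (pred (2 ^ j)) n , s<B
        , subst (λ b → X + b ^ n * x ≡ s + b * Y) (sym E≡) e
        , subst (λ b → Packed Q (pred (2 ^ i)) (repunit b n) (repunit b n) X Y) (sym E≡) pk
        , h

  fractran⪯dio-form : FRACTRAN ⪯ DIO-FORM
  fractran⪯dio-form = (λ { (Q , s) → Dio.form (terminates Q) (0 ∷ []) , λ _ → s }) ,
    λ { (Q , s) → mk⇔ (from (Dio.spec (terminates Q) (0 ∷ []) (λ _ → s))) (to (Dio.spec (terminates Q) (0 ∷ []) (λ _ → s))) }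

-- Formulas, elementary constraints and single polynomial equations.

module Equations where

  open BinomialParity using (double)
  open import Data.Nat
  open import Data.Nat.Properties
  open import Data.Fin using (Fin; toℕ; fromℕ<)
  open import Data.Fin.Properties using (toℕ-fromℕ<)
  open import Data.List using (List; []; _∷_; _++_)
  open import Data.List.Relation.Unary.All using (All; []; _∷_)
  open import Data.List.Relation.Unary.All.Properties using (++⁺; ++⁻)
  open import Data.Sum using (reduce)
  open import Relation.Binary using (tri<; tri≈; tri>)
  open Equivalence using (to; from)

  ⪯-trans : ∀ {X Y Z : Set} {P : X → Set} {Q : Y → Set} {S : Z → Set} → P ⪯ Q → Q ⪯ S → P ⪯ S
  ⪯-trans (f , h) (g , k) = g ∘ f , λ x → mk⇔ (to (k (f x)) ∘ to (h x)) (from (h x) ∘ from (k (f x)))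

  interleave : {A : Set} → (ℕ → A) → (ℕ → A) → ℕ → A
  interleave f g zero = f 0
  interleave f g (suc zero) = g 0
  interleave f g (suc (suc n)) = interleave (f ∘ suc) (g ∘ suc) n

  interleave-even : ∀ {A : Set} (f g : ℕ → A) k → interleave f g (double k) ≡ f k
  interleave-even f g zero = refl
  interleave-even f g (suc k) = interleave-even (f ∘ suc) (g ∘ suc) k

  interleave-odd : ∀ {A : Set} (f g : ℕ → A) k → interleave f g (suc (double k)) ≡ g k
  interleave-odd f g zero = refl
  interleave-odd f g (suc k) = interleave-odd (f ∘ suc) (g ∘ suc) k

  PolyEq : Set → Set → Set
  PolyEq U V = Poly U V × Poly U V

  Holds : {U V : Set} → (U → ℕ) → (V → ℕ) → PolyEq U V → Set
  Holds φ ν (p , q) = evalP φ ν p ≡ evalP φ ν q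

  -- (p − q)² + (r − s)² = 0 and (p − q)(r − s) = 0, rearranged to avoid subtraction.
  both either : {U V : Set} → PolyEq U V → PolyEq U V → PolyEq U V
  both (p , q) (r , s) = padd (padd (pmul p p) (pmul q q)) (padd (pmul r r) (pmul s s))
                       , padd (padd (pmul p q) (pmul p q)) (padd (pmul r s) (pmul r s))
  either (p , q) (r , s) = padd (pmul p r) (pmul q s) , padd (pmul p s) (pmul q r)

  -- Here k is the absolute difference of p and q, so later arguments need not know which is larger.
  square-difference : ∀ p q → ∃ λ k → p * p + q * q ≡ p * q + p * q + k * k × (k ≡ 0 → p ≡ q)
  square-difference p q with ≤-total p q
  ... | inj₁ p≤q with m≤n⇒∃[o]m+o≡n p≤q
  ... | k , refl = k , r p k , λ { refl → sym (+-identityʳ p) }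
    where
    r : ∀ p k → p * p + (p + k) * (p + k) ≡ p * (p + k) + p * (p + k) + k * k
    r = ℕR.solve-∀
  square-difference p q | inj₂ q≤p with m≤n⇒∃[o]m+o≡n q≤p
  ... | k , refl = k , r q k , λ { refl → +-identityʳ q }
    where
    r : ∀ p k → (p + k) * (p + k) + p * p ≡ (p + k) * p + (p + k) * p + k * k
    r = ℕR.solve-∀

  sum-of-squares : ∀ p q r s → p * p + q * q + (r * r + s * s) ≡ p * q + p * q + (r * s + r * s) → p ≡ q × r ≡ s
  sum-of-squares p q r s e with square-difference p q | square-difference r s
  ... | k , pq , k0 | l , rs , l0 = k0 (reduce (m*n≡0⇒m≡0∨n≡0 k (m+n≡0⇒m≡0 (k * k) z))) , l0 (reduce (m*n≡0⇒m≡0∨n≡0 l (m+n≡0⇒n≡0 (k * k) z)))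
    where
    t : ∀ a b k l → a + k + (b + l) ≡ a + b + (k + l)
    t = ℕR.solve-∀
    z : k * k + l * l ≡ 0
    z = +-cancelˡ-≡ (p * q + p * q + (r * s + r * s)) _ 0
          (trans (trans (sym (t (p * q + p * q) (r * s + r * s) (k * k) (l * l))) (trans (sym (cong₂ _+_ pq rs)) e)) (sym (+-identityʳ _)))

  product-zero : ∀ p q r s → p * r + q * s ≡ p * s + q * r → p ≡ q ⊎ r ≡ s
  product-zero p q r s e with <-cmp p q
  ... | tri≈ _ p≡q _ = inj₁ p≡q
  ... | tri< p<q _ _ with m≤n⇒∃[o]m+o≡n p<q
  ... | k , refl = inj₂ (sym (*-cancelˡ-≡ s r (suc k) (+-cancelˡ-≡ (p * r + p * s) _ _ (trans (l p k r s) (trans e (l′ p k r s))))))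
    where
    l : ∀ p k r s → p * r + p * s + suc k * s ≡ p * r + (suc p + k) * s
    l = ℕR.solve-∀
    l′ : ∀ p k r s → p * s + (suc p + k) * r ≡ p * r + p * s + suc k * r
    l′ = ℕR.solve-∀
  product-zero p q r s e | tri> _ _ q<p with m≤n⇒∃[o]m+o≡n q<p
  ... | k , refl = inj₂ (*-cancelˡ-≡ r s (suc k) (+-cancelˡ-≡ (q * r + q * s) _ _ (trans (l q k r s) (trans e (l′ q k r s)))))
    where
    l : ∀ p k r s → p * r + p * s + suc k * r ≡ (suc p + k) * r + p * s
    l = ℕR.solve-∀
    l′ : ∀ p k r s → (suc p + k) * s + p * r ≡ p * r + p * s + suc k * s
    l′ = ℕR.solve-∀

  both-⇔ : ∀ {U V : Set} (φ : U → ℕ) (ν : V → ℕ) e f → Holds φ ν (both e f) ⇔ (Holds φ ν e × Holds φ ν f)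
  both-⇔ φ ν (p , q) (r , s) = mk⇔ (sum-of-squares _ _ _ _)
    (λ { (e , f) → cong₂ _+_ (cong₂ _+_ (cong (evalP φ ν p *_) e) (cong (_* evalP φ ν q) (sym e)))
                             (cong₂ _+_ (cong (evalP φ ν r *_) f) (cong (_* evalP φ ν s) (sym f))) })

  either-⇔ : ∀ {U V : Set} (φ : U → ℕ) (ν : V → ℕ) e f → Holds φ ν (either e f) ⇔ (Holds φ ν e ⊎ Holds φ ν f)
  either-⇔ φ ν (p , q) (r , s) = mk⇔ (product-zero _ _ _ _)
    (λ { (inj₁ e) → trans (cong₂ _+_ (cong (_* evalP φ ν r) e) (cong (_* evalP φ ν s) (sym e))) (+-comm (evalP φ ν q * evalP φ ν r) _)
       ; (inj₂ e) → cong₂ _+_ (cong (evalP φ ν p *_) e) (cong (evalP φ ν q *_) (sym e)) })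

  -- The quantifiers of A become the variables ι 0, ι 1, …
  formEq : DioForm → (ℕ → Poly ℕ ℕ) → (ℕ → ℕ) → PolyEq ℕ ℕ
  formEq (i ≐c n) env ι = env i , pcst n
  formEq (i ≐v j) env ι = env i , env j
  formEq (≐add i j k) env ι = env i , padd (env j) (env k)
  formEq (≐mul i j k) env ι = env i , pmul (env j) (env k)
  formEq (A ∧̇ B) env ι = both (formEq A env (ι ∘ double)) (formEq B env (ι ∘ suc ∘ double))
  formEq (A ∨̇ B) env ι = either (formEq A env (ι ∘ double)) (formEq B env (ι ∘ suc ∘ double))
  formEq (∃̇ A) env ι = formEq A (λ { zero → pvar (ι 0) ; (suc i) → env i }) (ι ∘ suc)

  formEq-sound : ∀ A {env ι φ ν ν′} → (∀ i → evalP φ ν (env i) ≡ ν′ i) → Holds φ ν (formEq A env ι) → ⟦ A ⟧ ν′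
  formEq-sound (i ≐c n) h e = trans (sym (h i)) e
  formEq-sound (i ≐v j) h e = trans (sym (h i)) (trans e (h j))
  formEq-sound (≐add i j k) h e = trans (sym (h i)) (trans e (cong₂ _+_ (h j) (h k)))
  formEq-sound (≐mul i j k) h e = trans (sym (h i)) (trans e (cong₂ _*_ (h j) (h k)))
  formEq-sound (A ∧̇ B) {φ = φ} {ν} h e with to (both-⇔ φ ν (formEq A _ _) (formEq B _ _)) e
  ... | a , b = formEq-sound A h a , formEq-sound B h b
  formEq-sound (A ∨̇ B) {φ = φ} {ν} h e with to (either-⇔ φ ν (formEq A _ _) (formEq B _ _)) e
  ... | inj₁ a = inj₁ (formEq-sound A h a)
  ... | inj₂ b = inj₂ (formEq-sound B h b)
  formEq-sound (∃̇ A) {ι = ι} {φ} h e = φ (ι 0) , formEq-sound A (λ { zero → refl ; (suc i) → h i }) e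

  -- The witnesses ψ are fixed before the names and the environment are, so those of two subformulas
  -- can be interleaved.
  formEq-complete : ∀ A {ν′} → ⟦ A ⟧ ν′ → ∃ λ (ψ : ℕ → ℕ) → ∀ {env ι φ ν} →
    (∀ k → φ (ι k) ≡ ψ k) → (∀ i → evalP φ ν (env i) ≡ ν′ i) → Holds φ ν (formEq A env ι)
  formEq-complete (i ≐c n) e = id , λ _ h → trans (h i) e
  formEq-complete (i ≐v j) e = id , λ _ h → trans (h i) (trans e (sym (h j)))
  formEq-complete (≐add i j k) e = id , λ _ h → trans (h i) (trans e (sym (cong₂ _+_ (h j) (h k))))
  formEq-complete (≐mul i j k) e = id , λ _ h → trans (h i) (trans e (sym (cong₂ _*_ (h j) (h k))))
  formEq-complete (A ∧̇ B) (a , b) with formEq-complete A a | formEq-complete B b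
  ... | ψ₁ , f | ψ₂ , g = interleave ψ₁ ψ₂ , λ {_} {_} {φ} {ν} hι h → from (both-⇔ φ ν (formEq A _ _) (formEq B _ _))
    ( f (λ k → trans (hι (double k)) (interleave-even ψ₁ ψ₂ k)) h
    , g (λ k → trans (hι (suc (double k))) (interleave-odd ψ₁ ψ₂ k)) h )
  formEq-complete (A ∨̇ B) (inj₁ a) with formEq-complete A a
  -- One factor vanishes, so the quantifiers of the other disjunct may take any values, here ψ
  -- again.
  ... | ψ , f = interleave ψ ψ , λ {_} {_} {φ} {ν} hι h → from (either-⇔ φ ν (formEq A _ _) (formEq B _ _))
    (inj₁ (f (λ k → trans (hι (double k)) (interleave-even ψ ψ k)) h))
  formEq-complete (A ∨̇ B) (inj₂ b) with formEq-complete B b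
  ... | ψ , f = interleave ψ ψ , λ {_} {_} {φ} {ν} hι h → from (either-⇔ φ ν (formEq A _ _) (formEq B _ _))
    (inj₂ (f (λ k → trans (hι (suc (double k))) (interleave-odd ψ ψ k)) h))
  formEq-complete (∃̇ A) (n , a) with formEq-complete A a
  ... | ψ , f = (λ { zero → n ; (suc k) → ψ k }) , λ hι h → f (λ k → hι (suc k)) (λ { zero → hι 0 ; (suc i) → h i })

  dio-form⪯dio-single : DIO-FORM ⪯ DIO-SINGLE
  dio-form⪯dio-single = (λ { (A , ν) → let (p , q) = formEq A ppar id in p , q , ν }) , λ { (A , ν) → mk⇔
    (λ a → let (ψ , f) = formEq-complete A a in ψ , f (λ _ → refl) (λ _ → refl))
    (λ { (φ , e) → formEq-sound A (λ _ → refl) e }) }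

  -- The value of p sits at node 0 and its subterms occupy the odd and the positive even nodes.
  nodeˡ nodeʳ : ℕ → ℕ
  nodeˡ = suc ∘ double
  nodeʳ = suc ∘ suc ∘ double

  branch : ℕ → (ℕ → ℕ) → (ℕ → ℕ) → ℕ → ℕ
  branch x f g zero = x
  branch x f g (suc n) = interleave f g n

  flatten : Poly ℕ ℕ → (ℕ → ℕ) → (ℕ → ℕ) → List DioElem
  flatten (pvar u) o ι = var (ι 0) (o u) ∷ []
  flatten (ppar x) o ι = par (ι 0) x ∷ []
  flatten (pcst n) o ι = cst (ι 0) n ∷ []
  flatten (padd p q) o ι = add (ι 0) (ι (nodeˡ 0)) (ι (nodeʳ 0)) ∷ flatten p o (ι ∘ nodeˡ) ++ flatten q o (ι ∘ nodeʳ)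
  flatten (pmul p q) o ι = mul (ι 0) (ι (nodeˡ 0)) (ι (nodeʳ 0)) ∷ flatten p o (ι ∘ nodeˡ) ++ flatten q o (ι ∘ nodeʳ)

  values : (ℕ → ℕ) → (ℕ → ℕ) → Poly ℕ ℕ → ℕ → ℕ
  values φ ν (padd p q) = branch (evalP φ ν p + evalP φ ν q) (values φ ν p) (values φ ν q)
  values φ ν (pmul p q) = branch (evalP φ ν p * evalP φ ν q) (values φ ν p) (values φ ν q)
  values φ ν p = λ _ → evalP φ ν p

  values-0 : ∀ φ ν p → values φ ν p 0 ≡ evalP φ ν p
  values-0 φ ν (pvar _) = refl
  values-0 φ ν (ppar _) = refl
  values-0 φ ν (pcst _) = refl
  values-0 φ ν (padd _ _) = refl
  values-0 φ ν (pmul _ _) = refl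

  flatten-sound : ∀ {χ ν} p o ι → All (elemSat χ ν) (flatten p o ι) → χ (ι 0) ≡ evalP (χ ∘ o) ν p
  flatten-sound (pvar u) o ι (e ∷ []) = e
  flatten-sound (ppar x) o ι (e ∷ []) = e
  flatten-sound (pcst n) o ι (e ∷ []) = e
  flatten-sound (padd p q) o ι (e ∷ h) with ++⁻ (flatten p o (ι ∘ nodeˡ)) h
  ... | hp , hq = trans e (cong₂ _+_ (flatten-sound p o (ι ∘ nodeˡ) hp) (flatten-sound q o (ι ∘ nodeʳ) hq))
  flatten-sound (pmul p q) o ι (e ∷ h) with ++⁻ (flatten p o (ι ∘ nodeˡ)) h
  ... | hp , hq = trans e (cong₂ _*_ (flatten-sound p o (ι ∘ nodeˡ) hp) (flatten-sound q o (ι ∘ nodeʳ) hq))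

  flatten-complete : ∀ {χ φ ν} p o ι → (∀ u → χ (o u) ≡ φ u) → (∀ k → χ (ι k) ≡ values φ ν p k) →
                     All (elemSat χ ν) (flatten p o ι)
  flatten-complete (pvar u) o ι ho hι = trans (hι 0) (sym (ho u)) ∷ []
  flatten-complete (ppar x) o ι ho hι = hι 0 ∷ []
  flatten-complete (pcst n) o ι ho hι = hι 0 ∷ []
  flatten-complete {χ} {φ} {ν} (padd p q) o ι ho hι =
    trans (hι 0) (sym (cong₂ _+_ (trans (hp 0) (values-0 φ ν p)) (trans (hq 0) (values-0 φ ν q))))
    ∷ ++⁺ (flatten-complete p o (ι ∘ nodeˡ) ho hp) (flatten-complete q o (ι ∘ nodeʳ) ho hq)
    where
    hp : ∀ k → χ (ι (nodeˡ k)) ≡ values φ ν p k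
    hp k = trans (hι (nodeˡ k)) (interleave-even (values φ ν p) (values φ ν q) k)
    hq : ∀ k → χ (ι (nodeʳ k)) ≡ values φ ν q k
    hq k = trans (hι (nodeʳ k)) (interleave-odd (values φ ν p) (values φ ν q) k)
  flatten-complete {χ} {φ} {ν} (pmul p q) o ι ho hι =
    trans (hι 0) (sym (cong₂ _*_ (trans (hp 0) (values-0 φ ν p)) (trans (hq 0) (values-0 φ ν q))))
    ∷ ++⁺ (flatten-complete p o (ι ∘ nodeˡ) ho hp) (flatten-complete q o (ι ∘ nodeʳ) ho hq)
    where
    hp : ∀ k → χ (ι (nodeˡ k)) ≡ values φ ν p k
    hp k = trans (hι (nodeˡ k)) (interleave-even (values φ ν p) (values φ ν q) k)
    hq : ∀ k → χ (ι (nodeʳ k)) ≡ values φ ν q k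
    hq k = trans (hι (nodeʳ k)) (interleave-odd (values φ ν p) (values φ ν q) k)

  dio-single⪯dio-elem : DIO-SINGLE ⪯ DIO-ELEM
  dio-single⪯dio-elem = (λ { (p , q , ν) → elems p q , ν }) , λ { (p , q , ν) → mk⇔ (complete p q ν) (sound p q ν) }
    where
    ιᵖ ι^q : ℕ → ℕ
    -- Residues modulo 4 separate the names: even numbers for the variables of the equation, 4 k + 1
    -- for nodes of p, 4 k + 3 for nodes of q.
    ιᵖ = suc ∘ double ∘ double
    ι^q = suc ∘ double ∘ suc ∘ double
    elems : Poly ℕ ℕ → Poly ℕ ℕ → List DioElem
    elems p q = var (ιᵖ 0) (ι^q 0) ∷ flatten p double ιᵖ ++ flatten q double ι^q
    sound : ∀ p q ν → DIO-ELEM (elems p q , ν) → DIO-SINGLE (p , q , ν)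
    sound p q ν (χ , e ∷ h) with ++⁻ (flatten p double ιᵖ) h
    ... | hp , hq = χ ∘ double , trans (sym (flatten-sound p double ιᵖ hp)) (trans e (flatten-sound q double ι^q hq))
    complete : ∀ p q ν → DIO-SINGLE (p , q , ν) → DIO-ELEM (elems p q , ν)
    complete p q ν (φ , e) = χ
      , trans (hp 0) (trans (values-0 φ ν p) (trans e (sym (trans (hq 0) (values-0 φ ν q)))))
      ∷ ++⁺ (flatten-complete p double ιᵖ ho hp) (flatten-complete q double ι^q ho hq)
      where
      χ = interleave φ (interleave (values φ ν p) (values φ ν q))
      ho : ∀ u → χ (double u) ≡ φ u
      ho = interleave-even φ (interleave (values φ ν p) (values φ ν q))
      hp : ∀ k → χ (ιᵖ k) ≡ values φ ν p k
      hp k = trans (interleave-odd φ (interleave (values φ ν p) (values φ ν q)) (double k)) (interleave-even (values φ ν p) (values φ ν q) k)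
      hq : ∀ k → χ (ι^q k) ≡ values φ ν q k
      hq k = trans (interleave-odd φ (interleave (values φ ν p) (values φ ν q)) (suc (double k))) (interleave-odd (values φ ν p) (values φ ν q) k)

  dio-form⪯dio-elem : DIO-FORM ⪯ DIO-ELEM
  dio-form⪯dio-elem = ⪯-trans {S = DIO-ELEM} dio-form⪯dio-single dio-single⪯dio-elem

  elemEq : DioElem → PolyEq ℕ ℕ
  elemEq (cst u n) = pvar u , pcst n
  elemEq (var u w) = pvar u , pvar w
  elemEq (par u i) = pvar u , ppar i
  elemEq (add u v w) = pvar u , padd (pvar v) (pvar w)
  elemEq (mul u v w) = pvar u , pmul (pvar v) (pvar w)

  elemEq-⇔ : ∀ φ ν c → Holds φ ν (elemEq c) ⇔ elemSat φ ν c
  elemEq-⇔ φ ν (cst u n) = mk⇔ id id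
  elemEq-⇔ φ ν (var u v) = mk⇔ id id
  elemEq-⇔ φ ν (par u i) = mk⇔ id id
  elemEq-⇔ φ ν (add u v w) = mk⇔ id id
  elemEq-⇔ φ ν (mul u v w) = mk⇔ id id

  elemsEq : List DioElem → PolyEq ℕ ℕ
  elemsEq [] = pcst 0 , pcst 0
  elemsEq (c ∷ l) = both (elemEq c) (elemsEq l)

  elemsEq-⇔ : ∀ φ ν l → Holds φ ν (elemsEq l) ⇔ All (elemSat φ ν) l
  elemsEq-⇔ φ ν [] = mk⇔ (λ _ → []) (λ _ → refl)
  elemsEq-⇔ φ ν (c ∷ l) = mk⇔
    (λ e → let (h , t) = to (both-⇔ φ ν (elemEq c) (elemsEq l)) e in to (elemEq-⇔ φ ν c) h ∷ to (elemsEq-⇔ φ ν l) t)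
    (λ { (h ∷ t) → from (both-⇔ φ ν (elemEq c) (elemsEq l)) (from (elemEq-⇔ φ ν c) h , from (elemsEq-⇔ φ ν l) t) })

  dio-elem⪯dio-single : DIO-ELEM ⪯ DIO-SINGLE
  dio-elem⪯dio-single = (λ { (l , ν) → let (p , q) = elemsEq l in p , q , ν }) , λ { (l , ν) → mk⇔
    (λ { (φ , h) → φ , from (elemsEq-⇔ φ ν l) h })
    (λ { (φ , e) → φ , to (elemsEq-⇔ φ ν l) e }) }

  -- A total renaming that fixes all indices up to n. Solutions pull back along it, and they push
  -- forward because n bounds every variable that occurs.
  clamp : ∀ n → ℕ → Fin (suc n)
  clamp n u = fromℕ< {m = u ⊓ n} (s≤s (m⊓n≤n u n))

  toℕ-clamp : ∀ {n u} → u ≤ n → toℕ (clamp n u) ≡ u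
  toℕ-clamp {n} {u} u≤n = trans (toℕ-fromℕ< _) (m≤n⇒m⊓n≡m u≤n)

  close : {U W : Set} → (U → W) → (ℕ → ℕ) → Poly U ℕ → Poly W ⊥
  close f ν (pvar u) = pvar (f u)
  close f ν (ppar x) = pcst (ν x)
  close f ν (pcst n) = pcst n
  close f ν (padd p q) = padd (close f ν p) (close f ν q)
  close f ν (pmul p q) = pmul (close f ν p) (close f ν q)

  maxVar : Poly ℕ ℕ → ℕ
  maxVar (pvar u) = u
  maxVar (ppar x) = 0
  maxVar (pcst n) = 0
  maxVar (padd p q) = maxVar p ⊔ maxVar q
  maxVar (pmul p q) = maxVar p ⊔ maxVar q

  close-eval : ∀ {W : Set} (f : ℕ → W) ν φ ψ p → (∀ u → u ≤ maxVar p → φ (f u) ≡ ψ u) →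
               evalP φ ⊥-elim (close f ν p) ≡ evalP ψ ν p
  close-eval f ν φ ψ (pvar u) h = h u ≤-refl
  close-eval f ν φ ψ (ppar x) h = refl
  close-eval f ν φ ψ (pcst n) h = refl
  close-eval f ν φ ψ (padd p q) h = cong₂ _+_
    (close-eval f ν φ ψ p (λ u u≤ → h u (≤-trans u≤ (m≤m⊔n _ _)))) (close-eval f ν φ ψ q (λ u u≤ → h u (≤-trans u≤ (m≤n⊔m (maxVar p) _))))
  close-eval f ν φ ψ (pmul p q) h = cong₂ _*_
    (close-eval f ν φ ψ p (λ u u≤ → h u (≤-trans u≤ (m≤m⊔n _ _)))) (close-eval f ν φ ψ q (λ u u≤ → h u (≤-trans u≤ (m≤n⊔m (maxVar p) _))))

  dio-single⪯h10 : DIO-SINGLE ⪯ H10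
  dio-single⪯h10 = (λ { (p , q , ν) → let n = maxVar p ⊔ maxVar q in suc n , close (clamp n) ν p , close (clamp n) ν q }) ,
    λ { (p , q , ν) → let n = maxVar p ⊔ maxVar q in mk⇔
      (λ { (φ , e) → φ ∘ toℕ
         , trans (close-eval (clamp n) ν (φ ∘ toℕ) φ p (λ u u≤ → cong φ (toℕ-clamp (≤-trans u≤ (m≤m⊔n _ _)))))
             (trans e (sym (close-eval (clamp n) ν (φ ∘ toℕ) φ q (λ u u≤ → cong φ (toℕ-clamp (≤-trans u≤ (m≤n⊔m (maxVar p) _))))))) })
      (λ { (φ , e) → φ ∘ clamp n
         , trans (sym (close-eval (clamp n) ν φ (φ ∘ clamp n) p (λ _ _ → refl)))
             (trans e (close-eval (clamp n) ν φ (φ ∘ clamp n) q (λ _ _ → refl))) }) }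

-- Derivability by string rewriting as a correspondence problem.

module Rewriting where

  open import Data.Nat using (ℕ)
  open import Data.Bool using (Bool; true; false; not)
  open import Data.Bool.Properties using (not-¬)
  open import Data.List using (List; []; _∷_; _++_; map; concatMap)
  open import Data.List.Properties using (map-++; ++-assoc; ++-identityʳ; map-injective; ∷-injective)
  open import Data.List.Membership.Propositional using (_∈_)
  open import Data.List.Membership.Propositional.Properties using (∈-map⁺; ∈-map⁻; ∈-++⁺ˡ; ∈-++⁺ʳ; ∈-++⁻; ∈-lookup)
  open import Data.List.Relation.Unary.Any using (here; there; index)
  open import Data.List.Relation.Unary.Any.Properties using (lookup-index)
  open import Data.List.Relation.Unary.All using (All; []; _∷_)

  Domino : Set → Set
  Domino B = List B × List B

  top bot : ∀ {B : Set} → List (Domino B) → List B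
  top = concatMap proj₁
  bot = concatMap proj₂

  Solvable : ∀ {B : Set} → List (Domino B) → Set
  Solvable {B} D = ∃ λ (ds : List (Domino B)) → ds ≢ [] × All (_∈ D) ds × top ds ≡ bot ds

  module _ {B : Set} (code : B → ℕ) (injective : ∀ {a b} → code a ≡ code b → a ≡ b) (D : List (Domino B)) where

    coded : Domino B → String × String
    coded (u , v) = map code u , map code v

    instance-of : List (String × String)
    instance-of = map coded D

    indices : ∀ ds → All (_∈ D) ds → ∃ λ is → (ds ≢ [] → is ≢ []) ×
              tops instance-of is ≡ map code (top ds) × bots instance-of is ≡ map code (bot ds)
    indices [] [] = [] , (λ h _ → h refl) , refl , refl
    indices (d ∷ ds) (p ∷ ps) with indices ds ps
    ... | is , _ , t , b = index p′ ∷ is , (λ _ ()) ,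
        trans (cong₂ _++_ (cong proj₁ (sym (lookup-index p′))) t) (sym (map-++ code (proj₁ d) (top ds))) ,
        trans (cong₂ _++_ (cong proj₂ (sym (lookup-index p′))) b) (sym (map-++ code (proj₂ d) (bot ds)))
      where p′ = ∈-map⁺ coded p

    dominos : ∀ is → ∃ λ ds → (is ≢ [] → ds ≢ []) × All (_∈ D) ds ×
              tops instance-of is ≡ map code (top ds) × bots instance-of is ≡ map code (bot ds)
    dominos [] = [] , (λ h _ → h refl) , [] , refl , refl
    dominos (i ∷ is) with dominos is | ∈-map⁻ coded (∈-lookup {xs = instance-of} i)
    ... | ds , _ , ps , t , b | d , p , e = d ∷ ds , (λ _ ()) , p ∷ ps ,
        trans (cong₂ _++_ (cong proj₁ e) t) (sym (map-++ code (proj₁ d) (top ds))) ,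
        trans (cong₂ _++_ (cong proj₂ e) b) (sym (map-++ code (proj₂ d) (bot ds)))

    solvable⇔PCP : Solvable D ⇔ PCP instance-of
    solvable⇔PCP = mk⇔
      (λ { (ds , ne , ps , e) → let (is , ne′ , t , b) = indices ds ps in is , ne′ ne , trans t (trans (cong (map code) e) (sym b)) })
      (λ { (is , ne , e) → let (ds , ne′ , ps , t , b) = dominos is in
           ds , ne′ ne , ps , map-injective injective (trans (sym t) (trans e b)) })

  data Rewrite {A : Set} (R : List (List A × List A)) : List A → List A → Set where
    rewrite-at : ∀ x {u v} y → (u , v) ∈ R → Rewrite R (x ++ u ++ y) (x ++ v ++ y)

  data Letter (A : Set) : Set where
    $ : Letter A
    sep : Bool → Letter A
    sym′ : Bool → A → Letter A

  -- Successive words of a derivation are written in alternating copies of the alphabet. The two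
  -- sides of a domino use different copies, so that only the start domino can come first.
  module Derivation {A : Set} (alphabet : List A) (complete : ∀ a → a ∈ alphabet)
    (R : List (List A × List A))
    (nonempty : ∀ {u v} → (u , v) ∈ R → (∃₂ λ a u′ → u ≡ a ∷ u′) × (∃₂ λ b v′ → v ≡ b ∷ v′))
    (start : List A) (final : A) where

    word : Bool → List A → List (Letter A)
    word φ = map (sym′ φ)

    startD : Domino (Letter A)
    startD = $ ∷ [] , $ ∷ word true start ++ sep true ∷ []

    copyD : Bool → A → Domino (Letter A)
    copyD φ a = sym′ φ a ∷ [] , sym′ (not φ) a ∷ []

    -- With `endD` the top catches up with the bottom, once the current word is `final` alone.
    sepD endD : Bool → Domino (Letter A)
    sepD φ = sep φ ∷ [] , sep (not φ) ∷ []
    endD φ = sym′ φ final ∷ sep φ ∷ $ ∷ [] , $ ∷ []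

    ruleD : Bool → List A × List A → Domino (Letter A)
    ruleD φ (u , v) = word φ u , word (not φ) v

    phaseDs : Bool → List (Domino (Letter A))
    phaseDs φ = sepD φ ∷ endD φ ∷ map (copyD φ) alphabet ++ map (ruleD φ) R

    dominoSet : List (Domino (Letter A))
    dominoSet = startD ∷ phaseDs true ++ phaseDs false

    data IsDomino : Domino (Letter A) → Set where
      is-start : IsDomino startD
      is-sep   : ∀ φ → IsDomino (sepD φ)
      is-end   : ∀ φ → IsDomino (endD φ)
      is-copy  : ∀ φ a → IsDomino (copyD φ a)
      is-rule  : ∀ φ {u v} → (u , v) ∈ R → IsDomino (ruleD φ (u , v))

    phase⁺ : ∀ φ {d} → d ∈ phaseDs φ → d ∈ dominoSet
    phase⁺ true p = there (∈-++⁺ˡ p)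
    phase⁺ false p = there (∈-++⁺ʳ (phaseDs true) p)

    isDomino⇒∈ : ∀ {d} → IsDomino d → d ∈ dominoSet
    isDomino⇒∈ is-start = here refl
    isDomino⇒∈ (is-sep φ) = phase⁺ φ (here refl)
    isDomino⇒∈ (is-end φ) = phase⁺ φ (there (here refl))
    isDomino⇒∈ (is-copy φ a) = phase⁺ φ (there (there (∈-++⁺ˡ (∈-map⁺ (copyD φ) (complete a)))))
    isDomino⇒∈ (is-rule φ p) = phase⁺ φ (there (there (∈-++⁺ʳ (map (copyD φ) alphabet) (∈-map⁺ (ruleD φ) p))))

    phase⁻ : ∀ φ {d} → d ∈ phaseDs φ → IsDomino d
    phase⁻ φ (here refl) = is-sep φ
    phase⁻ φ (there (here refl)) = is-end φ
    phase⁻ φ (there (there p)) with ∈-++⁻ (map (copyD φ) alphabet) p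
    ... | inj₁ q with ∈-map⁻ (copyD φ) q
    ... | a , _ , refl = is-copy φ a
    phase⁻ φ (there (there p)) | inj₂ q with ∈-map⁻ (ruleD φ) q
    ... | r , h , refl = is-rule φ h

    ∈⇒isDomino : ∀ {d} → d ∈ dominoSet → IsDomino d
    ∈⇒isDomino (here refl) = is-start
    ∈⇒isDomino (there p) with ∈-++⁻ (phaseDs true) p
    ... | inj₁ q = phase⁻ true q
    ... | inj₂ q = phase⁻ false q

    copies : ∀ φ x → ∃ λ ds → ∀ ds′ → (All IsDomino ds′ → All IsDomino (ds ++ ds′)) ×
             top (ds ++ ds′) ≡ word φ x ++ top ds′ × bot (ds ++ ds′) ≡ word (not φ) x ++ bot ds′
    copies φ [] = [] , λ ds′ → (λ h → h) , refl , refl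
    copies φ (a ∷ x) with copies φ x
    ... | ds , k = copyD φ a ∷ ds , λ ds′ → let (h , t , b) = k ds′ in
        (λ p → is-copy φ a ∷ h p) , cong (sym′ φ a ∷_) t , cong (sym′ (not φ) a ∷_) b

    word-++³ : ∀ φ (x u y : List A) T → word φ (x ++ u ++ y) ++ T ≡ word φ x ++ word φ u ++ word φ y ++ T
    word-++³ φ x u y T = begin
      word φ (x ++ u ++ y) ++ T               ≡⟨ cong (_++ T) (map-++ (sym′ φ) x (u ++ y)) ⟩
      (word φ x ++ word φ (u ++ y)) ++ T      ≡⟨ ++-assoc (word φ x) _ T ⟩
      word φ x ++ word φ (u ++ y) ++ T        ≡⟨ cong (λ z → word φ x ++ z ++ T) (map-++ (sym′ φ) u y) ⟩
      word φ x ++ (word φ u ++ word φ y) ++ T ≡⟨ cong (word φ x ++_) (++-assoc (word φ u) _ T) ⟩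
      word φ x ++ word φ u ++ word φ y ++ T   ∎
      where open ≡-Reasoning

    -- The bottom is always one word ahead of the top. Each rewriting step is one pass over the
    -- word: copy, apply the rule, copy, close with a separator; the next pass swaps the two copies
    -- of the alphabet.
    derivation⇒match : ∀ φ {x} → Star (Rewrite R) x (final ∷ []) →
                       ∃ λ ds → All IsDomino ds × top ds ≡ word φ x ++ sep φ ∷ bot ds
    derivation⇒match φ ε = endD φ ∷ [] , is-end φ ∷ [] , refl
    derivation⇒match φ (rewrite-at x {u} {v} y p ◅ s) with derivation⇒match (not φ) s | copies φ x | copies φ y
    ... | ds , h , e | cx , kx | cy , ky with ky (sepD φ ∷ ds)
    ... | hy , ty , by with kx (ruleD φ (u , v) ∷ cy ++ sepD φ ∷ ds)
    ... | hx , tx , bx = cx ++ ruleD φ (u , v) ∷ cy ++ sepD φ ∷ ds , hx (is-rule φ p ∷ hy (is-sep φ ∷ h)) , (begin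
        top (cx ++ ruleD φ (u , v) ∷ cy ++ sepD φ ∷ ds)                ≡⟨ tx ⟩
        word φ x ++ word φ u ++ top (cy ++ sepD φ ∷ ds)                ≡⟨ cong (λ z → word φ x ++ word φ u ++ z) ty ⟩
        word φ x ++ word φ u ++ word φ y ++ sep φ ∷ top ds             ≡⟨ cong (λ z → word φ x ++ word φ u ++ word φ y ++ sep φ ∷ z)
                                                                            (trans e (word-++³ (not φ) x v y _)) ⟩
        word φ x ++ word φ u ++ word φ y ++ sep φ ∷ word (not φ) x ++ word (not φ) v ++ word (not φ) y ++ sep (not φ) ∷ bot ds
          ≡⟨ cong (λ z → word φ x ++ word φ u ++ word φ y ++ sep φ ∷ word (not φ) x ++ word (not φ) v ++ z) (sym by) ⟩
        word φ x ++ word φ u ++ word φ y ++ sep φ ∷ word (not φ) x ++ word (not φ) v ++ bot (cy ++ sepD φ ∷ ds)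
          ≡⟨ cong (λ z → word φ x ++ word φ u ++ word φ y ++ sep φ ∷ z) (sym bx) ⟩
        word φ x ++ word φ u ++ word φ y ++ sep φ ∷ bot (cx ++ ruleD φ (u , v) ∷ cy ++ sepD φ ∷ ds)
          ≡⟨ sym (word-++³ φ x u y _) ⟩
        word φ (x ++ u ++ y) ++ sep φ ∷ bot (cx ++ ruleD φ (u , v) ∷ cy ++ sepD φ ∷ ds) ∎)
      where open ≡-Reasoning

    sym′-injective : ∀ {φ ψ : Bool} {a b : A} → sym′ φ a ≡ sym′ ψ b → φ ≡ ψ × a ≡ b
    sym′-injective refl = refl , refl

    strip : ∀ φ u x {T S} → word φ u ++ T ≡ word φ x ++ sep φ ∷ S → ∃ λ x′ → x ≡ u ++ x′ × T ≡ word φ x′ ++ sep φ ∷ S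
    strip φ [] x e = x , refl , e
    strip φ (a ∷ u) [] ()
    strip φ (a ∷ u) (b ∷ x) e with ∷-injective e
    ... | p , q with strip φ u x q | sym′-injective p
    ... | x′ , refl , e′ | _ , refl = x′ , refl , e′

    extend : ∀ φ (y v : List A) T → word φ y ++ word φ v ++ T ≡ word φ (y ++ v) ++ T
    extend φ y v T = trans (sym (++-assoc (word φ y) _ T)) (cong (_++ T) (sym (map-++ (sym′ φ) y v)))

    -- The unmatched part of the bottom is the rest x of the current word followed by the part y of
    -- the next word that is already written; y ++ x is an intermediate word.
    match⇒derivation : ∀ φ x y ds → All IsDomino ds → top ds ≡ word φ x ++ sep φ ∷ word (not φ) y ++ bot ds →
                       Star (Rewrite R) (y ++ x) (final ∷ [])
    match⇒derivation φ [] y [] [] ()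
    match⇒derivation φ (_ ∷ _) y [] [] ()
    match⇒derivation φ [] y (_ ∷ ds) (is-start ∷ h) ()
    match⇒derivation φ (_ ∷ _) y (_ ∷ ds) (is-start ∷ h) ()
    match⇒derivation φ [] y (_ ∷ ds) (is-copy ψ a ∷ h) ()
    match⇒derivation φ (b ∷ x) y (_ ∷ ds) (is-copy ψ a ∷ h) e with ∷-injective e
    ... | p , q with sym′-injective p
    ... | refl , refl = subst (λ z → Star (Rewrite R) z (final ∷ [])) (++-assoc y (a ∷ []) x)
        (match⇒derivation φ x (y ++ a ∷ []) ds h (trans q (cong (λ z → word φ x ++ sep φ ∷ z) (extend (not φ) y (a ∷ []) (bot ds)))))
    match⇒derivation φ [] y (_ ∷ ds) (is-sep ψ ∷ h) e with ∷-injective e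
    ... | refl , q = subst (λ z → Star (Rewrite R) z (final ∷ [])) (sym (++-identityʳ y)) (match⇒derivation (not φ) y [] ds h q)
    match⇒derivation φ (_ ∷ _) y (_ ∷ ds) (is-sep ψ ∷ h) ()
    match⇒derivation φ [] y (_ ∷ ds) (is-end ψ ∷ h) ()
    match⇒derivation φ (_ ∷ []) [] (_ ∷ ds) (is-end ψ ∷ h) e with sym′-injective (proj₁ (∷-injective e))
    ... | _ , refl = ε
    match⇒derivation φ (_ ∷ []) (_ ∷ _) (_ ∷ ds) (is-end ψ ∷ h) e with proj₂ (∷-injective (proj₂ (∷-injective e)))
    ... | ()
    match⇒derivation φ (_ ∷ _ ∷ _) y (_ ∷ ds) (is-end ψ ∷ h) e with proj₂ (∷-injective e)
    ... | ()
    match⇒derivation φ x y (_ ∷ ds) (is-rule ψ {u} {v} p ∷ h) e with nonempty p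
    match⇒derivation φ [] y (_ ∷ ds) (is-rule ψ {u} {v} p ∷ h) () | (a , u′ , refl) , _
    match⇒derivation φ (b ∷ x) y (_ ∷ ds) (is-rule ψ {u} {v} p ∷ h) e | (a , u′ , refl) , _ with sym′-injective (proj₁ (∷-injective e))
    ... | refl , refl with strip φ (a ∷ u′) (b ∷ x) e
    ... | x′ , refl , e′ = rewrite-at y x′ p ◅ subst (λ z → Star (Rewrite R) z (final ∷ [])) (++-assoc y v x′)
        (match⇒derivation φ x′ (y ++ v) ds h (trans e′ (cong (λ z → word φ x′ ++ sep φ ∷ z) (extend (not φ) y v (bot ds)))))

    flip-≢ : ∀ {φ} {a b : A} → sym′ φ a ≢ sym′ (not φ) b
    flip-≢ e = not-¬ refl (proj₁ (sym′-injective e))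

    derivation⇔solvable : Star (Rewrite R) start (final ∷ []) ⇔ Solvable dominoSet
    derivation⇔solvable = mk⇔ to from
      where
      members : ∀ {ds} → All IsDomino ds → All (_∈ dominoSet) ds
      members [] = []
      members (h ∷ hs) = isDomino⇒∈ h ∷ members hs
      are : ∀ {ds} → All (_∈ dominoSet) ds → All IsDomino ds
      are [] = []
      are (h ∷ hs) = ∈⇒isDomino h ∷ are hs
      to : Star (Rewrite R) start (final ∷ []) → Solvable dominoSet
      to s with derivation⇒match true s
      ... | ds , h , e = startD ∷ ds , (λ ()) , members (is-start ∷ h) ,
          cong ($ ∷_) (trans e (sym (++-assoc (word true start) (sep true ∷ []) (bot ds))))
      from : Solvable dominoSet → Star (Rewrite R) start (final ∷ [])
      from ([] , ne , _) = ⊥-elim (ne refl)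
      from (d ∷ ds , _ , hs , e) = go (are hs) e
        where
        go : All IsDomino (d ∷ ds) → top (d ∷ ds) ≡ bot (d ∷ ds) → _
        go (is-start ∷ h) e = match⇒derivation true start [] ds h
          (trans (proj₂ (∷-injective e)) (++-assoc (word true start) (sep true ∷ []) (bot ds)))
        go (is-sep φ ∷ h) e with proj₁ (∷-injective e)
        go (is-sep true ∷ h) e | ()
        go (is-sep false ∷ h) e | ()
        go (is-end φ ∷ h) ()
        go (is-copy φ a ∷ h) e = ⊥-elim (flip-≢ (proj₁ (∷-injective e)))
        go (is-rule φ p ∷ h) e with nonempty p
        ... | (a , _ , refl) , (b , _ , refl) = ⊥-elim (flip-≢ (proj₁ (∷-injective e)))

-- Turing machine configurations as words.

module TuringToPCP where

  open import Defs using () renaming (L to moveL; R to moveR; N to moveN)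
  open Rewriting
  open BinomialParity using (+*-injective; bit)
  open import Data.Nat using (ℕ; suc; _+_; _*_; _<_; s≤s; z≤n)
  open import Data.Nat.Properties using (suc-injective)
  open import Data.Bool using (Bool; true; false)
  open import Data.Fin using (Fin; toℕ)
  open import Data.Fin.Properties using (toℕ-injective; toℕ<n)
  open import Data.Maybe using (Maybe; just; nothing; _<∣>_)
  open import Data.List using (List; []; _∷_; _++_; map; concatMap; allFin)
  open import Data.List.Properties using (++-assoc; ++-identityʳ; ∷-injective; ∷ʳ-injective)
  open import Data.List.Membership.Propositional using (_∈_; lose)
  open import Data.List.Membership.Propositional.Properties using (∈-map⁺; ∈-map⁻; ∈-++⁺ˡ; ∈-++⁺ʳ; ∈-++⁻; ∈-concatMap⁺; ∈-concatMap⁻; ∈-allFin)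
  open import Data.List.Relation.Unary.Any using (here; there; satisfied)
  open import Data.List.Relation.Unary.All using (All; []; _∷_)
  open import Data.List.Relation.Unary.All.Properties using (++⁺; ++⁻)

  -- The cell `done` replaces the head of a halted machine and then swallows its neighbours, so that
  -- all halting configurations derive one and the same word.
  data Cell (σ k : ℕ) : Set where
    lend rend done : Cell σ k
    sym′ : Fin σ → Cell σ k
    head : Fin k → Maybe (Fin σ) → Cell σ k

  module _ {A : Set} where

    cells : Maybe A → List A
    cells nothing = []
    cells (just a) = a ∷ []

    -- A head that scans no symbol leaves no cell behind when it moves away.
    moved : Move → List A → Maybe A → List A → List A × Maybe A × List A
    moved moveL [] m rs = [] , nothing , cells m ++ rs
    moved moveL (l ∷ ls) m rs = ls , just l , cells m ++ rs
    moved moveR ls m [] = cells m ++ ls , nothing , []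
    moved moveR ls m (r ∷ rs) = cells m ++ ls , just r , rs
    moved moveN ls m rs = ls , m , rs

    parts : Tape A → List A × Maybe A × List A
    parts t = left t , current t , right t

    parts-move : ∀ t mv → parts (tapeMove t mv) ≡ moved mv (left t) (current t) (right t)
    parts-move t moveN = refl
    parts-move niltape moveL = refl
    parts-move (leftof a rs) moveL = refl
    parts-move (rightof a ls) moveL = refl
    parts-move (midtape [] a rs) moveL = refl
    parts-move (midtape (l ∷ ls) a rs) moveL = refl
    parts-move niltape moveR = refl
    parts-move (leftof a rs) moveR = refl
    parts-move (rightof a ls) moveR = refl
    parts-move (midtape ls a []) moveR = refl
    parts-move (midtape ls a (r ∷ rs)) moveR = refl

    parts-act : ∀ t w mv → parts (doAct t (w , mv)) ≡ moved mv (left t) (w <∣> current t) (right t)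
    parts-act t nothing mv = parts-move t mv
    parts-act t (just a) mv = parts-move (midtape (left t) a (right t)) mv

  module Machine {σ : ℕ} (M : TM σ) where
    open TM M renaming (trans to δ)

    C : Set
    C = Cell σ states

    leftPart rightPart : List (Fin σ) → List C
    leftPart [] = lend ∷ []
    leftPart (l ∷ ls) = leftPart ls ++ sym′ l ∷ []
    rightPart [] = rend ∷ []
    rightPart (r ∷ rs) = sym′ r ∷ rightPart rs

    -- A head scanning no symbol keeps a cell of its own, so all four shapes of tapes are treated alike.
    config : Fin states → List (Fin σ) × Maybe (Fin σ) × List (Fin σ) → List C
    config q (ls , m , rs) = leftPart ls ++ head q m ∷ rightPart rs

    confOf : TMConf M → List C
    confOf (q , t) = config q (parts t)

    content : Maybe (Fin σ) → List C
    content m = map sym′ (cells m)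

    Window : Set
    Window = List C × List C × List C

    -- A window (x , y , z) rewrites x, the old head and y to z. It covers the one neighbour that
    -- the move has to inspect, which may be an end marker.
    windows : Move → Fin states → Maybe (Fin σ) → List Window
    windows moveN q m = ([] , [] , head q m ∷ []) ∷ []
    windows moveL q m = (lend ∷ [] , [] , lend ∷ head q nothing ∷ content m)
                      ∷ map (λ l → sym′ l ∷ [] , [] , head q (just l) ∷ content m) (allFin σ)
    windows moveR q m = ([] , rend ∷ [] , content m ++ head q nothing ∷ rend ∷ [])
                      ∷ map (λ r → [] , sym′ r ∷ [] , content m ++ head q (just r) ∷ []) (allFin σ)

    toRule : Fin states → Maybe (Fin σ) → Window → List C × List C
    toRule q m (x , y , z) = x ++ head q m ∷ y , z

    rulesAt : Fin states → Maybe (Fin σ) → Bool → Fin states × (Maybe (Fin σ) × Move) → List (List C × List C)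
    rulesAt q m true _ = (head q m ∷ [] , done ∷ []) ∷ []
    rulesAt q m false (q′ , w , mv) = map (toRule q m) (windows mv q′ (w <∣> m))

    scans : List (Fin states × Maybe (Fin σ))
    scans = concatMap (λ q → (q , nothing) ∷ map (λ a → q , just a) (allFin σ)) (allFin states)

    ∈-scans : ∀ q m → (q , m) ∈ scans
    ∈-scans q m = ∈-concatMap⁺ _ (lose (∈-allFin q) (go m))
      where
      go : ∀ m → (q , m) ∈ (q , nothing) ∷ map (λ a → q , just a) (allFin σ)
      go nothing = here refl
      go (just a) = there (∈-map⁺ (λ a → q , just a) (∈-allFin a))

    alphabet : List C
    alphabet = lend ∷ rend ∷ done ∷ map sym′ (allFin σ) ++ map (λ { (q , m) → head q m }) scans

    ∈-alphabet : ∀ c → c ∈ alphabet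
    ∈-alphabet lend = here refl
    ∈-alphabet rend = there (here refl)
    ∈-alphabet done = there (there (here refl))
    ∈-alphabet (sym′ a) = there (there (there (∈-++⁺ˡ (∈-map⁺ sym′ (∈-allFin a)))))
    ∈-alphabet (head q m) = there (there (there (∈-++⁺ʳ (map sym′ (allFin σ)) (∈-map⁺ _ (∈-scans q m)))))

    scanRules : Fin states × Maybe (Fin σ) → List (List C × List C)
    scanRules (q , m) = rulesAt q m (halt q) (δ q m)

    eraseRules : C → List (List C × List C)
    eraseRules c = (c ∷ done ∷ [] , done ∷ []) ∷ (done ∷ c ∷ [] , done ∷ []) ∷ []

    rules : List (List C × List C)
    rules = concatMap scanRules scans ++ concatMap eraseRules alphabet

    data Rule : List C × List C → Set where
      run    : ∀ {q m q′ w mv x y z} → halt q ≡ false → δ q m ≡ (q′ , w , mv) →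
               (x , y , z) ∈ windows mv q′ (w <∣> m) → Rule (x ++ head q m ∷ y , z)
      stop   : ∀ {q m} → halt q ≡ true → Rule (head q m ∷ [] , done ∷ [])
      eraseˡ : ∀ c → Rule (c ∷ done ∷ [] , done ∷ [])
      eraseʳ : ∀ c → Rule (done ∷ c ∷ [] , done ∷ [])

    scan⇒∈ : ∀ {r} q m → r ∈ scanRules (q , m) → r ∈ rules
    scan⇒∈ q m h = ∈-++⁺ˡ (∈-concatMap⁺ scanRules (lose (∈-scans q m) h))

    rule⇒∈ : ∀ {r} → Rule r → r ∈ rules
    rule⇒∈ (run {q} {m} {q′} {w} {mv} {x} {y} {z} h e p) = scan⇒∈ q m
      (subst₂ (λ b t → toRule q m (x , y , z) ∈ rulesAt q m b t) (sym h) (sym e) (∈-map⁺ (toRule q m) p))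
    rule⇒∈ (stop {q} {m} h) = scan⇒∈ q m (subst (λ b → _ ∈ rulesAt q m b (δ q m)) (sym h) (here refl))
    rule⇒∈ (eraseˡ c) = ∈-++⁺ʳ (concatMap scanRules scans) (∈-concatMap⁺ eraseRules (lose (∈-alphabet c) (here refl)))
    rule⇒∈ (eraseʳ c) = ∈-++⁺ʳ (concatMap scanRules scans) (∈-concatMap⁺ eraseRules (lose (∈-alphabet c) (there (here refl))))

    ∈⇒rule : ∀ {r} → r ∈ rules → Rule r
    ∈⇒rule p with ∈-++⁻ (concatMap scanRules scans) p
    ... | inj₂ p′ with satisfied (∈-concatMap⁻ eraseRules {xs = alphabet} p′)
    ... | c , here refl = eraseˡ c
    ... | c , there (here refl) = eraseʳ c
    ∈⇒rule p | inj₁ p′ with satisfied (∈-concatMap⁻ scanRules {xs = scans} p′)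
    ... | (q , m) , p″ = go (halt q) (δ q m) refl refl p″
      where
      go : ∀ b t → halt q ≡ b → δ q m ≡ t → _ ∈ rulesAt q m b t → Rule _
      go true t h e (here refl) = stop h
      go false (q′ , w , mv) h e p with ∈-map⁻ (toRule q m) p
      ... | (x , y , z) , pw , refl = run h e pw

    window-nonempty : ∀ mv q m {x y z} → (x , y , z) ∈ windows mv q m → ∃₂ λ b z′ → z ≡ b ∷ z′
    window-nonempty moveN q m (here refl) = _ , _ , refl
    window-nonempty moveL q m (here refl) = _ , _ , refl
    window-nonempty moveL q m (there p) with ∈-map⁻ _ p
    ... | l , _ , refl = _ , _ , refl
    window-nonempty moveR q nothing (here refl) = _ , _ , refl
    window-nonempty moveR q (just _) (here refl) = _ , _ , refl
    window-nonempty moveR q m (there p) with ∈-map⁻ _ p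
    window-nonempty moveR q nothing (there p) | r , _ , refl = _ , _ , refl
    window-nonempty moveR q (just _) (there p) | r , _ , refl = _ , _ , refl

    rules-nonempty : ∀ {u v} → (u , v) ∈ rules → (∃₂ λ a u′ → u ≡ a ∷ u′) × (∃₂ λ b v′ → v ≡ b ∷ v′)
    rules-nonempty p with ∈⇒rule p
    ... | stop _ = (_ , _ , refl) , (_ , _ , refl)
    ... | eraseˡ c = (_ , _ , refl) , (_ , _ , refl)
    ... | eraseʳ c = (_ , _ , refl) , (_ , _ , refl)
    ... | run {mv = mv} {x = []} _ _ pw = (_ , _ , refl) , window-nonempty mv _ _ pw
    ... | run {mv = mv} {x = _ ∷ _} _ _ pw = (_ , _ , refl) , window-nonempty mv _ _ pw

    rewrite-to : ∀ x {u v} y {w w′} → Rule (u , v) → w ≡ x ++ u ++ y → w′ ≡ x ++ v ++ y → Rewrite rules w w′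
    rewrite-to x y p refl refl = rewrite-at x y (rule⇒∈ p)

    rightPart-cells : ∀ m rs → rightPart (cells m ++ rs) ≡ content m ++ rightPart rs
    rightPart-cells nothing rs = refl
    rightPart-cells (just a) rs = refl

    leftPart-cells : ∀ m ls → leftPart (cells m ++ ls) ≡ leftPart ls ++ content m
    leftPart-cells nothing ls = sym (++-identityʳ _)
    leftPart-cells (just a) ls = refl

    -- The window W, with x on its left and y on its right, is the one used by the move mv.
    data Fits (q : Fin states) (m : Maybe (Fin σ)) : (mv : Move) → (ls rs : List (Fin σ)) (x y : List C) (W : Window) → Set where
      fitN : ∀ {ls rs} → Fits q m moveN ls rs (leftPart ls) (rightPart rs) ([] , [] , head q m ∷ [])
      fitL₀ : ∀ {rs} → Fits q m moveL [] rs [] (rightPart rs) (lend ∷ [] , [] , lend ∷ head q nothing ∷ content m)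
      fitL : ∀ {l ls rs} → Fits q m moveL (l ∷ ls) rs (leftPart ls) (rightPart rs) (sym′ l ∷ [] , [] , head q (just l) ∷ content m)
      fitR₀ : ∀ {ls} → Fits q m moveR ls [] (leftPart ls) [] ([] , rend ∷ [] , content m ++ head q nothing ∷ rend ∷ [])
      fitR : ∀ {ls r rs} → Fits q m moveR ls (r ∷ rs) (leftPart ls) (rightPart rs) ([] , sym′ r ∷ [] , content m ++ head q (just r) ∷ [])

    fits-∈ : ∀ {q m mv ls rs x y W} → Fits q m mv ls rs x y W → W ∈ windows mv q m
    fits-∈ fitN = here refl
    fits-∈ fitL₀ = here refl
    fits-∈ (fitL {l}) = there (∈-map⁺ _ (∈-allFin l))
    fits-∈ fitR₀ = here refl
    fits-∈ (fitR {r = r}) = there (∈-map⁺ _ (∈-allFin r))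

    fits-source : ∀ {q m mv ls rs x y u v z} c → Fits q m mv ls rs x y (u , v , z) →
                  leftPart ls ++ c ∷ rightPart rs ≡ x ++ (u ++ c ∷ v) ++ y
    fits-source c fitN = refl
    fits-source c fitL₀ = refl
    fits-source c (fitL {l} {ls} {rs}) = ++-assoc (leftPart ls) (sym′ l ∷ []) (c ∷ rightPart rs)
    fits-source c fitR₀ = refl
    fits-source c fitR = refl

    fits-target : ∀ {q m mv ls rs x y u v z} → Fits q m mv ls rs x y (u , v , z) →
                  config q (moved mv ls m rs) ≡ x ++ z ++ y
    fits-target fitN = refl
    fits-target {q} {m} (fitL₀ {rs}) = cong (λ z → lend ∷ head q nothing ∷ z) (rightPart-cells m rs)
    fits-target {q} {m} (fitL {l} {ls} {rs}) = cong (λ z → leftPart ls ++ head q (just l) ∷ z) (rightPart-cells m rs)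
    fits-target {q} {m} (fitR₀ {ls}) = trans (cong (_++ head q nothing ∷ rend ∷ []) (leftPart-cells m ls))
      (trans (++-assoc (leftPart ls) (content m) _) (cong (leftPart ls ++_) (sym (++-identityʳ _))))
    fits-target {q} {m} (fitR {ls} {r} {rs}) = trans (cong (_++ head q (just r) ∷ rightPart rs) (leftPart-cells m ls))
      (trans (++-assoc (leftPart ls) (content m) _) (cong (leftPart ls ++_) (sym (++-assoc (content m) (head q (just r) ∷ []) (rightPart rs)))))

    fits-exists : ∀ q m mv ls rs → ∃ λ x → ∃ λ y → ∃ λ W → Fits q m mv ls rs x y W
    fits-exists q m moveN ls rs = _ , _ , _ , fitN
    fits-exists q m moveL [] rs = _ , _ , _ , fitL₀
    fits-exists q m moveL (l ∷ ls) rs = _ , _ , _ , fitL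
    fits-exists q m moveR ls [] = _ , _ , _ , fitR₀
    fits-exists q m moveR ls (r ∷ rs) = _ , _ , _ , fitR

    step⇒rewrite : ∀ {c c′} → TMStep M c c′ → Rewrite rules (confOf c) (confOf c′)
    step⇒rewrite (step {q} {t} {q′} {w , mv} h e) with fits-exists q′ (w <∣> current t) mv (left t) (right t)
    ... | x , y , W , f = rewrite-to x y (run h e (fits-∈ f)) (fits-source (head q (current t)) f)
        (trans (cong (config q′) (parts-act t w mv)) (fits-target f))

    steps⇒rewrites : ∀ {c c′} → Star (TMStep M) c c′ → Star (Rewrite rules) (confOf c) (confOf c′)
    steps⇒rewrites ε = ε
    steps⇒rewrites (s ◅ ss) = step⇒rewrite s ◅ steps⇒rewrites ss

    eraseLeft : ∀ x y → Star (Rewrite rules) (x ++ done ∷ y) (done ∷ y)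
    eraseLeft [] y = ε
    eraseLeft (c ∷ x) y = under (eraseLeft x y) ◅◅ rewrite-to [] y (eraseˡ c) refl refl ◅ ε
      where
      under : ∀ {w w′} → Star (Rewrite rules) w w′ → Star (Rewrite rules) (c ∷ w) (c ∷ w′)
      under ε = ε
      under (rewrite-at x y p ◅ ss) = rewrite-at (c ∷ x) y p ◅ under ss

    eraseRight : ∀ y → Star (Rewrite rules) (done ∷ y) (done ∷ [])
    eraseRight [] = ε
    eraseRight (c ∷ y) = rewrite-to [] y (eraseʳ c) refl refl ◅ eraseRight y

    data Tame : C → Set where
      lend : Tame lend
      rend : Tame rend
      sym′ : ∀ a → Tame (sym′ a)

    leftPart-tame : ∀ ls → All Tame (leftPart ls)
    leftPart-tame [] = lend ∷ []
    leftPart-tame (l ∷ ls) = ++⁺ (leftPart-tame ls) (sym′ l ∷ [])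

    rightPart-tame : ∀ rs → All Tame (rightPart rs)
    rightPart-tame [] = rend ∷ []
    rightPart-tame (r ∷ rs) = sym′ r ∷ rightPart-tame rs

    -- A configuration has a single cell that is not tame, and every rule mentions such a cell on
    -- its left. This fixes the place where a rule applies.
    unique-wild : ∀ {X Y X′ Y′ c d} → All Tame X → All Tame Y → ¬ Tame d →
                  X ++ c ∷ Y ≡ X′ ++ d ∷ Y′ → X ≡ X′ × c ≡ d × Y ≡ Y′
    unique-wild {X′ = []} [] tY nd refl = refl , refl , refl
    unique-wild {X′ = _ ∷ X′} [] tY nd refl with ++⁻ X′ tY
    ... | _ , td ∷ _ = ⊥-elim (nd td)
    unique-wild {X′ = []} (td ∷ _) tY nd refl = ⊥-elim (nd td)
    unique-wild {X′ = _ ∷ X′} (_ ∷ tX) tY nd e with ∷-injective e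
    ... | refl , e′ with unique-wild tX tY nd e′
    ... | refl , refl , refl = refl , refl , refl

    unfit : ∀ {q m} mv ls rs x y u v z → (u , v , z) ∈ windows mv q m →
            leftPart ls ≡ x ++ u → rightPart rs ≡ v ++ y → Fits q m mv ls rs x y (u , v , z)
    unfit moveN ls rs x y _ _ _ (here refl) e refl with ++-identityʳ x
    ... | e′ rewrite e′ | sym e = fitN
    unfit moveL [] rs x y _ _ _ (here refl) e refl with ∷ʳ-injective [] x e
    ... | refl , _ = fitL₀
    unfit moveL (l ∷ ls) rs x y _ _ _ (here refl) e refl with ∷ʳ-injective (leftPart ls) x e
    ... | _ , ()
    unfit moveL ls rs x y _ _ _ (there p) e e′ with ∈-map⁻ _ p
    unfit moveL [] rs x y _ _ _ (there p) e refl | l , _ , refl with ∷ʳ-injective [] x e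
    ... | _ , ()
    unfit moveL (l′ ∷ ls) rs x y _ _ _ (there p) e refl | l , _ , refl with ∷ʳ-injective (leftPart ls) x e
    ... | refl , refl = fitL
    unfit moveR ls [] x y _ _ _ (here refl) e refl with ++-identityʳ x
    ... | e′ rewrite e′ | sym e = fitR₀
    unfit moveR ls (r ∷ rs) x y _ _ _ (here refl) e ()
    unfit moveR ls rs x y _ _ _ (there p) e e′ with ∈-map⁻ _ p
    unfit moveR ls [] x y _ _ _ (there p) e () | r , _ , refl
    unfit moveR ls (r′ ∷ rs) x y _ _ _ (there p) e refl | r , _ , refl with ++-identityʳ x
    ... | e′ rewrite e′ | sym e = fitR

    HaltsFrom : TMConf M → Set
    HaltsFrom c = ∃ λ c′ → Star (TMStep M) c c′ × halt (proj₁ c′) ≡ true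

    wild-done : ¬ Tame done
    wild-done ()
    wild-head : ∀ {q m} → ¬ Tame (head q m)
    wild-head ()

    -- Erasing rules require `done`, which occurs in no configuration. The stopping rule already
    -- witnesses a halting state, so derivations have to be analysed only as long as they stay among
    -- configurations.
    rewrite⇒step : ∀ c {w w′} → w ≡ confOf c → Rewrite rules w w′ →
                   HaltsFrom c ⊎ (∃ λ c′ → TMStep M c c′ × w′ ≡ confOf c′)
    rewrite⇒step (q , t) e (rewrite-at x {u} {v} y p) = go (∈⇒rule p) e
      where
      tL = leftPart-tame (left t)
      tR = rightPart-tame (right t)
      go : ∀ {u v} → Rule (u , v) → x ++ u ++ y ≡ confOf (q , t) →
           HaltsFrom (q , t) ⊎ (∃ λ c′ → TMStep M (q , t) c′ × x ++ v ++ y ≡ confOf c′)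
      go (eraseˡ c) e with unique-wild tL tR wild-done (trans (sym e) (sym (++-assoc x (c ∷ []) (done ∷ y))))
      ... | _ , () , _
      go (eraseʳ c) e with unique-wild tL tR wild-done (sym e)
      ... | _ , () , _
      go (stop h) e with unique-wild tL tR wild-head (sym e)
      ... | _ , refl , _ = inj₁ ((q , t) , ε , h)
      go (run {mq} {m} {q′} {w} {mv} {a} {b} {z} h tr pw) e
        with unique-wild tL tR wild-head (trans (sym e) (trans (cong (x ++_) (++-assoc a (head mq m ∷ b) y)) (sym (++-assoc x a (head mq m ∷ b ++ y)))))
      ... | eL , refl , eR = inj₂ ((q′ , doAct t (w , mv)) , step h tr ,
          sym (trans (cong (config q′) (parts-act t w mv)) (fits-target (unfit mv (left t) (right t) x y a b z pw eL eR))))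

    rewrites⇒halts : ∀ c {w} → w ≡ confOf c → Star (Rewrite rules) w (done ∷ []) → HaltsFrom c
    rewrites⇒halts (q , t) e ε with unique-wild {X′ = []} (leftPart-tame (left t)) (rightPart-tame (right t)) wild-done (sym e)
    ... | _ , () , _
    rewrites⇒halts c e (r ◅ rs) with rewrite⇒step c e r
    ... | inj₁ h = h
    ... | inj₂ (c′ , s , e′) with rewrites⇒halts c′ e′ rs
    ... | d , ss , h = d , s ◅ ss , h

    halts⇔derivation : ∀ t → TMHalts M t ⇔ Star (Rewrite rules) (confOf (start , t)) (done ∷ [])
    halts⇔derivation t = mk⇔ to (rewrites⇒halts (start , t) refl)
      where
      to : TMHalts M t → Star (Rewrite rules) (confOf (start , t)) (done ∷ [])
      to ((q , t′) , ss , h) = steps⇒rewrites ss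
        ◅◅ rewrite-to (leftPart (left t′)) (rightPart (right t′)) (stop h) refl refl
        ◅ eraseLeft (leftPart (left t′)) (rightPart (right t′)) ◅◅ eraseRight (rightPart (right t′))

  mcode : ∀ {σ} → Maybe (Fin σ) → ℕ
  mcode nothing = 0
  mcode (just a) = suc (toℕ a)

  mcode< : ∀ {σ} (m : Maybe (Fin σ)) → mcode m < suc σ
  mcode< nothing = s≤s z≤n
  mcode< (just a) = s≤s (toℕ<n a)

  mcode-injective : ∀ {σ} (m m′ : Maybe (Fin σ)) → mcode m ≡ mcode m′ → m ≡ m′
  mcode-injective nothing nothing _ = refl
  mcode-injective (just a) (just b) e = cong just (toℕ-injective (suc-injective e))

  -- Mixed radix coding: the tag is the lowest digit, in base 5, and for a head the scanned symbol
  -- is the next one, in base σ + 1.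
  cellTag cellArg cellCode : ∀ {σ k} → Cell σ k → ℕ
  cellTag lend = 0
  cellTag rend = 1
  cellTag done = 2
  cellTag (sym′ _) = 3
  cellTag (head _ _) = 4
  cellArg {σ} (sym′ a) = toℕ a
  cellArg {σ} (head q m) = mcode m + suc σ * toℕ q
  cellArg _ = 0
  cellCode c = cellTag c + 5 * cellArg c

  cellTag<5 : ∀ {σ k} (c : Cell σ k) → cellTag c < 5
  cellTag<5 lend = s≤s z≤n
  cellTag<5 rend = s≤s (s≤s z≤n)
  cellTag<5 done = s≤s (s≤s (s≤s z≤n))
  cellTag<5 (sym′ _) = s≤s (s≤s (s≤s (s≤s z≤n)))
  cellTag<5 (head _ _) = s≤s (s≤s (s≤s (s≤s (s≤s z≤n))))

  cellCode-injective : ∀ {σ k} (c d : Cell σ k) → cellCode c ≡ cellCode d → c ≡ d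
  cellCode-injective {σ} {k} c d e with +*-injective (cellTag c) (cellTag d) (cellArg c) (cellArg d) (cellTag<5 c) (cellTag<5 d) e
  ... | t , a = go c d t a
    where
    go : ∀ c d → cellTag {σ} {k} c ≡ cellTag d → cellArg c ≡ cellArg d → c ≡ d
    go lend lend _ _ = refl
    go rend rend _ _ = refl
    go done done _ _ = refl
    go (sym′ a) (sym′ b) _ e = cong sym′ (toℕ-injective e)
    go (head q m) (head q′ m′) _ e with +*-injective (mcode m) (mcode m′) (toℕ q) (toℕ q′) (mcode< m) (mcode< m′) e
    ... | p , r = cong₂ head (toℕ-injective r) (mcode-injective m m′ p)

  bit<2 : ∀ b → bit b < 2
  bit<2 false = s≤s z≤n
  bit<2 true = s≤s (s≤s z≤n)

  bit-injective : ∀ a b → bit a ≡ bit b → a ≡ b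
  bit-injective false false _ = refl
  bit-injective true true _ = refl

  letterTag : ∀ {A : Set} → Letter A → ℕ
  letterTag $ = 0
  letterTag (sep _) = 1
  letterTag (sym′ _ _) = 2

  letterTag<3 : ∀ {A : Set} (l : Letter A) → letterTag l < 3
  letterTag<3 $ = s≤s z≤n
  letterTag<3 (sep _) = s≤s (s≤s z≤n)
  letterTag<3 (sym′ _ _) = s≤s (s≤s (s≤s z≤n))

  module _ {A : Set} (code : A → ℕ) (injective : ∀ a b → code a ≡ code b → a ≡ b) where
    letterArg letterCode : Letter A → ℕ
    letterArg $ = 0
    letterArg (sep φ) = bit φ
    letterArg (sym′ φ a) = bit φ + 2 * code a
    letterCode l = letterTag l + 3 * letterArg l

    letterCode-injective : ∀ {l m} → letterCode l ≡ letterCode m → l ≡ m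
    letterCode-injective {l} {m} e with +*-injective (letterTag l) (letterTag m) (letterArg l) (letterArg m) (letterTag<3 l) (letterTag<3 m) e
    ... | t , a = go l m t a
      where
      go : ∀ l m → letterTag l ≡ letterTag m → letterArg l ≡ letterArg m → l ≡ m
      go $ $ _ _ = refl
      go (sep φ) (sep ψ) _ e = cong sep (bit-injective φ ψ e)
      go (sym′ φ a) (sym′ ψ b) _ e with +*-injective (bit φ) (bit ψ) (code a) (code b) (bit<2 φ) (bit<2 ψ) e
      ... | p , q = cong₂ sym′ (bit-injective φ ψ p) (injective a b q)

  halt⪯pcp : Halt ⪯ PCP
  halt⪯pcp = (λ { (σ , M , t) → pcp M t }) , λ { (σ , M , t) → mk⇔ (to M t) (from M t) }
    where
    module D {σ} (M : TM σ) (t : Tape (Fin σ)) =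
      Derivation (Machine.alphabet M) (Machine.∈-alphabet M) (Machine.rules M) (Machine.rules-nonempty M) (Machine.confOf M (TM.start M , t)) done
    pcp : ∀ {σ} → TM σ → Tape (Fin σ) → List (String × String)
    pcp M t = instance-of (letterCode cellCode cellCode-injective) (letterCode-injective cellCode cellCode-injective) (D.dominoSet M t)
    pcp⇔ : ∀ {σ} (M : TM σ) t → Solvable (D.dominoSet M t) ⇔ PCP (pcp M t)
    pcp⇔ M t = solvable⇔PCP (letterCode cellCode cellCode-injective) (letterCode-injective cellCode cellCode-injective) (D.dominoSet M t)
    to : ∀ {σ} (M : TM σ) t → TMHalts M t → PCP (pcp M t)
    to M t h = Equivalence.to (pcp⇔ M t) (Equivalence.to (D.derivation⇔solvable M t) (Equivalence.to (Machine.halts⇔derivation M t) h))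
    from : ∀ {σ} (M : TM σ) t → PCP (pcp M t) → TMHalts M t
    from M t h = Equivalence.from (Machine.halts⇔derivation M t) (Equivalence.from (D.derivation⇔solvable M t) (Equivalence.from (pcp⇔ M t) h))

-- Positions of instructions in code.

module Labels where

  open import Data.Nat
  open import Data.Nat.Properties
  open import Data.List using (List; _∷_; length)

  module _ {A : Set} where

    instrAt-≤ : ∀ {s i} {P : List A} {ι} → InstrAt s P i ι → s ≤ i
    instrAt-≤ here = ≤-refl
    instrAt-≤ (there h) = ≤-trans (n≤1+n _) (instrAt-≤ h)

    instrAt-< : ∀ {s i} {P : List A} {ι} → InstrAt s P i ι → i < s + length P
    instrAt-< {s} {P = _ ∷ P} here = m<m+n s (s≤s z≤n)
    instrAt-< {s} {P = _ ∷ P} (there h) = <-≤-trans (instrAt-< h) (≤-reflexive (sym (+-suc s (length P))))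

    instrAt-inside : ∀ {s i} {P : List A} {ι} → InstrAt s P i ι → ¬ OutOfCode s P i
    instrAt-inside h (inj₁ i<s) = <⇒≱ i<s (instrAt-≤ h)
    instrAt-inside h (inj₂ out) = <⇒≱ (instrAt-< h) out

    instrAt-unique : ∀ {s i} {P : List A} {ι κ} → InstrAt s P i ι → InstrAt s P i κ → ι ≡ κ
    instrAt-unique here here = refl
    instrAt-unique here (there q) = ⊥-elim (1+n≰n (instrAt-≤ q))
    instrAt-unique (there p) here = ⊥-elim (1+n≰n (instrAt-≤ p))
    instrAt-unique (there p) (there q) = instrAt-unique p q

-- Gödel numbering of Minsky states by pairwise coprime bases.

module MinskyToFractran where

  open BinomialParity using (bit)
  open Labels
  open import Data.Nat
  open import Data.Nat.Properties
  open import Data.Nat.Divisibility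
  open import Data.Nat.Coprimality using (Coprime; coprime-divisor) renaming (sym to coprime-sym)
  open import Data.Bool using (Bool; true; false; not)
  import Data.Bool as Bool
  open import Data.Bool.Properties using (not-¬)
  open import Data.Fin using (Fin; zero; suc; toℕ)
  import Data.Fin.Properties as Fin
  open import Data.Fin.Properties using (toℕ<n; toℕ-injective)
  open import Data.List using (List; []; _∷_; _++_; length)
  open import Data.List.Relation.Unary.All using (All; []; _∷_)
  open import Data.List.Relation.Unary.All.Properties using (++⁺)
  open import Data.Vec using (Vec; []; _∷_; lookup; _[_]≔_; _[_]%=_)
  open import Relation.Binary using (tri<; tri≈; tri>)

  coprime-1 : ∀ {c} → Coprime c 1
  coprime-1 (_ , h) = ∣1⇒≡1 h

  coprime-* : ∀ {c x y} → Coprime c x → Coprime c y → Coprime c (x * y)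
  coprime-* {c} {x} {y} cx cy {d} (d∣c , d∣xy) =
    cy (d∣c , coprime-divisor (λ { (e∣d , e∣x) → cx (∣-trans e∣d d∣c , e∣x) }) d∣xy)

  coprime-^ : ∀ {c x} n → Coprime c x → Coprime c (x ^ n)
  coprime-^ zero h = coprime-1
  coprime-^ (suc n) h = coprime-* h (coprime-^ n h)

  coprime⇒∤ : ∀ {c x} → 1 < c → Coprime c x → ¬ (c ∣ x)
  coprime⇒∤ 1<c h c∣x = <-irrefl (sym (h (∣-refl , c∣x))) 1<c

  -- Sylvester's sequence, whose members are pairwise coprime.
  predecessors : ℕ → ℕ
  predecessors zero = 1
  predecessors (suc k) = predecessors k * suc (predecessors k)

  base : ℕ → ℕ
  base k = suc (predecessors k)

  1<base : ∀ k → 1 < base k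
  1<base zero = ≤-refl
  1<base (suc k) = s≤s (≤-trans (s≤s⁻¹ (1<base k)) (m≤m*n (predecessors k) (base k)))

  base∣predecessors : ∀ {j k} → j < k → base j ∣ predecessors k
  base∣predecessors {j} {k} j<k = go (≤⇒≤′ j<k)
    where
    go : ∀ {k} → suc j ≤′ k → base j ∣ predecessors k
    go ≤′-refl = n∣m*n (predecessors j)
    go (≤′-step {k} p) = ∣m⇒∣m*n (base k) (go p)

  coprime-base-< : ∀ {j k} → j < k → Coprime (base j) (base k)
  coprime-base-< {j} {k} j<k {d} (p , q) = ∣1⇒≡1 (∣m+n∣m⇒∣n (subst (d ∣_) (+-comm 1 (predecessors k)) q) (∣-trans p (base∣predecessors j<k)))

  coprime-base : ∀ {j k} → j ≢ k → Coprime (base j) (base k)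
  coprime-base {j} {k} j≢k with <-cmp j k
  ... | tri< j<k _ _ = coprime-base-< j<k
  ... | tri≈ _ j≡k _ = ⊥-elim (j≢k j≡k)
  ... | tri> _ _ k<j = coprime-sym (coprime-base-< k<j)

  regs : ∀ {n} → (ℕ → ℕ) → Vec ℕ n → ℕ
  regs b [] = 1
  regs b (x ∷ v) = b 0 ^ x * regs (b ∘ suc) v

  regs-suc : ∀ {n} b (v : Vec ℕ n) α → regs b (v [ α ]%= suc) ≡ b (toℕ α) * regs b v
  regs-suc b (x ∷ v) zero = *-assoc (b 0) (b 0 ^ x) _
  regs-suc b (x ∷ v) (suc α) = trans (cong (b 0 ^ x *_) (regs-suc (b ∘ suc) v α)) (r (b 0 ^ x) (b (suc (toℕ α))) (regs (b ∘ suc) v))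
    where
    r : ∀ x y z → x * (y * z) ≡ y * (x * z)
    r = ℕR.solve-∀

  regs-pred : ∀ {n} b (v : Vec ℕ n) α {u} → lookup v α ≡ suc u → regs b v ≡ b (toℕ α) * regs b (v [ α ]≔ u)
  regs-pred b (x ∷ v) zero {u} refl = *-assoc (b 0) (b 0 ^ u) _
  regs-pred b (x ∷ v) (suc α) {u} e = trans (cong (b 0 ^ x *_) (regs-pred (b ∘ suc) v α e)) (r (b 0 ^ x) (b (suc (toℕ α))) (regs (b ∘ suc) (v [ α ]≔ u)))
    where
    r : ∀ x y z → x * (y * z) ≡ y * (x * z)
    r = ℕR.solve-∀

  coprime-regs : ∀ {n c} b (v : Vec ℕ n) → (∀ α → lookup v α ≡ 0 ⊎ Coprime c (b (toℕ α))) → Coprime c (regs b v)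
  coprime-regs b [] h = coprime-1
  coprime-regs {c = c} b (x ∷ v) h = coprime-* (hd (h zero)) (coprime-regs (b ∘ suc) v (h ∘ suc))
    where
    hd : x ≡ 0 ⊎ Coprime c (b 0) → Coprime c (b 0 ^ x)
    hd (inj₁ refl) = coprime-1
    hd (inj₂ p) = coprime-^ x p

  Blocked : List (ℕ × ℕ) → ℕ → Set
  Blocked Q x = All (λ { (p , q) → ¬ (q ∣ p * x) }) Q

  blocked⇒¬step : ∀ {Q x y} → Blocked Q x → ¬ FStep Q x y
  blocked⇒¬step {x = x} {y} (h ∷ _) (fhere {p = p} {q} e) = h (divides y (trans (sym e) (*-comm q y)))
  blocked⇒¬step (_ ∷ h) (fthere _ st) = blocked⇒¬step h st

  step-++ˡ : ∀ {Q Q′ x y} → FStep Q x y → FStep (Q ++ Q′) x y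
  step-++ˡ (fhere e) = fhere e
  step-++ˡ (fthere h st) = fthere h (step-++ˡ st)

  step-++ʳ : ∀ {Q Q′ x y} → Blocked Q x → FStep Q′ x y → FStep (Q ++ Q′) x y
  step-++ʳ [] st = st
  step-++ʳ (h ∷ hs) st = fthere h (step-++ʳ hs st)

  step-++ : ∀ Q {Q′ x y} → FStep (Q ++ Q′) x y → FStep Q x y ⊎ FStep Q′ x y
  step-++ [] st = inj₂ st
  step-++ (_ ∷ Q) (fhere e) = inj₁ (fhere e)
  step-++ (_ ∷ Q) (fthere h st) with step-++ Q st
  ... | inj₁ st′ = inj₁ (fthere h st′)
  ... | inj₂ st′ = inj₂ st′

  index : Bool → ℕ → ℕ
  index φ zero = bit φ
  index φ (suc i) = suc (suc (index φ i))

  index-injective : ∀ φ ψ i j → index φ i ≡ index ψ j → φ ≡ ψ × i ≡ j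
  index-injective false false zero zero _ = refl , refl
  index-injective true true zero zero _ = refl , refl
  index-injective false true (suc i) zero ()
  index-injective φ ψ (suc i) (suc j) e with index-injective φ ψ i j (suc-injective (suc-injective e))
  ... | p , refl = p , refl
  index-injective false ψ zero (suc j) ()
  index-injective true ψ zero (suc j) ()
  index-injective true true (suc i) zero ()
  index-injective φ false (suc i) zero ()

  module _ {n : ℕ} where

    -- Each label has two bases; a step moves to the other phase, so no fraction has its label on both sides.
    label : Bool → ℕ → ℕ
    label φ i = base (n + index φ i)

    reg : Fin n → ℕ
    reg α = base (toℕ α)

    encode : Bool → MMState n → ℕ
    encode φ (i , v) = label φ i * regs base v

    label≢ : ∀ φ ψ i j → ¬ (φ ≡ ψ × i ≡ j) → Coprime (label φ i) (label ψ j)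
    label≢ φ ψ i j h = coprime-base (λ e → h (index-injective φ ψ i j (+-cancelˡ-≡ n _ _ e)))

    label-flip : ∀ φ i j → Coprime (label φ i) (label (not φ) j)
    label-flip φ i j = label≢ φ (not φ) i j (λ { (e , _) → not-¬ refl e })

    label-reg : ∀ φ i α → Coprime (label φ i) (reg α)
    label-reg φ i α = coprime-base (λ e → <-irrefl (sym e) (<-≤-trans (toℕ<n α) (m≤m+n n _)))

    label-regs : ∀ φ i (v : Vec ℕ n) → Coprime (label φ i) (regs base v)
    label-regs φ i v = coprime-regs base v (λ α → inj₂ (label-reg φ i α))

    -- The order matters: the zero jump of DEC is reached only when the decrementing fraction is
    -- blocked.
    fractions : Bool → ℕ → Instr n → List (ℕ × ℕ)
    fractions φ i (INC α) = (label (not φ) (suc i) * reg α , label φ i) ∷ []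
    fractions φ i (DEC α p) = (label (not φ) (suc i) , label φ i * reg α) ∷ (label (not φ) p , label φ i) ∷ []

    program : Bool → ℕ → List (Instr n) → List (ℕ × ℕ)
    program φ s [] = []
    program φ s (ι ∷ P) = fractions φ s ι ++ program φ (suc s) P

    label∤ : ∀ ψ j {x} → Coprime (label ψ j) x → ¬ (label ψ j ∣ x)
    label∤ ψ j = coprime⇒∤ (1<base (n + index ψ j))

    label-encode : ∀ φ ψ i j v → ¬ (ψ ≡ φ × j ≡ i) → Coprime (label ψ j) (encode φ (i , v))
    label-encode φ ψ i j v h = coprime-* (label≢ ψ φ j i h) (label-regs ψ j v)

    -- Each denominator contains the base of its own label and phase. That base is coprime to the
    -- numerator, which carries the other phase, and to the code of any state with a different label
    -- or phase.
    mismatch : ∀ φ ψ i j v ι → ¬ (ψ ≡ φ × j ≡ i) → Blocked (fractions ψ j ι) (encode φ (i , v))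
    mismatch φ ψ i j v (INC α) h =
      label∤ ψ j (coprime-* (coprime-* (label-flip ψ j (suc j)) (label-reg ψ j α)) (label-encode φ ψ i j v h)) ∷ []
    mismatch φ ψ i j v (DEC α p) h =
        (λ d → label∤ ψ j (coprime-* (label-flip ψ j (suc j)) (label-encode φ ψ i j v h)) (∣-trans (m∣m*n (reg α)) d))
      ∷ label∤ ψ j (coprime-* (label-flip ψ j p) (label-encode φ ψ i j v h)) ∷ []

    program-mismatch : ∀ φ ψ i v s P → ψ ≢ φ → Blocked (program ψ s P) (encode φ (i , v))
    program-mismatch φ ψ i v s [] h = []
    program-mismatch φ ψ i v s (ι ∷ P) h = ++⁺ (mismatch φ ψ i s v ι (h ∘ proj₁)) (program-mismatch φ ψ i v (suc s) P h)

    data Executes (i : ℕ) (v : Vec ℕ n) : Instr n → MMState n → Set where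
      inc  : ∀ {α} → Executes i v (INC α) (suc i , v [ α ]%= suc)
      decS : ∀ {α p u} → lookup v α ≡ suc u → Executes i v (DEC α p) (suc i , v [ α ]≔ u)
      decZ : ∀ {α p} → lookup v α ≡ 0 → Executes i v (DEC α p) (p , v)

    reg-encode : ∀ φ i v α → lookup v α ≡ 0 → Coprime (reg α) (encode φ (i , v))
    reg-encode φ i v α z = coprime-* (coprime-sym (label-reg φ i α)) (coprime-regs base v other)
      where
      other : ∀ β → lookup v β ≡ 0 ⊎ Coprime (reg α) (base (toℕ β))
      other β with α Fin.≟ β
      ... | yes refl = inj₁ z
      ... | no α≢β = inj₂ (coprime-base (α≢β ∘ toℕ-injective))

    -- The base of an empty register divides the denominator but is coprime to the product on the
    -- right.
    dec-blocked : ∀ φ i v α → lookup v α ≡ 0 → ¬ (label φ i * reg α ∣ label (not φ) (suc i) * encode φ (i , v))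
    dec-blocked φ i v α z d = coprime⇒∤ (1<base (toℕ α))
      (coprime-* (coprime-sym (label-reg (not φ) (suc i) α)) (reg-encode φ i v α z))
      (∣-trans (n∣m*n (label φ i)) d)

    inc-eq : ∀ φ i v α → label φ i * encode (not φ) (suc i , v [ α ]%= suc) ≡ label (not φ) (suc i) * reg α * encode φ (i , v)
    inc-eq φ i v α = trans (cong (λ z → label φ i * (label (not φ) (suc i) * z)) (regs-suc base v α))
                       (r (label φ i) (label (not φ) (suc i)) (reg α) (regs base v))
      where
      r : ∀ a b c d → a * (b * (c * d)) ≡ b * c * (a * d)
      r = ℕR.solve-∀

    decS-eq : ∀ φ i v α {u} → lookup v α ≡ suc u →
              label φ i * reg α * encode (not φ) (suc i , v [ α ]≔ u) ≡ label (not φ) (suc i) * encode φ (i , v)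
    decS-eq φ i v α {u} e = trans (r (label φ i) (label (not φ) (suc i)) (reg α) (regs base (v [ α ]≔ u)))
                          (cong (λ z → label (not φ) (suc i) * (label φ i * z)) (sym (regs-pred base v α e)))
      where
      r : ∀ a b c d → a * c * (b * d) ≡ b * (a * (c * d))
      r = ℕR.solve-∀

    decZ-eq : ∀ φ i v p → label φ i * encode (not φ) (p , v) ≡ label (not φ) p * encode φ (i , v)
    decZ-eq φ i v p = r (label φ i) (label (not φ) p) (regs base v)
      where
      r : ∀ a b c → a * (b * c) ≡ b * (a * c)
      r = ℕR.solve-∀

    executes⇒step : ∀ φ {i v ι st} → Executes i v ι st → FStep (fractions φ i ι) (encode φ (i , v)) (encode (not φ) st)
    executes⇒step φ {i} {v} (inc {α}) = fhere (inc-eq φ i v α)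
    executes⇒step φ {i} {v} (decS {α} e) = fhere (decS-eq φ i v α e)
    executes⇒step φ {i} {v} (decZ {α} {p} z) = fthere (dec-blocked φ i v α z) (fhere (decZ-eq φ i v p))

    step⇒executes : ∀ φ i v {y} ι → FStep (fractions φ i ι) (encode φ (i , v)) y →
                    ∃ λ st → Executes i v ι st × y ≡ encode (not φ) st
    step⇒executes φ i v {y} (INC α) (fhere e) = (suc i , v [ α ]%= suc) , inc , *-cancelˡ-≡ y _ (label φ i) (trans e (sym (inc-eq φ i v α)))
    step⇒executes φ i v {y} (DEC α p) st with lookup v α in eq
    ... | zero with st
    ... | fhere e = ⊥-elim (dec-blocked φ i v α eq (divides y (trans (sym e) (*-comm (label φ i * reg α) y))))
    ... | fthere _ (fhere e) = (p , v) , decZ eq , *-cancelˡ-≡ y _ (label φ i) (trans e (sym (decZ-eq φ i v p)))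
    step⇒executes φ i v {y} (DEC α p) st | suc u with st
    ... | fhere e = (suc i , v [ α ]≔ u) , decS eq , *-cancelˡ-≡ y _ (label φ i * reg α) {{m*n≢0 (label φ i) (reg α)}} (trans e (sym (decS-eq φ i v α eq)))
    ... | fthere h _ = ⊥-elim (h (divides (encode (not φ) (suc i , v [ α ]≔ u)) (trans (sym (decS-eq φ i v α eq)) (*-comm (label φ i * reg α) (encode (not φ) (suc i , v [ α ]≔ u))))))

    instrAt-or-out : ∀ {A : Set} s (P : List A) i → (∃ λ ι → InstrAt s P i ι) ⊎ OutOfCode s P i
    instrAt-or-out s [] i with i <? s
    ... | yes p = inj₂ (inj₁ p)
    ... | no p = inj₂ (inj₂ (≤-trans (≤-reflexive (+-identityʳ s)) (≮⇒≥ p)))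
    instrAt-or-out s (ι ∷ P) i with s ≟ i
    ... | yes refl = inj₁ (ι , here)
    ... | no s≢i with instrAt-or-out (suc s) P i
    ... | inj₁ (κ , h) = inj₁ (κ , there h)
    ... | inj₂ (inj₁ i<1+s) = inj₂ (inj₁ (≤∧≢⇒< (s≤s⁻¹ i<1+s) (s≢i ∘ sym)))
    ... | inj₂ (inj₂ h) = inj₂ (inj₂ (subst (_≤ i) (sym (+-suc s (length P))) h))

    executes⇒MMStep : ∀ {s P i v ι st} → InstrAt s P i ι → Executes i v ι st → MMStep s P (i , v) st
    executes⇒MMStep h inc = inc h
    executes⇒MMStep h (decS e) = decS h e
    executes⇒MMStep h (decZ e) = decZ h e

    MMStep⇒executes : ∀ {s P i v st} → MMStep s P (i , v) st → ∃ λ ι → InstrAt s P i ι × Executes i v ι st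
    MMStep⇒executes (inc h) = _ , h , inc
    MMStep⇒executes (decS h e) = _ , h , decS e
    MMStep⇒executes (decZ h e) = _ , h , decZ e

    executes-total : ∀ i v ι → ∃ λ st → Executes i v ι st
    executes-total i v (INC α) = _ , inc
    executes-total i v (DEC α p) with lookup v α in e
    ... | zero = _ , decZ e
    ... | suc u = _ , decS e

    program-step : ∀ φ {s P i v ι y} → InstrAt s P i ι → FStep (fractions φ i ι) (encode φ (i , v)) y →
                   FStep (program φ s P) (encode φ (i , v)) y
    program-step φ here st = step-++ˡ st
    program-step φ {i = i} {v} (there {s} {x = ι} h) st =
      step-++ʳ (mismatch φ φ i s v ι (λ { (_ , refl) → <-irrefl refl (instrAt-≤ h) })) (program-step φ {v = v} h st)

    program-step⁻¹ : ∀ φ ψ s P i v {y} → FStep (program ψ s P) (encode φ (i , v)) y →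
                     ψ ≡ φ × ∃ λ ι → InstrAt s P i ι × FStep (fractions φ i ι) (encode φ (i , v)) y
    program-step⁻¹ φ ψ s (ι ∷ P) i v st with step-++ (fractions ψ s ι) st
    ... | inj₂ st′ with program-step⁻¹ φ ψ (suc s) P i v st′
    ... | e , κ , h , st″ = e , κ , there h , st″
    program-step⁻¹ φ ψ s (ι ∷ P) i v st | inj₁ st′ with ψ Bool.≟ φ | s ≟ i
    ... | yes refl | yes refl = refl , ι , here , st′
    ... | no ψ≢φ | _ = ⊥-elim (blocked⇒¬step (mismatch φ ψ i s v ι (ψ≢φ ∘ proj₁)) st′)
    ... | yes _ | no s≢i = ⊥-elim (blocked⇒¬step (mismatch φ ψ i s v ι (s≢i ∘ proj₂)) st′)

    module _ (P : List (Instr n)) where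
      fractran : List (ℕ × ℕ)
      fractran = program false 1 P ++ program true 1 P

      simulate : ∀ φ {st st′} → MMStep 1 P st st′ → FStep fractran (encode φ st) (encode (not φ) st′)
      simulate φ {i , v} s with MMStep⇒executes s
      ... | ι , h , e with φ
      ... | false = step-++ˡ (program-step false {v = v} h (executes⇒step false e))
      ... | true = step-++ʳ (program-mismatch true false i v 1 P (λ ())) (program-step true {v = v} h (executes⇒step true e))

      reflect : ∀ φ i v {y} → FStep fractran (encode φ (i , v)) y → ∃ λ st → MMStep 1 P (i , v) st × y ≡ encode (not φ) st
      reflect φ i v {y} s = go (step-++ (program false 1 P) s)
        where
        executed : (∃ λ ι → InstrAt 1 P i ι × FStep (fractions φ i ι) (encode φ (i , v)) y) →
                   ∃ λ st → MMStep 1 P (i , v) st × y ≡ encode (not φ) st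
        executed (ι , h , s) with step⇒executes φ i v ι s
        ... | st , e , y≡ = st , executes⇒MMStep h e , y≡
        go : FStep (program false 1 P) (encode φ (i , v)) y ⊎ FStep (program true 1 P) (encode φ (i , v)) y →
             ∃ λ st → MMStep 1 P (i , v) st × y ≡ encode (not φ) st
        go (inj₁ s) = executed (proj₂ (program-step⁻¹ φ false 1 P i v s))
        go (inj₂ s) = executed (proj₂ (program-step⁻¹ φ true 1 P i v s))

      forward : ∀ φ {st} → MMTerminates 1 P st → FTerminates fractran (encode φ st)
      forward φ {i , v} (_ , ε , out) = encode φ (i , v) , ε , λ y s → stuck out (proj₁ (proj₂ (reflect φ i v s)))
        where
        stuck : ∀ {st′} → OutOfCode 1 P i → ¬ MMStep 1 P (i , v) st′
        stuck out s = instrAt-inside (proj₁ (proj₂ (MMStep⇒executes s))) out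
      forward φ {st} (st′ , s ◅ ss , out) with forward (not φ) (st′ , ss , out)
      ... | x , ts , h = x , simulate φ {st} s ◅ ts , h

      -- Every instruction can be executed in every state, so a number without successor encodes a
      -- state outside the code; before that, each step reflects to a machine step.
      backward : ∀ φ i v {x} → Star (FStep fractran) (encode φ (i , v)) x → (∀ y → ¬ FStep fractran x y) → MMTerminates 1 P (i , v)
      backward φ i v ε h with instrAt-or-out 1 P i
      ... | inj₂ out = (i , v) , ε , out
      ... | inj₁ (ι , at) with executes-total i v ι
      ... | st , e = ⊥-elim (h _ (simulate φ {i , v} {st} (executes⇒MMStep at e)))
      backward φ i v (s ◅ ss) h with reflect φ i v s
      ... | (i′ , v′) , s′ , refl with backward (not φ) i′ v′ ss h
      ... | fin , ts , out = fin , s′ ◅ ts , out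

  mm⪯fractran : MM ⪯ FRACTRAN
  mm⪯fractran = (λ { (n , P , v) → fractran P , encode false (1 , v) }) , λ { (n , P , v) → mk⇔
    (forward P false) (λ { (x , ss , h) → backward P false 1 v ss h }) }

-- Exhaustive search for a match by a structured program.

module PCPToMinsky where

  open Labels
  open BinomialParity using (+*-injective)
  open import Data.Nat
  open import Data.Nat.Properties
  open import Data.Nat.DivMod using (_/_; _%_; m≡m%n+[m/n]*n; m%n<n)
  open import Data.Nat.Induction using (<-wellFounded)
  open import Induction.WellFounded using (Acc; acc)
  open import Data.Fin using (Fin; zero; suc; toℕ; fromℕ<)
  open import Data.Fin.Properties using (toℕ-fromℕ<)
  open import Data.List using (List; []; _∷_; _++_; length; _ʳ++_; reverse; foldr; lookup)
  open import Data.List.Properties using (length-++; reverse-involutive)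
  open import Data.List.Relation.Unary.All using (All; []; _∷_)
  import Data.List.Relation.Unary.All as All
  open import Data.List.Relation.Unary.All.Properties using (++⁺)
  open import Data.Vec using (Vec; []; _∷_; _[_]≔_; _[_]%=_)
  import Data.Vec as Vec

  infixr 4 _⨾_
  data Cmd (n : ℕ) : Set where
    skip  : Cmd n
    incr  : Fin n → Cmd n
    while : Fin n → Cmd n → Cmd n
    if0   : Fin n → Cmd n → Cmd n → Cmd n
    _⨾_   : Cmd n → Cmd n → Cmd n

  -- A non-zero register is decremented when it is tested.
  infix 3 _/_⇓_
  data _/_⇓_ {n} : Cmd n → Vec ℕ n → Vec ℕ n → Set where
    skip   : ∀ {v} → skip / v ⇓ v
    incr   : ∀ {v α} → incr α / v ⇓ v [ α ]%= suc
    while0 : ∀ {v α c} → Vec.lookup v α ≡ 0 → while α c / v ⇓ v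
    whileS : ∀ {v v′ v″ α c u} → Vec.lookup v α ≡ suc u → c / v [ α ]≔ u ⇓ v′ → while α c / v′ ⇓ v″ → while α c / v ⇓ v″
    if0Z   : ∀ {v v′ α c d} → Vec.lookup v α ≡ 0 → c / v ⇓ v′ → if0 α c d / v ⇓ v′
    if0S   : ∀ {v v′ α c d u} → Vec.lookup v α ≡ suc u → d / v [ α ]≔ u ⇓ v′ → if0 α c d / v ⇓ v′
    _⨾_    : ∀ {v v′ v″ c d} → c / v ⇓ v′ → d / v′ ⇓ v″ → c ⨾ d / v ⇓ v″

  to-state : ∀ {n} {c : Cmd n} {v v′ v″} → v′ ≡ v″ → c / v ⇓ v′ → c / v ⇓ v″
  to-state refl w = w

  from-state : ∀ {n} {c : Cmd n} {v v′ v″} → v ≡ v′ → c / v ⇓ v″ → c / v′ ⇓ v″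
  from-state refl w = w

  size : ∀ {n} → Cmd n → ℕ
  size skip = 0
  size (incr α) = 1
  size (while α c) = suc (size c + 1)
  size (if0 α c d) = suc (size d + suc (size c))
  size (c ⨾ d) = size c + size d

  -- Register 0 of the machine always holds 0 and serves for unconditional jumps.
  compile : ∀ {n} → ℕ → Cmd n → List (Instr (suc n))
  compile i skip = []
  compile i (incr α) = INC (suc α) ∷ []
  compile i (while α c) = DEC (suc α) (i + size (while α c)) ∷ compile (suc i) c ++ DEC zero i ∷ []
  compile i (if0 α c d) = DEC (suc α) (suc i + size d + 1) ∷ compile (suc i) d ++ DEC zero (i + size (if0 α c d)) ∷ compile (suc i + size d + 1) c
  compile i (c ⨾ d) = compile i c ++ compile (i + size c) d

  length-compile : ∀ {n} i (c : Cmd n) → length (compile i c) ≡ size c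
  length-compile i skip = refl
  length-compile i (incr α) = refl
  length-compile i (while α c) = cong suc (trans (length-++ (compile (suc i) c)) (cong (_+ 1) (length-compile (suc i) c)))
  length-compile i (if0 α c d) = cong suc (trans (length-++ (compile (suc i) d)) (cong₂ (λ a b → a + suc b) (length-compile (suc i) d) (length-compile _ c)))
  length-compile i (c ⨾ d) = trans (length-++ (compile i c)) (cong₂ _+_ (length-compile i c) (length-compile _ d))

  data CodeAt {A : Set} (s : ℕ) (P : List A) : ℕ → List A → Set where
    []  : ∀ {i} → CodeAt s P i []
    _∷_ : ∀ {i ι ιs} → InstrAt s P i ι → CodeAt s P (suc i) ιs → CodeAt s P i (ι ∷ ιs)

  module _ {A : Set} {s : ℕ} {P : List A} where

    relabel : ∀ {i j xs} → i ≡ j → CodeAt s P i xs → CodeAt s P j xs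
    relabel refl h = h

    codeAt-++ : ∀ {i} xs {ys} → CodeAt s P i (xs ++ ys) → CodeAt s P i xs × CodeAt s P (i + length xs) ys
    codeAt-++ {i} [] h = [] , relabel (sym (+-identityʳ i)) h
    codeAt-++ {i} (x ∷ xs) (p ∷ h) with codeAt-++ xs h
    ... | a , b = p ∷ a , relabel (sym (+-suc i (length xs))) b

  codeAt-self : ∀ {A : Set} s (P : List A) → CodeAt s P s P
  codeAt-self s [] = []
  codeAt-self s (x ∷ P) = here ∷ shift (codeAt-self (suc s) P)
    where
    shift : ∀ {i ιs} → CodeAt (suc s) P i ιs → CodeAt s (x ∷ P) i ιs
    shift [] = []
    shift (p ∷ h) = there p ∷ shift h

  at : ∀ {n} → ℕ → Vec ℕ n → MMState (suc n)
  at i v = i , 0 ∷ v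

  module _ {n : ℕ} {s : ℕ} {P : List (Instr (suc n))} where

    _⟶*_ : MMState (suc n) → MMState (suc n) → Set
    _⟶*_ = Star (MMStep s P)

    move-to : ∀ {st j j′ v} → j ≡ j′ → st ⟶* at j v → st ⟶* at j′ v
    move-to refl h = h

    split-compiled : ∀ i (c : Cmd n) {ys} → CodeAt s P i (compile i c ++ ys) → CodeAt s P i (compile i c) × CodeAt s P (i + size c) ys
    split-compiled i c h with codeAt-++ (compile i c) h
    ... | a , b = a , relabel (cong (i +_) (length-compile i c)) b

    compile-correct : ∀ {c v v′} → c / v ⇓ v′ → ∀ i → CodeAt s P i (compile i c) → at i v ⟶* at (i + size c) v′
    compile-correct skip i h = move-to (sym (+-identityʳ i)) ε
    compile-correct incr i (p ∷ []) = move-to (+-comm 1 i) (inc p ◅ ε)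
    compile-correct (while0 e) i (p ∷ h) = decZ p e ◅ ε
    compile-correct {while α c} (whileS e b w) i (p ∷ h) with split-compiled (suc i) c h
    ... | hc , (q ∷ []) = decS p e ◅ compile-correct b (suc i) hc ◅◅ decZ q refl ◅ compile-correct w i (p ∷ h)
    compile-correct {if0 α c d} (if0Z e b) i (p ∷ h) with split-compiled (suc i) d h
    ... | hd , (q ∷ hc) = decZ p e ◅ move-to (r i (size d) (size c)) (compile-correct b _ (relabel (+-comm 1 _) hc))
      where
      r : ∀ i d c → suc i + d + 1 + c ≡ i + suc (d + suc c)
      r = ℕR.solve-∀
    compile-correct {if0 α c d} (if0S e b) i (p ∷ h) with split-compiled (suc i) d h
    ... | hd , (q ∷ hc) = decS p e ◅ compile-correct b (suc i) hd ◅◅ decZ q refl ◅ ε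
    compile-correct {c ⨾ d} (b₁ ⨾ b₂) i h with split-compiled i c h
    ... | hc , hd = compile-correct b₁ i hc ◅◅ move-to (+-assoc i (size c) (size d)) (compile-correct b₂ (i + size c) hd)

  module _ {n : ℕ} {s : ℕ} {P : List (Instr n)} where

    -- Compilation is proved correct only from commands to runs; determinism supplies the other
    -- direction.
    step-unique : ∀ {st st₁ st₂} → MMStep s P st st₁ → MMStep s P st st₂ → st₁ ≡ st₂
    step-unique (inc p) (inc q) with instrAt-unique p q
    ... | refl = refl
    step-unique (inc p) (decS q _) with instrAt-unique p q
    ... | ()
    step-unique (inc p) (decZ q _) with instrAt-unique p q
    ... | ()
    step-unique (decS p _) (inc q) with instrAt-unique p q
    ... | ()
    step-unique (decS p e) (decS q e′) with instrAt-unique p q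
    ... | refl with trans (sym e) e′
    ... | refl = refl
    step-unique (decS p e) (decZ q e′) with instrAt-unique p q
    ... | refl with trans (sym e) e′
    ... | ()
    step-unique (decZ p _) (inc q) with instrAt-unique p q
    ... | ()
    step-unique (decZ p e) (decS q e′) with instrAt-unique p q
    ... | refl with trans (sym e) e′
    ... | ()
    step-unique (decZ p e) (decZ q e′) with instrAt-unique p q
    ... | refl = refl

    step-inside : ∀ {st st′} → MMStep s P st st′ → ¬ OutOfCode s P (proj₁ st)
    step-inside (inc p) = instrAt-inside p
    step-inside (decS p _) = instrAt-inside p
    step-inside (decZ p _) = instrAt-inside p

    data HaltsIn : ℕ → MMState n → Set where
      now   : ∀ {st} → OutOfCode s P (proj₁ st) → HaltsIn 0 st
      later : ∀ {m st st′} → MMStep s P st st′ → HaltsIn m st′ → HaltsIn (suc m) st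

    terminates⇒haltsIn : ∀ {st} → MMTerminates s P st → ∃ λ m → HaltsIn m st
    terminates⇒haltsIn (st′ , ε , out) = 0 , now out
    terminates⇒haltsIn (st′ , x ◅ xs , out) with terminates⇒haltsIn (st′ , xs , out)
    ... | m , h = suc m , later x h

    haltsIn-after : ∀ {m st st′} → HaltsIn m st → Star (MMStep s P) st st′ → ∃ λ m′ → m′ ≤ m × HaltsIn m′ st′
    haltsIn-after h ε = _ , ≤-refl , h
    haltsIn-after (now out) (x ◅ xs) = ⊥-elim (step-inside x out)
    haltsIn-after (later y h) (x ◅ xs) with step-unique x y
    ... | refl with haltsIn-after h xs
    ... | m′ , le , h′ = m′ , m≤n⇒m≤1+n le , h′

  module Loop {n : ℕ} (α : Fin n) (c : Cmd n) where

    loop : List (Instr (suc n))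
    loop = compile 1 (while α c)

    loop-code : CodeAt 1 loop 1 loop
    loop-code = codeAt-self 1 loop

    loop-terminates : ∀ {v v′} → while α c / v ⇓ v′ → MMTerminates 1 loop (at 1 v)
    loop-terminates {v′ = v′} w = at (1 + size (while α c)) v′ , compile-correct w 1 loop-code
      , inj₂ (≤-reflexive (cong suc (length-compile 1 (while α c))))

    iterate : ∀ {v u v′} → Vec.lookup v α ≡ suc u → c / v [ α ]≔ u ⇓ v′ →
              ∃ λ st → MMStep 1 loop (at 1 v) st × Star (MMStep 1 loop) st (at 1 v′)
    iterate e w with loop-code
    ... | p ∷ h with split-compiled 2 c h
    ... | hc , (j ∷ []) = _ , decS p e , compile-correct w 2 hc ◅◅ decZ j refl ◅ ε

    -- While M is not good, the loop returns to its head after at least one step. By determinism a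
    -- halting run passes through that state with fewer steps left, so the descent ends at a good M.
    terminates⇒good : ∀ {Good : ℕ → Set} (V : ℕ → Vec ℕ n) →
      (∀ M → Good M ⊎ (∃ λ u → Vec.lookup (V M) α ≡ suc u × c / V M [ α ]≔ u ⇓ V (suc M))) →
      MMTerminates 1 loop (at 1 (V 0)) → ∃ Good
    terminates⇒good {Good} V advance h with terminates⇒haltsIn h
    ... | l , hl = go l 0 (<-wellFounded l) hl
      where
      go : ∀ l M → Acc _<_ l → HaltsIn {s = 1} {loop} l (at 1 (V M)) → ∃ Good
      go l M (acc rs) h with advance M
      ... | inj₁ good = M , good
      ... | inj₂ (u , e , w) with iterate e w
      go l M (acc rs) (now out) | inj₂ (u , e , w) | st , x , xs = ⊥-elim (step-inside x out)
      go (suc l) M (acc rs) (later y h) | inj₂ (u , e , w) | st , x , xs with step-unique x y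
      ... | refl with haltsIn-after h xs
      ... | l′ , l′≤l , h′ = go l′ (suc M) (rs (s≤s l′≤l)) h′

  incs : ∀ {n} → ℕ → Fin n → Cmd n
  incs zero α = skip
  incs (suc k) α = incr α ⨾ incs k α

  -- #g: no solution found yet; #m: code of the current candidate; #n: what is left to decode, with
  -- quotient #q; #a, #b: the numbers denoted by the two strings; #t: scratch; #f: division in progress.
  pattern #g = zero
  pattern #m = suc zero
  pattern #n = suc (suc zero)
  pattern #q = suc (suc (suc zero))
  pattern #a = suc (suc (suc (suc zero)))
  pattern #b = suc (suc (suc (suc (suc zero))))
  pattern #t = suc (suc (suc (suc (suc (suc zero)))))
  pattern #f = suc (suc (suc (suc (suc (suc (suc zero))))))

  State : Set
  State = Vec ℕ 8

  copyM : Cmd 8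
  copyM = while #m (incr #n ⨾ incr #t) ⨾ while #t (incr #m)

  copyM-run : ∀ {M} → copyM / 0 ∷ M ∷ 0 ∷ 0 ∷ 0 ∷ 0 ∷ 0 ∷ 0 ∷ [] ⇓ 0 ∷ M ∷ M ∷ 0 ∷ 0 ∷ 0 ∷ 0 ∷ 0 ∷ []
  copyM-run {M} = to-state (cong₂ (λ x y → 0 ∷ 0 ∷ x ∷ 0 ∷ 0 ∷ 0 ∷ y ∷ 0 ∷ []) (+-identityʳ M) (+-identityʳ M)) (out M)
                ⨾ to-state (cong (λ x → 0 ∷ x ∷ M ∷ 0 ∷ 0 ∷ 0 ∷ 0 ∷ 0 ∷ []) (+-identityʳ M)) (back M)
    where
    out : ∀ k {x y} → while #m (incr #n ⨾ incr #t) / 0 ∷ k ∷ x ∷ 0 ∷ 0 ∷ 0 ∷ y ∷ 0 ∷ [] ⇓ 0 ∷ 0 ∷ k + x ∷ 0 ∷ 0 ∷ 0 ∷ k + y ∷ 0 ∷ []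
    out zero = while0 refl
    out (suc k) {x} {y} = whileS refl (incr ⨾ incr)
      (to-state (cong₂ (λ x y → 0 ∷ 0 ∷ x ∷ 0 ∷ 0 ∷ 0 ∷ y ∷ 0 ∷ []) (+-suc k x) (+-suc k y)) (out k))
    back : ∀ k {x} → while #t (incr #m) / 0 ∷ x ∷ M ∷ 0 ∷ 0 ∷ 0 ∷ k ∷ 0 ∷ [] ⇓ 0 ∷ k + x ∷ M ∷ 0 ∷ 0 ∷ 0 ∷ 0 ∷ 0 ∷ []
    back zero = while0 refl
    back (suc k) {x} = whileS refl incr (to-state (cong (λ x → 0 ∷ x ∷ M ∷ 0 ∷ 0 ∷ 0 ∷ 0 ∷ 0 ∷ []) (+-suc k x)) (back k))

  affine : Fin 8 → ℕ → ℕ → Cmd 8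
  affine α c e = while α (incs c #t) ⨾ while #t (incr α) ⨾ incs e α

  module _ {M Z Q F : ℕ} where

    private
      S : ℕ → ℕ → ℕ → State
      S A B T = 0 ∷ M ∷ Z ∷ Q ∷ A ∷ B ∷ T ∷ F ∷ []

    incs-t : ∀ k {A B T} → incs k #t / S A B T ⇓ S A B (k + T)
    incs-t zero = skip
    incs-t (suc k) {A} {B} {T} = incr ⨾ to-state (cong (λ x → S A B x) (+-suc k T)) (incs-t k)

    incs-a : ∀ k {A B T} → incs k #a / S A B T ⇓ S (k + A) B T
    incs-a zero = skip
    incs-a (suc k) {A} {B} {T} = incr ⨾ to-state (cong (λ x → S x B T) (+-suc k A)) (incs-a k)

    incs-b : ∀ k {A B T} → incs k #b / S A B T ⇓ S A (k + B) T
    incs-b zero = skip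
    incs-b (suc k) {A} {B} {T} = incr ⨾ to-state (cong (λ x → S A x T) (+-suc k B)) (incs-b k)

    affine-a : ∀ c e {A B} → affine #a c e / S A B 0 ⇓ S (e + A * c) B 0
    affine-a c e {A} {B} = to-state (cong (λ x → S 0 B x) (+-identityʳ (A * c))) (mult A)
                         ⨾ to-state (cong (λ x → S x B 0) (+-identityʳ (A * c))) (back (A * c)) ⨾ incs-a e
      where
      mult : ∀ k {T} → while #a (incs c #t) / S k B T ⇓ S 0 B (k * c + T)
      mult zero = while0 refl
      mult (suc k) {T} = whileS refl (incs-t c) (to-state (cong (λ x → S 0 B x) (r k c T)) (mult k))
        where
        r : ∀ k c T → k * c + (c + T) ≡ c + k * c + T
        r = ℕR.solve-∀
      back : ∀ k {A} → while #t (incr #a) / S A B k ⇓ S (k + A) B 0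
      back zero = while0 refl
      back (suc k) {A} = whileS refl incr (to-state (cong (λ x → S x B 0) (+-suc k A)) (back k))

    affine-b : ∀ c e {A B} → affine #b c e / S A B 0 ⇓ S A (e + B * c) 0
    affine-b c e {A} {B} = to-state (cong (λ x → S A 0 x) (+-identityʳ (B * c))) (mult B)
                         ⨾ to-state (cong (λ x → S A x 0) (+-identityʳ (B * c))) (back (B * c)) ⨾ incs-b e
      where
      mult : ∀ k {T} → while #b (incs c #t) / S A k T ⇓ S A 0 (k * c + T)
      mult zero = while0 refl
      mult (suc k) {T} = whileS refl (incs-t c) (to-state (cong (λ x → S A 0 x) (r k c T)) (mult k))
        where
        r : ∀ k c T → k * c + (c + T) ≡ c + k * c + T
        r = ℕR.solve-∀
      back : ∀ k {B} → while #t (incr #b) / S A B k ⇓ S A (k + B) 0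
      back zero = while0 refl
      back (suc k) {B} = whileS refl incr (to-state (cong (λ x → S A x 0) (+-suc k B)) (back k))

  -- A test decrements a non-zero register, so incrementing in both branches turns a flag of 0 or 1
  -- into 1. The flag is raised as soon as one of the two numbers runs out before the other.
  setG compareAB : Cmd 8
  setG = if0 #g (incr #g) (incr #g)
  compareAB = while #a (if0 #b setG skip) ⨾ while #b setG

  module _ {M : ℕ} where
    private
      S : ℕ → ℕ → ℕ → State
      S G A B = G ∷ M ∷ 0 ∷ 0 ∷ A ∷ B ∷ 0 ∷ 0 ∷ []

    compare-same : ∀ A → compareAB / S 0 A A ⇓ S 0 0 0
    compare-same A = go A ⨾ while0 refl
      where
      go : ∀ A → while #a (if0 #b setG skip) / S 0 A A ⇓ S 0 0 0
      go zero = while0 refl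
      go (suc A) = whileS refl (if0S refl skip) (go A)

    flag : ∀ {G A B} → G ≤ 1 → setG / S G A B ⇓ S 1 A B
    flag {zero} _ = if0Z refl incr
    flag {suc zero} _ = if0S refl incr
    flag {suc (suc _)} (s≤s ())

    drain-b : ∀ B {G} → G ≤ 1 → B ≢ 0 ⊎ G ≡ 1 → while #b setG / S G 0 B ⇓ S 1 0 0
    drain-b zero _ (inj₁ B≢0) = ⊥-elim (B≢0 refl)
    drain-b zero _ (inj₂ refl) = while0 refl
    drain-b (suc B) G≤1 _ = whileS refl (flag G≤1) (drain-b B ≤-refl (inj₂ refl))

    compare-flag : ∀ A B {G} → G ≤ 1 → A ≢ B ⊎ G ≡ 1 → compareAB / S G A B ⇓ S 1 0 0
    compare-flag zero B G≤1 h = while0 refl ⨾ drain-b B G≤1 (Data.Sum.map₁ (λ z≢B e → z≢B (sym e)) h)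
    compare-flag (suc A) zero G≤1 h with compare-flag A zero ≤-refl (inj₂ refl)
    ... | w ⨾ d = whileS refl (if0Z refl (flag G≤1)) w ⨾ d
    compare-flag (suc A) (suc B) G≤1 h with compare-flag A B G≤1 (Data.Sum.map₁ (λ ne e → ne (cong suc e)) h)
    ... | w ⨾ d = whileS refl (if0S refl skip) w ⨾ d

  -- A string is read as a number in base β with digits suc c, least significant first, so that
  -- prepending a fixed string is an affine map and the empty string is the only one denoting 0.
  module Numeral (β : ℕ) where
    numeral : List ℕ → ℕ
    numeral [] = 0
    numeral (c ∷ u) = suc c + β * numeral u

    numeral-++ : ∀ u w → numeral (u ++ w) ≡ numeral u + numeral w * β ^ length u
    numeral-++ [] w = sym (*-identityʳ _)
    numeral-++ (c ∷ u) w = trans (cong (λ z → suc c + β * z) (numeral-++ u w)) (r (suc c) β (numeral u) (numeral w) (β ^ length u))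
      where
      r : ∀ c β u w p → c + β * (u + w * p) ≡ c + β * u + w * (β * p)
      r = ℕR.solve-∀

    Digits : List ℕ → Set
    Digits = All (λ c → suc c < β)

    numeral-injective : ∀ {u w} → Digits u → Digits w → numeral u ≡ numeral w → u ≡ w
    numeral-injective [] [] _ = refl
    numeral-injective {c ∷ u} {d ∷ w} (p ∷ ps) (r ∷ rs) e with +*-injective (suc c) (suc d) (numeral u) (numeral w) p r e
    ... | refl , e′ = cong (c ∷_) (numeral-injective ps rs e′)

  module Search (P₀ : String × String) (Ps : List (String × String)) where

    P : List (String × String)
    P = P₀ ∷ Ps

    k : ℕ
    k = length P

    bound : ℕ → List ℕ → ℕ
    bound = foldr _⊔_

    -- Two more than the largest letter, so that every digit `suc c` is below the base.
    β : ℕ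
    β = suc (suc (foldr (λ { (u , w) z → bound (bound z u) w }) 0 P))

    open Numeral β

    bound-≥ : ∀ z u → z ≤ bound z u
    bound-≥ z [] = ≤-refl
    bound-≥ z (c ∷ u) = ≤-trans (bound-≥ z u) (m≤n⊔m c _)

    bound-all : ∀ z u → All (_≤ bound z u) u
    bound-all z [] = []
    bound-all z (c ∷ u) = m≤m⊔n c _ ∷ All.map (λ h → ≤-trans h (m≤n⊔m c _)) (bound-all z u)

    bounded : ∀ Ps i → let z = foldr (λ { (u , w) z → bound (bound z u) w }) 0 Ps in
              All (_≤ z) (proj₁ (lookup Ps i)) × All (_≤ z) (proj₂ (lookup Ps i))
    bounded ((u , w) ∷ Ps) zero = All.map (λ h → ≤-trans h (bound-≥ _ w)) (bound-all _ u) , bound-all _ w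
    bounded ((u , w) ∷ Ps) (suc i) with bounded Ps i
    ... | p , q = All.map up p , All.map up q
      where
      z = foldr (λ { (u , w) z → bound (bound z u) w }) 0 Ps
      up : ∀ {c} → c ≤ z → c ≤ bound (bound z u) w
      up h = ≤-trans h (≤-trans (bound-≥ z u) (bound-≥ (bound z u) w))

    digits-tops : ∀ js → Digits (tops P js)
    digits-tops [] = []
    digits-tops (j ∷ js) = ++⁺ (All.map (λ h → s≤s (s≤s h)) (proj₁ (bounded P j))) (digits-tops js)

    digits-bots : ∀ js → Digits (bots P js)
    digits-bots [] = []
    digits-bots (j ∷ js) = ++⁺ (All.map (λ h → s≤s (s≤s h)) (proj₂ (bounded P j))) (digits-bots js)

    apply : String × String → Cmd 8
    apply (u , w) = affine #a (β ^ length u) (numeral u) ⨾ affine #b (β ^ length w) (numeral w)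

    -- Subtracts length Ps from register #n; if this fails, the remainder selects a pair.
    dispatch : List (String × String) → Cmd 8
    dispatch [] = incr #q ⨾ incr #f
    dispatch (p ∷ Ps) = if0 #n (apply p) (dispatch Ps)

    -- The test of `#n` strips the leading successor of a code. The inner loop then subtracts k
    -- repeatedly until a remainder selects a pair, and the quotient is left to decode.
    decode : Cmd 8
    decode = while #n (incr #f ⨾ while #f (dispatch P) ⨾ while #q (incr #n))

    body : Cmd 8
    -- Incrementing first skips the code 0 of the empty sequence.
    body = incr #m ⨾ copyM ⨾ decode ⨾ compareAB

    search : Cmd 8
    search = while #g body

    -- Bijective numeration in base k, so that every number is the code of a sequence and counting
    -- misses none.
    encode : List (Fin k) → ℕ
    encode [] = 0
    encode (i ∷ is) = suc (toℕ i + k * encode is)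

    decodable : ∀ M → ∃ λ is → encode is ≡ M
    decodable M = go M (<-wellFounded M)
      where
      go : ∀ M → Acc _<_ M → ∃ λ is → encode is ≡ M
      go zero _ = [] , refl
      go (suc M) (acc rs) with go (M / k) (rs (s≤s (quotient-≤ M)))
        where
        quotient-≤ : ∀ M → M / k ≤ M
        quotient-≤ M = ≤-trans (m≤m*n (M / k) k) (≤-trans (m≤n+m _ (M % k)) (≤-reflexive (sym (m≡m%n+[m/n]*n M k))))
      ... | is , e = fromℕ< (m%n<n M k) ∷ is
          , cong suc (trans (cong₂ (λ x y → x + k * y) (toℕ-fromℕ< (m%n<n M k)) e)
              (trans (cong (M % k +_) (*-comm k (M / k))) (sym (m≡m%n+[m/n]*n M k))))

    module _ {M : ℕ} where
      private
        S : ℕ → ℕ → ℕ → ℕ → ℕ → State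
        S Z Q A B F = 0 ∷ M ∷ Z ∷ Q ∷ A ∷ B ∷ 0 ∷ F ∷ []

      apply-run : ∀ u w {Z Q A B F} → apply (u , w) / S Z Q A B F ⇓ S Z Q (numeral u + A * β ^ length u) (numeral w + B * β ^ length w) F
      apply-run u w = affine-a (β ^ length u) (numeral u) ⨾ affine-b (β ^ length w) (numeral w)

      dispatch-hit : ∀ (Ps : List (String × String)) (i : Fin (length Ps)) {Q A B F} → dispatch Ps / S (toℕ i) Q A B F ⇓
        S 0 Q (numeral (proj₁ (lookup Ps i)) + A * β ^ length (proj₁ (lookup Ps i)))
              (numeral (proj₂ (lookup Ps i)) + B * β ^ length (proj₂ (lookup Ps i))) F
      dispatch-hit ((u , w) ∷ Ps) zero = if0Z refl (apply-run u w)
      dispatch-hit (_ ∷ Ps) (suc i) = if0S refl (dispatch-hit Ps i)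

      dispatch-miss : ∀ Ps {Z Q A B F} → dispatch Ps / S (length Ps + Z) Q A B F ⇓ S Z (suc Q) A B (suc F)
      dispatch-miss [] = incr ⨾ incr
      dispatch-miss (_ ∷ Ps) = if0S refl (dispatch-miss Ps)

      divide : ∀ i Q′ {Q js} → while #f (dispatch P) / S (toℕ i + k * Q′) Q (numeral (tops P js)) (numeral (bots P js)) 1
                                 ⇓ S 0 (Q′ + Q) (numeral (tops P (i ∷ js))) (numeral (bots P (i ∷ js))) 0
      divide i zero {Q} {js} = whileS refl (from-state (cong (λ x → S x Q (numeral (tops P js)) (numeral (bots P js)) 0) (sym (trans (cong (toℕ i +_) (*-zeroʳ k)) (+-identityʳ (toℕ i))))) (dispatch-hit P i))
        (to-state (cong₂ (λ x y → S 0 Q x y 0) (sym (numeral-++ (proj₁ (lookup P i)) (tops P js))) (sym (numeral-++ (proj₂ (lookup P i)) (bots P js)))) (while0 refl))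
      divide i (suc Q′) {Q} {js} = whileS refl
        (from-state (cong (λ x → S x Q (numeral (tops P js)) (numeral (bots P js)) 0) (r (toℕ i) k Q′)) (dispatch-miss P))
        (to-state (cong (λ x → S 0 x (numeral (tops P (i ∷ js))) (numeral (bots P (i ∷ js))) 0) (+-suc Q′ Q)) (divide i Q′ {js = js}))
        where
        r : ∀ i k Q → k + (i + k * Q) ≡ i + k * suc Q
        r = ℕR.solve-∀

      restore : ∀ Q {Z A B} → while #q (incr #n) / S Z Q A B 0 ⇓ S (Q + Z) 0 A B 0
      restore zero = while0 refl
      restore (suc Q) {Z} {A} {B} = whileS refl incr (to-state (cong (λ x → S x 0 A B 0) (+-suc Q Z)) (restore Q))

      -- The strings of a decoded index are put in front of those collected so far, so the candidate
      -- tested is the reversed sequence.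
      decode-run : ∀ is js → decode / S (encode is) 0 (numeral (tops P js)) (numeral (bots P js)) 0
                               ⇓ S 0 0 (numeral (tops P (is ʳ++ js))) (numeral (bots P (is ʳ++ js))) 0
      decode-run [] js = while0 refl
      decode-run (i ∷ is) js = whileS refl
        (incr ⨾ to-state (cong (λ x → S 0 x (numeral (tops P (i ∷ js))) (numeral (bots P (i ∷ js))) 0) (+-identityʳ (encode is))) (divide i (encode is) {js = js})
              ⨾ to-state (cong (λ x → S x 0 (numeral (tops P (i ∷ js))) (numeral (bots P (i ∷ js))) 0) (+-identityʳ (encode is))) (restore (encode is)))
        (decode-run is (i ∷ js))

    Solves : List (Fin k) → Set
    Solves js = numeral (tops P js) ≡ numeral (bots P js)

    V : ℕ → ℕ → State
    V G M = G ∷ M ∷ 0 ∷ 0 ∷ 0 ∷ 0 ∷ 0 ∷ 0 ∷ []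

    compared : List (Fin k) → ℕ → State
    compared is M = 0 ∷ suc M ∷ 0 ∷ 0 ∷ numeral (tops P (reverse is)) ∷ numeral (bots P (reverse is)) ∷ 0 ∷ 0 ∷ []

    body-run : ∀ is {M G} → encode is ≡ suc M →
               compareAB / compared is M ⇓ V G (suc M) →
               body / V 0 M ⇓ V G (suc M)
    body-run is {M} e c = incr ⨾ copyM-run ⨾ subst (λ x → decode / 0 ∷ suc M ∷ x ∷ 0 ∷ 0 ∷ 0 ∷ 0 ∷ 0 ∷ [] ⇓ compared is M) e (decode-run is []) ⨾ c

    body-solved : ∀ is {M} → encode is ≡ suc M → Solves (reverse is) → body / V 0 M ⇓ V 0 (suc M)
    body-solved is {M} e h = body-run is e
      (subst (λ x → compareAB / 0 ∷ suc M ∷ 0 ∷ 0 ∷ numeral (tops P (reverse is)) ∷ x ∷ 0 ∷ 0 ∷ [] ⇓ V 0 (suc M)) h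
        (compare-same (numeral (tops P (reverse is)))))

    body-unsolved : ∀ is {M} → encode is ≡ suc M → ¬ Solves (reverse is) → body / V 0 M ⇓ V 1 (suc M)
    body-unsolved is e h = body-run is e (compare-flag (numeral (tops P (reverse is))) (numeral (bots P (reverse is))) z≤n (inj₁ h))

    solves? : ∀ js → Dec (Solves js)
    solves? js = numeral (tops P js) ≟ numeral (bots P js)

    open Loop #g body

    solved : ∀ js → js ≢ [] → Solves js → PCP P
    solved js ne h = js , ne , numeral-injective (digits-tops js) (digits-bots js) h

    -- Recursion on the distance d to a known solution; the search may stop earlier, at another one.
    search-run : ∀ d {M} is → encode is ≡ suc d + M → Solves (reverse is) → ∃ λ v → search / V 1 M ⇓ v
    search-run d {M} is e h with decodable (suc M)
    ... | is′ , e′ with solves? (reverse is′)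
    ... | yes s = V 0 (suc M) , whileS refl (body-solved is′ e′ s) (while0 refl)
    search-run zero is e h | is′ , e′ | no _ = V 0 _ , whileS refl (body-solved is e h) (while0 refl)
    search-run (suc d) {M} is e h | is′ , e′ | no ¬s with search-run d {suc M} is (trans e (cong suc (sym (+-suc d M)))) h
    ... | v , w = v , whileS refl (body-unsolved is′ e′ ¬s) w

    pcp⇒terminates : PCP P → MMTerminates 1 loop (1 , 0 ∷ V 1 0)
    pcp⇒terminates (js , ne , e) with encode (reverse js) in eq
    ... | zero = ⊥-elim (ne (trans (sym (reverse-involutive js)) (cong reverse (encode-0 (reverse js) eq))))
      where
      encode-0 : ∀ is → encode is ≡ 0 → is ≡ []
      encode-0 [] _ = refl
    ... | suc d with search-run d (reverse js) (trans eq (cong suc (sym (+-identityʳ d)))) (subst Solves (sym (reverse-involutive js)) (cong numeral e))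
    ... | v , w = loop-terminates w

    advance : ∀ M → PCP P ⊎ (∃ λ u → 1 ≡ suc u × body / u ∷ M ∷ 0 ∷ 0 ∷ 0 ∷ 0 ∷ 0 ∷ 0 ∷ [] ⇓ V 1 (suc M))
    advance M with decodable (suc M)
    ... | is , e with solves? (reverse is)
    ... | yes s = inj₁ (solved (reverse is) (λ r → is≢[] e (trans (sym (reverse-involutive is)) (cong reverse r))) s)
      where
      is≢[] : ∀ {is} → encode is ≡ suc M → is ≢ []
      is≢[] () refl
    ... | no ¬s = inj₂ (0 , refl , body-unsolved is e ¬s)

    pcp⇔terminates : PCP P ⇔ MM (9 , loop , 0 ∷ V 1 0)
    pcp⇔terminates = mk⇔ pcp⇒terminates (λ h → proj₂ (terminates⇒good (V 1) advance h))

  pcp⪯mm : PCP ⪯ MM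
  -- The division in the decoding needs k > 0. Without pairs there is no match, and the machine is a
  -- jump to itself.
  pcp⪯mm = (λ { [] → 1 , idle , 0 ∷ [] ; (p ∷ P) → 9 , Loop.loop #g (Search.body p P) , 0 ∷ Search.V p P 1 0 })
         , λ { [] → mk⇔ (λ { ([] , ne , _) → ⊥-elim (ne refl) ; (() ∷ _ , _) }) (λ { (st , xs , out) → ⊥-elim (forever xs out) })
             ; (p ∷ P) → Search.pcp⇔terminates p P }
    where
    idle : List (Instr 1)
    idle = DEC zero 1 ∷ []
    forever : ∀ {st} → Star (MMStep 1 idle) (1 , 0 ∷ []) st → ¬ OutOfCode 1 idle (proj₁ st)
    forever ε (inj₁ (s≤s ()))
    forever ε (inj₂ (s≤s ()))
    forever (decZ here refl ◅ xs) out = forever xs out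
    forever (decZ (there ()) _ ◅ xs) out
    forever (decS (there ()) _ ◅ xs) out
    forever (inc (there ()) ◅ xs) out

-- The chain of reductions and the transfer of decidability.

open Equations using (⪯-trans; dio-form⪯dio-elem; dio-elem⪯dio-single; dio-single⪯h10)
open TuringToPCP using (halt⪯pcp)
open PCPToMinsky using (pcp⪯mm)
open MinskyToFractran using (mm⪯fractran)
open PackedRuns using (fractran⪯dio-form)

halt⪯h10 : Halt ⪯ H10
halt⪯h10 = ⪯-trans {S = H10} halt⪯pcp (⪯-trans {S = H10} pcp⪯mm (⪯-trans {S = H10} mm⪯fractran
  (⪯-trans {S = H10} fractran⪯dio-form (⪯-trans {S = H10} dio-form⪯dio-elem
    (⪯-trans {S = H10} dio-elem⪯dio-single dio-single⪯h10)))))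

⪯-decides : ∀ {X Y : Set} {P : X → Set} {Q : Y → Set} → P ⪯ Q → (∀ y → Dec (Q y)) → ∀ x → Dec (P x)
⪯-decides (f , h) d x = Dec-map (⇔-sym (h x)) (d (f x))

theorem7p4 : (Halt ⪯ PCP) × (PCP ⪯ MM) × (MM ⪯ FRACTRAN) × (FRACTRAN ⪯ DIO-FORM)
    × (DIO-FORM ⪯ DIO-ELEM) × (DIO-ELEM ⪯ DIO-SINGLE) × (DIO-SINGLE ⪯ H10)
    × ((∀ x → Dec (H10 x)) → ∀ x → Dec (Halt x))
theorem7p4 = halt⪯pcp , pcp⪯mm , mm⪯fractran , fractran⪯dio-form , dio-form⪯dio-elem , dio-elem⪯dio-single
  , dio-single⪯h10 , ⪯-decides {Q = H10} halt⪯h10
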